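{- Let $f(t),g(t)\in\mathbb{C}[[t]]$ be a delta series and an invertible series respectively, and let $r\ge 1$ be an integer. For every $n\ge0$, the Legendre-Gould Hopper based Sheffer polynomials ${}_{{}_{r}LeG^{(r)}}s_{n}(x,y,z)$ satisfy $${}_{{}_{r}LeG^{(r)}}s_{n}(x,y,z)=\int_{0}^{\infty} e^{ -s}\;{}_{{}_{r}LeG^{(r)}}s_{n}(x,y,sD_{z}^{ -1})\,ds.$$
   Context: A delta series is $f\in\mathbb{C}[[t]]$ with $f(0)=0$, $f'(0)\neq 0$; $f^{ -1}$ denotes its compositional inverse. An invertible series is $g\in\mathbb{C}[[t]]$ with $g(0)\ne 0$. $C_0(x)=\sum_{k\ge 0}\frac{(-1)^k x^k}{(k!)^2}$. $D_z^{ -1}$ is the inverse derivative operator in $z$, $D_z^{ -1}h=\int_0^z h\,d\zeta$, so $D_z^{ -k}\{1\}=z^k/k!$. For a polynomial $p(x,y,z)=\sum_k p_k(x,y)z^k$, the expression $p(x,y,sD_z^{ -1})$ means the operator obtained by substituting $sD_z^{ -1}$ for $z$, applied to the constant $1$: $p(x,y,sD_z^{ -1})=\sum_k p_k(x,y)s^kD_z^{ -k}\{1\}=\sum_k p_k(x,y)\frac{s^kz^k}{k!}$. The polynomials are determined by the generating function $$\frac{1}{g(f^{ -1}(t))}\,C_0\!\left(x f^{ -1}(t)\right)C_0\!\left(-y f^{ -1}(t)\right)\exp\!\left(z\,(f^{ -1}(t))^r\right)=\sum_{n=0}^{\infty}{}_{{}_{r}LeG^{(r)}}s_{n}(x,y,z)\frac{t^n}{(n!)^2}.$$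 -}

module Defs where

open import Algebra.Bundles.Raw using (RawRing)
import Algebra.Definitions.RawSemiring as RawPower
open import Data.Integer using (+_; -1ℤ)
import Data.Integer as ℤ
import Data.Integer.Properties as ℤₚ
open import Data.List using (List; []; _∷_; map; length)
open import Data.Nat using (ℕ; zero; suc; _!)
import Data.Nat as ℕ
import Data.Nat.Properties as ℕₚ
open import Data.Nat.GeneralisedArithmetic using (fold)
open import Data.Product using (∃-syntax; _×_; _,_; proj₁; proj₂)
open import Data.Rational using (ℚ; 0ℚ; 1ℚ)
import Data.Rational as Rat
import Data.Rational.Properties as ℚₚ
open import Data.Rational.Solver using (module +-*-Solver)
import Data.Rational.Unnormalised as ℚᵘ
import Data.Rational.Unnormalised.Properties as ℚᵘₚ
open import Data.Sum using (inj₁; inj₂)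
open import Function using (id; _∘_)
open import Level using (0ℓ)
open import Relation.Binary.PropositionalEquality
  using (_≡_; refl; sym; trans; cong; cong₂; subst)

module FiniteSums (R : RawRing 0ℓ 0ℓ) where
  open RawRing R
  open RawPower rawSemiring public using (_^_)

  -- ∑ n a = a 0 + … + a (n - 1)
  ∑ : ℕ → (ℕ → Carrier) → Carrier
  ∑ zero    a = 0#
  ∑ (suc n) a = ∑ n a + a n

module Estimates where
  open Rat
  open ℚₚ
  open ℚₚ.≤-Reasoning
  open +-*-Solver using (solve; _:+_; _:*_; _:-_; :-_; _:=_; con)
  open FiniteSums Rat.+-*-rawRing

  IsCauchy : (ℕ → ℚ) → Set
  IsCauchy x = ∀ ε → 0ℚ < ε →
    ∃[ N ] (∀ m n → N ℕ.≤ m → N ℕ.≤ n → ∣ x m - x n ∣ < ε)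

  invFact : ℕ → ℚ
  invFact n = (+ 1 / n !) {{n ℕₚ.!≢0}}

  expTerm : ℚ → ℕ → ℚ
  expTerm q k = q ^ k * invFact k

  expSum : ℕ → ℚ → ℚ
  expSum n q = ∑ n (expTerm q)

  *-mono : ∀ {p q r s} → 0ℚ ≤ r → 0ℚ ≤ q → p ≤ q → r ≤ s → p * r ≤ q * s
  *-mono {p} {q} {r} {s} 0≤r 0≤q p≤q r≤s = ≤-trans
    (*-monoʳ-≤-nonNeg r {{nonNegative 0≤r}} p≤q)
    (*-monoˡ-≤-nonNeg q {{nonNegative 0≤q}} r≤s)

  0≤* : ∀ {p q} → 0ℚ ≤ p → 0ℚ ≤ q → 0ℚ ≤ p * q
  0≤* {p} {q} 0≤p 0≤q = subst (_≤ p * q) (*-zeroˡ 0ℚ) (*-mono ≤-refl 0≤p 0≤p 0≤q)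

  0≤+ : ∀ {p q} → 0ℚ ≤ p → 0ℚ ≤ q → 0ℚ ≤ p + q
  0≤+ {p} {q} 0≤p 0≤q = subst (_≤ p + q) (+-identityˡ 0ℚ) (+-mono-≤ 0≤p 0≤q)

  0≤1 : 0ℚ ≤ 1ℚ
  0≤1 = nonNegative⁻¹ 1ℚ

  ≤+ʳ : ∀ {p q} → 0ℚ ≤ q → p ≤ p + q
  ≤+ʳ {p} {q} 0≤q = subst (_≤ p + q) (+-identityʳ p) (+-monoʳ-≤ p 0≤q)

  ≤+ˡ : ∀ {p q} → 0ℚ ≤ q → p ≤ q + p
  ≤+ˡ {p} {q} 0≤q = subst (_≤ q + p) (+-identityˡ p) (+-monoˡ-≤ p 0≤q)

  p≤q⇒0≤q-p : ∀ {p q} → p ≤ q → 0ℚ ≤ q - p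
  p≤q⇒0≤q-p {p} {q} p≤q = subst (_≤ q - p) (+-inverseʳ p) (+-monoˡ-≤ (- p) p≤q)

  p≤∣p∣ : ∀ p → p ≤ ∣ p ∣
  p≤∣p∣ p with ≤-total 0ℚ p
  ... | inj₁ 0≤p = ≤-reflexive (sym (0≤p⇒∣p∣≡p 0≤p))
  ... | inj₂ p≤0 = ≤-trans p≤0 (0≤∣p∣ p)

  triangle : ∀ p q r → ∣ p - r ∣ ≤ ∣ p - q ∣ + ∣ q - r ∣
  triangle p q r = begin
    ∣ p - r ∣               ≡⟨ cong ∣_∣ (solve 3 (λ p q r → p :- r := (p :- q) :+ (q :- r)) refl p q r) ⟩
    ∣ (p - q) + (q - r) ∣   ≤⟨ ∣p+q∣≤∣p∣+∣q∣ (p - q) (q - r) ⟩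
    ∣ p - q ∣ + ∣ q - r ∣   ∎

  ∣-∣-sym : ∀ p q → ∣ p - q ∣ ≡ ∣ q - p ∣
  ∣-∣-sym p q = trans (sym (∣-p∣≡∣p∣ (p - q)))
    (cong ∣_∣ (solve 2 (λ p q → :- (p :- q) := q :- p) refl p q))

  ∣p∣≤∣p-q∣+∣q∣ : ∀ p q → ∣ p ∣ ≤ ∣ p - q ∣ + ∣ q ∣
  ∣p∣≤∣p-q∣+∣q∣ p q = begin
    ∣ p ∣              ≡⟨ cong ∣_∣ (solve 2 (λ p q → p := (p :- q) :+ q) refl p q) ⟩
    ∣ (p - q) + q ∣    ≤⟨ ∣p+q∣≤∣p∣+∣q∣ (p - q) q ⟩
    ∣ p - q ∣ + ∣ q ∣  ∎

  ∣∣p∣-∣q∣∣≤∣p-q∣ : ∀ p q → ∣ ∣ p ∣ - ∣ q ∣ ∣ ≤ ∣ p - q ∣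
  ∣∣p∣-∣q∣∣≤∣p-q∣ p q with ≤-total ∣ p ∣ ∣ q ∣
  ... | inj₁ ∣p∣≤∣q∣ = begin
    ∣ ∣ p ∣ - ∣ q ∣ ∣             ≡⟨ ∣-∣-sym ∣ p ∣ ∣ q ∣ ⟩
    ∣ ∣ q ∣ - ∣ p ∣ ∣             ≡⟨ 0≤p⇒∣p∣≡p (p≤q⇒0≤q-p ∣p∣≤∣q∣) ⟩
    ∣ q ∣ - ∣ p ∣                 ≤⟨ +-monoˡ-≤ (- ∣ p ∣) (∣p∣≤∣p-q∣+∣q∣ q p) ⟩
    (∣ q - p ∣ + ∣ p ∣) - ∣ p ∣   ≡⟨ solve 2 (λ a b → (a :+ b) :- b := a) refl ∣ q - p ∣ ∣ p ∣ ⟩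
    ∣ q - p ∣                     ≡⟨ ∣-∣-sym q p ⟩
    ∣ p - q ∣                     ∎
  ... | inj₂ ∣q∣≤∣p∣ = begin
    ∣ ∣ p ∣ - ∣ q ∣ ∣             ≡⟨ 0≤p⇒∣p∣≡p (p≤q⇒0≤q-p ∣q∣≤∣p∣) ⟩
    ∣ p ∣ - ∣ q ∣                 ≤⟨ +-monoˡ-≤ (- ∣ q ∣) (∣p∣≤∣p-q∣+∣q∣ p q) ⟩
    (∣ p - q ∣ + ∣ q ∣) - ∣ q ∣   ≡⟨ solve 2 (λ a b → (a :+ b) :- b := a) refl ∣ p - q ∣ ∣ q ∣ ⟩
    ∣ p - q ∣                     ∎

  ∣p-p∣<ε : ∀ p {ε} → 0ℚ < ε → ∣ p - p ∣ < ε
  ∣p-p∣<ε p {ε} 0<ε = subst (_< ε) (sym (cong ∣_∣ (+-inverseʳ p))) 0<ε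

  cauchy-intro : ∀ x K → 0ℚ ≤ K →
    (∀ ε → 0ℚ < ε → ∃[ N ] (∀ n → N ℕ.≤ n → ∣ x n - x N ∣ ≤ K * ε)) →
    IsCauchy x
  cauchy-intro x K 0≤K close ε 0<ε = N , λ m n N≤m N≤n → begin-strict
      ∣ x m - x n ∣                   ≤⟨ triangle (x m) (x N) (x n) ⟩
      ∣ x m - x N ∣ + ∣ x N - x n ∣   ≡⟨ cong (λ w → ∣ x m - x N ∣ + w) (∣-∣-sym (x N) (x n)) ⟩
      ∣ x m - x N ∣ + ∣ x n - x N ∣   ≤⟨ +-mono-≤ (near m N≤m) (near n N≤n) ⟩
      K * ε′ + K * ε′                 ≡⟨ +-identityʳ _ ⟨
      (K * ε′ + K * ε′) + 0ℚ          <⟨ +-monoʳ-< (K * ε′ + K * ε′) 0<ε′ ⟩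
      (K * ε′ + K * ε′) + ε′          ≡⟨ lemma ⟩
      ε                               ∎
    where
      D : ℚ
      D = (K + K) + 1ℚ
      instance
        D-pos : Positive D
        D-pos = nonNeg+pos⇒pos (K + K) {{nonNegative (0≤+ 0≤K 0≤K)}} 1ℚ
        D-nonZero : NonZero D
        D-nonZero = pos⇒nonZero D
      ε′ : ℚ
      ε′ = ε * 1/ D
      0<ε′ : 0ℚ < ε′
      0<ε′ = positive⁻¹ ε′ {{pos*pos⇒pos ε {{positive 0<ε}} (1/ D) {{1/pos⇒pos D}}}}
      N = proj₁ (close ε′ 0<ε′)
      near = proj₂ (close ε′ 0<ε′)
      lemma : (K * ε′ + K * ε′) + ε′ ≡ ε
      lemma = begin-equality
        (K * ε′ + K * ε′) + ε′   ≡⟨ cong (λ w → (K * ε′ + K * ε′) + w) (*-identityʳ ε′) ⟨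
        (K * ε′ + K * ε′) + ε′ * 1ℚ
          ≡⟨ solve 4 (λ k e d o → (k :* (e :* d) :+ k :* (e :* d)) :+ (e :* d) :* o
                     := e :* (d :* ((k :+ k) :+ o))) refl K ε (1/ D) 1ℚ ⟩
        ε * (1/ D * D)           ≡⟨ cong (ε *_) (*-inverseˡ D) ⟩
        ε * 1ℚ                   ≡⟨ *-identityʳ ε ⟩
        ε                        ∎

  bounded : ∀ x → IsCauchy x → ∃[ B ] (1ℚ ≤ B × (∀ n → ∣ x n ∣ ≤ B))
  bounded x cx = B , 1≤B , bound
    where
      N = proj₁ (cx 1ℚ (positive⁻¹ 1ℚ))
      near = proj₂ (cx 1ℚ (positive⁻¹ 1ℚ))
      S : ℕ → ℚ
      S n = ∑ n (λ k → ∣ x k ∣)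
      0≤S : ∀ n → 0ℚ ≤ S n
      0≤S zero = ≤-refl
      0≤S (suc n) = 0≤+ (0≤S n) (0≤∣p∣ (x n))
      B : ℚ
      B = 1ℚ + (S N + ∣ x N ∣)
      1≤B : 1ℚ ≤ B
      1≤B = ≤+ʳ (0≤+ (0≤S N) (0≤∣p∣ (x N)))
      early : ∀ M n → n ℕ.< M → ∣ x n ∣ ≤ S M
      early (suc M) n (ℕ.s≤s n≤M) with ℕₚ.m≤n⇒m<n∨m≡n n≤M
      ... | inj₁ n<M = ≤-trans (early M n n<M) (≤+ʳ (0≤∣p∣ (x M)))
      ... | inj₂ refl = ≤+ˡ (0≤S M)
      bound : ∀ n → ∣ x n ∣ ≤ B
      bound n with ℕₚ.<-≤-connex n N
      ... | inj₁ n<N = begin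
        ∣ x n ∣            ≤⟨ early N n n<N ⟩
        S N                ≤⟨ ≤+ʳ (0≤∣p∣ (x N)) ⟩
        S N + ∣ x N ∣      ≤⟨ ≤+ˡ 0≤1 ⟩
        B                  ∎
      ... | inj₂ N≤n = begin
        ∣ x n ∣                   ≤⟨ ∣p∣≤∣p-q∣+∣q∣ (x n) (x N) ⟩
        ∣ x n - x N ∣ + ∣ x N ∣   ≤⟨ +-mono-≤ (<⇒≤ (near n N N≤n ℕₚ.≤-refl)) (≤+ˡ (0≤S N)) ⟩
        B                         ∎

  const-cauchy : ∀ q → IsCauchy (λ _ → q)
  const-cauchy q ε 0<ε = 0 , λ _ _ _ _ → ∣p-p∣<ε q 0<ε

  +-cauchy : ∀ x y → IsCauchy x → IsCauchy y → IsCauchy (λ n → x n + y n)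
  +-cauchy x y cx cy = cauchy-intro (λ n → x n + y n) (1ℚ + 1ℚ) (0≤+ 0≤1 0≤1) λ ε 0<ε →
    let (M , nearx) = cx ε 0<ε
        (M′ , neary) = cy ε 0<ε
        N = M ℕ.⊔ M′
    in N , λ n N≤n → begin
      ∣ (x n + y n) - (x N + y N) ∣
        ≡⟨ cong ∣_∣ (solve 4 (λ a b c d → (a :+ b) :- (c :+ d) := (a :- c) :+ (b :- d)) refl (x n) (y n) (x N) (y N)) ⟩
      ∣ (x n - x N) + (y n - y N) ∣
        ≤⟨ ∣p+q∣≤∣p∣+∣q∣ (x n - x N) (y n - y N) ⟩
      ∣ x n - x N ∣ + ∣ y n - y N ∣
        ≤⟨ +-mono-≤
             (<⇒≤ (nearx n N (ℕₚ.≤-trans (ℕₚ.m≤m⊔n M M′) N≤n) (ℕₚ.m≤m⊔n M M′)))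
             (<⇒≤ (neary n N (ℕₚ.≤-trans (ℕₚ.m≤n⊔m M M′) N≤n) (ℕₚ.m≤n⊔m M M′))) ⟩
      ε + ε
        ≡⟨ cong₂ _+_ (*-identityˡ ε) (*-identityˡ ε) ⟨
      1ℚ * ε + 1ℚ * ε
        ≡⟨ *-distribʳ-+ ε 1ℚ 1ℚ ⟨
      (1ℚ + 1ℚ) * ε ∎

  neg-cauchy : ∀ x → IsCauchy x → IsCauchy (λ n → - x n)
  neg-cauchy x cx ε 0<ε = let (N , near) = cx ε 0<ε in
    N , λ m n N≤m N≤n → begin-strict
      ∣ - x m - - x n ∣   ≡⟨ cong ∣_∣ (solve 2 (λ a b → :- a :- :- b := :- (a :- b)) refl (x m) (x n)) ⟩
      ∣ - (x m - x n) ∣   ≡⟨ ∣-p∣≡∣p∣ (x m - x n) ⟩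
      ∣ x m - x n ∣       <⟨ near m n N≤m N≤n ⟩
      ε                   ∎

  abs-cauchy : ∀ x → IsCauchy x → IsCauchy (λ n → ∣ x n ∣)
  abs-cauchy x cx ε 0<ε = let (N , near) = cx ε 0<ε in
    N , λ m n N≤m N≤n → ≤-<-trans (∣∣p∣-∣q∣∣≤∣p-q∣ (x m) (x n)) (near m n N≤m N≤n)

  *-cauchy : ∀ x y → IsCauchy x → IsCauchy y → IsCauchy (λ n → x n * y n)
  *-cauchy x y cx cy =
    let (A , 1≤A , boundx) = bounded x cx
        (B , 1≤B , boundy) = bounded y cy
        0≤A = ≤-trans 0≤1 1≤A
        0≤B = ≤-trans 0≤1 1≤B
    in cauchy-intro (λ n → x n * y n) (A + B) (0≤+ 0≤A 0≤B) λ ε 0<ε →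
    let (M , nearx) = cx ε 0<ε
        (M′ , neary) = cy ε 0<ε
        N = M ℕ.⊔ M′
    in N , λ n N≤n → begin
      ∣ x n * y n - x N * y N ∣
        ≡⟨ cong ∣_∣ (solve 4 (λ a b c d → a :* b :- c :* d := a :* (b :- d) :+ (a :- c) :* d) refl (x n) (y n) (x N) (y N)) ⟩
      ∣ x n * (y n - y N) + (x n - x N) * y N ∣
        ≤⟨ ∣p+q∣≤∣p∣+∣q∣ (x n * (y n - y N)) ((x n - x N) * y N) ⟩
      ∣ x n * (y n - y N) ∣ + ∣ (x n - x N) * y N ∣
        ≡⟨ cong₂ _+_ (∣p*q∣≡∣p∣*∣q∣ (x n) (y n - y N)) (∣p*q∣≡∣p∣*∣q∣ (x n - x N) (y N)) ⟩
      ∣ x n ∣ * ∣ y n - y N ∣ + ∣ x n - x N ∣ * ∣ y N ∣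
        ≤⟨ +-mono-≤
             (*-mono (0≤∣p∣ (y n - y N)) 0≤A (boundx n)
               (<⇒≤ (neary n N (ℕₚ.≤-trans (ℕₚ.m≤n⊔m M M′) N≤n) (ℕₚ.m≤n⊔m M M′))))
             (*-mono (0≤∣p∣ (y N)) (<⇒≤ 0<ε)
               (<⇒≤ (nearx n N (ℕₚ.≤-trans (ℕₚ.m≤m⊔n M M′) N≤n) (ℕₚ.m≤m⊔n M M′)))
               (boundy N)) ⟩
      A * ε + ε * B
        ≡⟨ solve 3 (λ a b e → a :* e :+ e :* b := (a :+ b) :* e) refl A B ε ⟩
      (A + B) * ε ∎

  ↑ : ℕ → ℚ
  ↑ n = + n / 1

  recip : ℕ → ℚ
  recip n = + 1 / suc n

  toℚᵘ-/ : ∀ i n → toℚᵘ (i / suc n) ℚᵘ.≃ ℚᵘ.mkℚᵘ i n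
  toℚᵘ-/ i n = toℚᵘ-fromℚᵘ (ℚᵘ.mkℚᵘ i n)

  0≤recip : ∀ n → 0ℚ ≤ recip n
  0≤recip n = nonNegative⁻¹ (recip n) {{normalize-nonNeg 1 (suc n)}}

  0≤invFact : ∀ n → 0ℚ ≤ invFact n
  0≤invFact n = nonNegative⁻¹ (invFact n) {{normalize-nonNeg 1 (n !) {{n ℕₚ.!≢0}}}}

  toℚᵘ-recip : ∀ d .{{_ : ℕ.NonZero d}} → toℚᵘ (+ 1 / d) ℚᵘ.* ℚᵘ.mkℚᵘ (+ d) 0 ℚᵘ.≃ ℚᵘ.1ℚᵘ
  toℚᵘ-recip (suc d) = ℚᵘₚ.≃-trans
    (ℚᵘₚ.*-congʳ {ℚᵘ.mkℚᵘ (+ suc d) 0} (toℚᵘ-/ (+ 1) d))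
    (ℚᵘ.*≡* (trans (ℤₚ.*-identityʳ _) (cong (λ w → + suc w)
      (cong (ℕ._+ 0) (sym (ℕₚ.*-identityʳ d))))))

  ↑-recip : ∀ d .{{_ : ℕ.NonZero d}} → ↑ d * (+ 1 / d) ≡ 1ℚ
  ↑-recip d = toℚᵘ-injective (ℚᵘₚ.≃-trans (toℚᵘ-homo-* (↑ d) (+ 1 / d))
    (ℚᵘₚ.≃-trans (ℚᵘₚ.*-congʳ {toℚᵘ (+ 1 / d)} (toℚᵘ-/ (+ d) 0))
      (ℚᵘₚ.≃-trans (ℚᵘₚ.*-comm (ℚᵘ.mkℚᵘ (+ d) 0) (toℚᵘ (+ 1 / d))) (toℚᵘ-recip d))))

  ↑-mono : ∀ {m n} → m ℕ.≤ n → ↑ m ≤ ↑ n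
  ↑-mono {m} {n} m≤n = toℚᵘ-cancel-≤ (ℚᵘₚ.≤-respˡ-≃ (ℚᵘₚ.≃-sym (toℚᵘ-/ (+ m) 0))
    (ℚᵘₚ.≤-respʳ-≃ (ℚᵘₚ.≃-sym (toℚᵘ-/ (+ n) 0))
      (ℚᵘ.*≤* (ℤₚ.*-monoʳ-≤-nonNeg (+ 1) (ℤ.+≤+ m≤n)))))

  ↑-* : ∀ m n → ↑ (m ℕ.* n) ≡ ↑ m * ↑ n
  ↑-* m n = toℚᵘ-injective (ℚᵘₚ.≃-trans (toℚᵘ-/ (+ (m ℕ.* n)) 0)
    (ℚᵘₚ.≃-trans (ℚᵘ.*≡* (cong (ℤ._* + 1) (ℤₚ.pos-* m n)))
      (ℚᵘₚ.≃-sym (ℚᵘₚ.≃-trans (toℚᵘ-homo-* (↑ m) (↑ n))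
        (ℚᵘₚ.*-cong (toℚᵘ-/ (+ m) 0) (toℚᵘ-/ (+ n) 0))))))

  ↑-suc : ∀ n → ↑ (suc n) ≡ ↑ n + 1ℚ
  ↑-suc n = toℚᵘ-injective (ℚᵘₚ.≃-trans (toℚᵘ-/ (+ suc n) 0)
    (ℚᵘₚ.≃-sym (ℚᵘₚ.≃-trans (toℚᵘ-homo-+ (↑ n) 1ℚ)
      (ℚᵘₚ.≃-trans (ℚᵘₚ.+-cong (toℚᵘ-/ (+ n) 0) (ℚᵘₚ.≃-refl {ℚᵘ.1ℚᵘ}))
        (ℚᵘ.*≡* (cong (ℤ._* + 1)
          (trans (cong (ℤ._+ + 1) (ℤₚ.*-identityʳ (+ n)))
            (cong +_ (ℕₚ.+-comm n 1)))))))))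

  0≤↑ : ∀ n → 0ℚ ≤ ↑ n
  0≤↑ n = ↑-mono {0} {n} ℕ.z≤n

  ↑-suc-pos : ∀ n → Positive (↑ (suc n))
  ↑-suc-pos n = normalize-pos (suc n) 1

  archimedean : ∀ p → ∃[ N ] p ≤ ↑ N
  archimedean p = ℤ.∣ ↥ p ∣ , toℚᵘ-cancel-≤ (ℚᵘₚ.≤-respʳ-≃ (ℚᵘₚ.≃-sym (toℚᵘ-/ (+ ℤ.∣ ↥ p ∣) 0)) (below p))
    where
      below : ∀ p → toℚᵘ p ℚᵘ.≤ ℚᵘ.mkℚᵘ (+ ℤ.∣ ↥ p ∣) 0
      below (mkℚ (+ n) d _) = ℚᵘ.*≤* (ℤₚ.*-monoˡ-≤-nonNeg (+ n) (ℤ.+≤+ (ℕ.s≤s ℕ.z≤n)))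
      below (mkℚ ℤ.-[1+ n ] d _) = ℚᵘ.*≤* (ℤₚ.≤-trans ℤ.-≤+ (ℤ.+≤+ ℕ.z≤n))

  invFact-suc : ∀ n → invFact (suc n) ≡ recip n * invFact n
  invFact-suc n = begin-equality
    i′                            ≡⟨ *-identityʳ i′ ⟨
    i′ * 1ℚ                       ≡⟨ cong (i′ *_) (*-identityʳ 1ℚ) ⟨
    i′ * (1ℚ * 1ℚ)                ≡⟨ cong₂ (λ u v → i′ * (u * v)) (↑-recip (suc n)) (↑-recip (n !) {{n ℕₚ.!≢0}}) ⟨
    i′ * ((S * recip n) * (F * invFact n))
      ≡⟨ solve 5 (λ i s r f c → i :* ((s :* r) :* (f :* c)) := ((s :* f) :* i) :* (r :* c)) refl
           i′ S (recip n) F (invFact n) ⟩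
    ((S * F) * i′) * (recip n * invFact n)
      ≡⟨ cong (λ w → (w * i′) * (recip n * invFact n)) (↑-* (suc n) (n !)) ⟨
    (↑ (suc n !) * i′) * (recip n * invFact n)
      ≡⟨ cong (_* (recip n * invFact n)) (↑-recip (suc n !) {{suc n ℕₚ.!≢0}}) ⟩
    1ℚ * (recip n * invFact n)    ≡⟨ *-identityˡ _ ⟩
    recip n * invFact n           ∎
    where
      i′ = invFact (suc n)
      S = ↑ (suc n)
      F = ↑ (n !)

  module _ (L : ℚ) (0≤L : 0ℚ ≤ L) where

    private
      a : ℕ → ℚ
      a = expTerm L

    0≤^ : ∀ n → 0ℚ ≤ L ^ n
    0≤^ zero = 0≤1
    0≤^ (suc n) = 0≤* 0≤L (0≤^ n)

    0≤expTerm : ∀ n → 0ℚ ≤ a n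
    0≤expTerm n = 0≤* (0≤^ n) (0≤invFact n)

    expTerm-halves : ∀ n → L + L ≤ ↑ (suc n) → a (suc n) + a (suc n) ≤ a n
    expTerm-halves n 2L≤ = begin
      a (suc n) + a (suc n)
        ≡⟨ cong (λ w → L ^ suc n * w + L ^ suc n * w) (invFact-suc n) ⟩
      (L * L ^ n) * (recip n * invFact n) + (L * L ^ n) * (recip n * invFact n)
        ≡⟨ solve 4 (λ l p r c → (l :* p) :* (r :* c) :+ (l :* p) :* (r :* c)
                   := ((l :+ l) :* r) :* (p :* c)) refl L (L ^ n) (recip n) (invFact n) ⟩
      ((L + L) * recip n) * a n
        ≤⟨ *-mono (0≤expTerm n) 0≤1 (≤-trans
             (*-monoʳ-≤-nonNeg (recip n) {{nonNegative (0≤recip n)}} 2L≤)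
             (≤-reflexive (↑-recip (suc n)))) ≤-refl ⟩
      1ℚ * a n
        ≡⟨ *-identityˡ (a n) ⟩
      a n ∎

    private
      K : ℕ
      K = proj₁ (archimedean (L + L))

      halves : ∀ n → K ℕ.≤ n → a (suc n) + a (suc n) ≤ a n
      halves n K≤n = expTerm-halves n
        (≤-trans (proj₂ (archimedean (L + L))) (↑-mono (ℕₚ.m≤n⇒m≤1+n K≤n)))

      tail : ∀ m → K ℕ.≤ m → ∀ j → expSum (j ℕ.+ m) L + (a (j ℕ.+ m) + a (j ℕ.+ m)) ≤ expSum m L + (a m + a m)
      tail m K≤m zero = ≤-refl
      tail m K≤m (suc j) = begin
        (E + t) + (t′ + t′)   ≤⟨ +-monoʳ-≤ (E + t) (halves (j ℕ.+ m) (ℕₚ.≤-trans K≤m (ℕₚ.m≤n+m m j))) ⟩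
        (E + t) + t           ≡⟨ +-assoc E t t ⟩
        E + (t + t)           ≤⟨ tail m K≤m j ⟩
        expSum m L + (a m + a m) ∎
        where
          E = expSum (j ℕ.+ m) L
          t = a (j ℕ.+ m)
          t′ = a (suc (j ℕ.+ m))

      decay : ∀ j → ↑ (suc j) * a (j ℕ.+ K) ≤ a K
      decay zero = ≤-reflexive (*-identityˡ (a K))
      decay (suc j) = begin
        ↑ (suc (suc j)) * t′     ≡⟨ cong (_* t′) (↑-suc (suc j)) ⟩
        (u + 1ℚ) * t′            ≤⟨ *-monoʳ-≤-nonNeg t′ {{nonNegative (0≤expTerm (suc (j ℕ.+ K)))}}
                                     (+-monoʳ-≤ u (↑-mono {1} {suc j} (ℕ.s≤s ℕ.z≤n))) ⟩
        (u + u) * t′             ≡⟨ solve 2 (λ u t → (u :+ u) :* t := u :* (t :+ t)) refl u t′ ⟩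
        u * (t′ + t′)            ≤⟨ *-monoˡ-≤-nonNeg u {{nonNegative (0≤↑ (suc j))}} (halves (j ℕ.+ K) (ℕₚ.m≤n+m K j)) ⟩
        u * a (j ℕ.+ K)          ≤⟨ decay j ⟩
        a K                      ∎
        where
          u = ↑ (suc j)
          t′ = a (suc (j ℕ.+ K))

    expSum-mono : ∀ m j → expSum m L ≤ expSum (j ℕ.+ m) L
    expSum-mono m zero = ≤-refl
    expSum-mono m (suc j) = ≤-trans (expSum-mono m j) (≤+ʳ (0≤expTerm (j ℕ.+ m)))

    expSum-settles : ∀ ε → 0ℚ < ε → ∃[ N ] (∀ j → expSum (j ℕ.+ N) L - expSum N L ≤ ε)
    expSum-settles ε 0<ε = J ℕ.+ K , λ j → let N = J ℕ.+ K in begin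
        expSum (j ℕ.+ N) L - expSum N L
          ≤⟨ +-monoˡ-≤ (- expSum N L) (≤-trans (≤+ʳ {expSum (j ℕ.+ N) L} (0≤+ (0≤expTerm (j ℕ.+ N)) (0≤expTerm (j ℕ.+ N))))
               (tail N (ℕₚ.m≤n+m K J) j)) ⟩
        (expSum N L + (a N + a N)) - expSum N L
          ≡⟨ solve 2 (λ e t → (e :+ (t :+ t)) :- e := t :+ t) refl (expSum N L) (a N) ⟩
        a N + a N
          ≤⟨ small ⟩
        ε ∎
      where
        instance
          ε-pos : Positive ε
          ε-pos = positive 0<ε
          ε-nonZero : NonZero ε
          ε-nonZero = pos⇒nonZero ε
        J : ℕ
        J = proj₁ (archimedean ((a K + a K) * 1/ ε))
        u : ℚ
        u = ↑ (suc J)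
        t : ℚ
        t = a (J ℕ.+ K)
        small : t + t ≤ ε
        small = *-cancelˡ-≤-pos u {{↑-suc-pos J}} (begin
          u * (t + t)                ≡⟨ *-distribˡ-+ u t t ⟩
          u * t + u * t              ≤⟨ +-mono-≤ (decay J) (decay J) ⟩
          a K + a K                  ≡⟨ *-identityʳ _ ⟨
          (a K + a K) * 1ℚ           ≡⟨ cong ((a K + a K) *_) (*-inverseˡ ε) ⟨
          (a K + a K) * (1/ ε * ε)   ≡⟨ *-assoc (a K + a K) (1/ ε) ε ⟨
          ((a K + a K) * 1/ ε) * ε   ≤⟨ *-monoʳ-≤-nonNeg ε {{nonNegative (<⇒≤ 0<ε)}}
                                         (≤-trans (proj₂ (archimedean ((a K + a K) * 1/ ε))) (↑-mono (ℕₚ.n≤1+n J))) ⟩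
          u * ε                      ∎)

    expSum-cauchy : IsCauchy (λ n → expSum n L)
    expSum-cauchy = cauchy-intro (λ n → expSum n L) 1ℚ 0≤1 λ ε 0<ε →
      let (N , settle) = expSum-settles ε 0<ε in
      N , λ n N≤n → subst (λ w → ∣ expSum w L - expSum N L ∣ ≤ 1ℚ * ε) (ℕₚ.m∸n+n≡m N≤n)
        (begin
          ∣ expSum ((n ℕ.∸ N) ℕ.+ N) L - expSum N L ∣
            ≡⟨ 0≤p⇒∣p∣≡p (p≤q⇒0≤q-p (expSum-mono N (n ℕ.∸ N))) ⟩
          expSum ((n ℕ.∸ N) ℕ.+ N) L - expSum N L
            ≤⟨ settle (n ℕ.∸ N) ⟩
          ε
            ≡⟨ *-identityˡ ε ⟨
          1ℚ * ε ∎)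

    ∣^∣≤ : ∀ {q} → ∣ q ∣ ≤ L → ∀ k → ∣ q ^ k ∣ ≤ L ^ k
    ∣^∣≤ ∣q∣≤L zero = ≤-refl
    ∣^∣≤ {q} ∣q∣≤L (suc k) = begin
      ∣ q * q ^ k ∣        ≡⟨ ∣p*q∣≡∣p∣*∣q∣ q (q ^ k) ⟩
      ∣ q ∣ * ∣ q ^ k ∣    ≤⟨ *-mono (0≤∣p∣ (q ^ k)) 0≤L ∣q∣≤L (∣^∣≤ ∣q∣≤L k) ⟩
      L * L ^ k            ∎

    expSum-tail : ∀ {q} → ∣ q ∣ ≤ L → ∀ m j →
      ∣ expSum (j ℕ.+ m) q - expSum m q ∣ ≤ expSum (j ℕ.+ m) L - expSum m L
    expSum-tail {q} ∣q∣≤L m zero = ≤-trans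
      (≤-reflexive (cong ∣_∣ (+-inverseʳ (expSum m q)))) (≤-reflexive (sym (+-inverseʳ (expSum m L))))
    expSum-tail {q} ∣q∣≤L m (suc j) = begin
      ∣ (E q + t) - expSum m q ∣
        ≡⟨ cong ∣_∣ (solve 3 (λ e t f → (e :+ t) :- f := (e :- f) :+ t) refl (E q) t (expSum m q)) ⟩
      ∣ (E q - expSum m q) + t ∣
        ≤⟨ ∣p+q∣≤∣p∣+∣q∣ (E q - expSum m q) t ⟩
      ∣ E q - expSum m q ∣ + ∣ t ∣
        ≤⟨ +-mono-≤ (expSum-tail ∣q∣≤L m j) term ⟩
      (E L - expSum m L) + a (j ℕ.+ m)
        ≡⟨ solve 3 (λ e t f → (e :- f) :+ t := (e :+ t) :- f) refl (E L) (a (j ℕ.+ m)) (expSum m L) ⟩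
      (E L + a (j ℕ.+ m)) - expSum m L ∎
      where
        E : ℚ → ℚ
        E = expSum (j ℕ.+ m)
        t : ℚ
        t = expTerm q (j ℕ.+ m)
        term : ∣ t ∣ ≤ a (j ℕ.+ m)
        term = begin
          ∣ t ∣                              ≡⟨ ∣p*q∣≡∣p∣*∣q∣ (q ^ (j ℕ.+ m)) (invFact (j ℕ.+ m)) ⟩
          ∣ q ^ (j ℕ.+ m) ∣ * ∣ invFact (j ℕ.+ m) ∣
            ≡⟨ cong (λ w → ∣ q ^ (j ℕ.+ m) ∣ * w) (0≤p⇒∣p∣≡p (0≤invFact (j ℕ.+ m))) ⟩
          ∣ q ^ (j ℕ.+ m) ∣ * invFact (j ℕ.+ m)
            ≤⟨ *-monoʳ-≤-nonNeg (invFact (j ℕ.+ m)) {{nonNegative (0≤invFact (j ℕ.+ m))}} (∣^∣≤ ∣q∣≤L (j ℕ.+ m)) ⟩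
          a (j ℕ.+ m) ∎

  module _ (H : ℚ) (1≤H : 1ℚ ≤ H) {p q : ℚ} (∣p∣≤H : ∣ p ∣ ≤ H) (∣q∣≤H : ∣ q ∣ ≤ H) where

    private
      0≤H : 0ℚ ≤ H
      0≤H = ≤-trans 0≤1 1≤H

      L : ℚ
      L = H + H

      0≤L : 0ℚ ≤ L
      0≤L = 0≤+ 0≤H 0≤H

      d : ℚ
      d = ∣ p - q ∣

    ∣^-^∣≤ : ∀ k → ∣ p ^ k - q ^ k ∣ ≤ d * L ^ k
    ∣^-^∣≤ zero = subst (_≤ d * 1ℚ) (cong ∣_∣ (sym (+-inverseʳ 1ℚ))) (0≤* (0≤∣p∣ (p - q)) 0≤1)
    ∣^-^∣≤ (suc k) = begin
      ∣ p * p ^ k - q * q ^ k ∣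
        ≡⟨ cong ∣_∣ (solve 4 (λ p u q v → p :* u :- q :* v := p :* (u :- v) :+ (p :- q) :* v) refl p (p ^ k) q (q ^ k)) ⟩
      ∣ p * (p ^ k - q ^ k) + (p - q) * q ^ k ∣
        ≤⟨ ∣p+q∣≤∣p∣+∣q∣ (p * (p ^ k - q ^ k)) ((p - q) * q ^ k) ⟩
      ∣ p * (p ^ k - q ^ k) ∣ + ∣ (p - q) * q ^ k ∣
        ≡⟨ cong₂ _+_ (∣p*q∣≡∣p∣*∣q∣ p (p ^ k - q ^ k)) (∣p*q∣≡∣p∣*∣q∣ (p - q) (q ^ k)) ⟩
      ∣ p ∣ * ∣ p ^ k - q ^ k ∣ + d * ∣ q ^ k ∣
        ≤⟨ +-mono-≤
             (*-mono (0≤∣p∣ (p ^ k - q ^ k)) 0≤H ∣p∣≤H (∣^-^∣≤ k))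
             (*-monoˡ-≤-nonNeg d {{∣-∣-nonNeg (p - q)}} q^k≤) ⟩
      H * (d * L ^ k) + d * (H * L ^ k)
        ≡⟨ solve 3 (λ h d l → h :* (d :* l) :+ d :* (h :* l) := d :* ((h :+ h) :* l)) refl H d (L ^ k) ⟩
      d * (L * L ^ k) ∎
      where
        q^k≤ : ∣ q ^ k ∣ ≤ H * L ^ k
        q^k≤ = begin
          ∣ q ^ k ∣      ≤⟨ ∣^∣≤ L 0≤L (≤-trans ∣q∣≤H (≤+ʳ 0≤H)) k ⟩
          L ^ k          ≡⟨ *-identityˡ (L ^ k) ⟨
          1ℚ * L ^ k     ≤⟨ *-monoʳ-≤-nonNeg (L ^ k) {{nonNegative (0≤^ L 0≤L k)}} 1≤H ⟩
          H * L ^ k      ∎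

    expSum-lipschitz : ∀ n → ∣ expSum n p - expSum n q ∣ ≤ d * expSum n L
    expSum-lipschitz zero = subst (_≤ d * 0ℚ) (cong ∣_∣ (sym (+-inverseʳ 0ℚ))) (0≤* (0≤∣p∣ (p - q)) ≤-refl)
    expSum-lipschitz (suc n) = begin
      ∣ (E p + p ^ n * c) - (E q + q ^ n * c) ∣
        ≡⟨ cong ∣_∣ (solve 5 (λ e f u v c → (e :+ u :* c) :- (f :+ v :* c) := (e :- f) :+ (u :- v) :* c) refl
             (E p) (E q) (p ^ n) (q ^ n) c) ⟩
      ∣ (E p - E q) + (p ^ n - q ^ n) * c ∣
        ≤⟨ ∣p+q∣≤∣p∣+∣q∣ (E p - E q) ((p ^ n - q ^ n) * c) ⟩
      ∣ E p - E q ∣ + ∣ (p ^ n - q ^ n) * c ∣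
        ≡⟨ cong (λ w → ∣ E p - E q ∣ + w) (trans (∣p*q∣≡∣p∣*∣q∣ (p ^ n - q ^ n) c)
             (cong (λ w → ∣ p ^ n - q ^ n ∣ * w) (0≤p⇒∣p∣≡p (0≤invFact n)))) ⟩
      ∣ E p - E q ∣ + ∣ p ^ n - q ^ n ∣ * c
        ≤⟨ +-mono-≤ (expSum-lipschitz n) (*-monoʳ-≤-nonNeg c {{nonNegative (0≤invFact n)}} (∣^-^∣≤ n)) ⟩
      d * E L + (d * L ^ n) * c
        ≡⟨ solve 4 (λ d e l c → d :* e :+ (d :* l) :* c := d :* (e :+ l :* c)) refl d (E L) (L ^ n) c ⟩
      d * (E L + L ^ n * c) ∎
      where
        E : ℚ → ℚ
        E = expSum n
        c : ℚ
        c = invFact n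

  exp-cauchy : ∀ x → IsCauchy x → IsCauchy (λ n → expSum n (x n))
  exp-cauchy x cx =
    let (H , 1≤H , boundx) = bounded x cx
        0≤H = ≤-trans 0≤1 1≤H
        L = H + H
        0≤L = 0≤+ 0≤H 0≤H
        (B , 1≤B , boundE) = bounded (λ n → expSum n L) (expSum-cauchy L 0≤L)
        H≤L = ≤+ʳ {H} 0≤H
    in cauchy-intro (λ n → expSum n (x n)) (B + 1ℚ) (0≤+ (≤-trans 0≤1 1≤B) 0≤1) λ ε 0<ε →
    let (M , nearx) = cx ε 0<ε
        (M′ , settle) = expSum-cauchy L 0≤L ε 0<ε
        N = M ℕ.⊔ M′
    in N , λ n N≤n → begin
      ∣ expSum n (x n) - expSum N (x N) ∣
        ≤⟨ triangle (expSum n (x n)) (expSum n (x N)) (expSum N (x N)) ⟩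
      ∣ expSum n (x n) - expSum n (x N) ∣ + ∣ expSum n (x N) - expSum N (x N) ∣
        ≤⟨ +-mono-≤
             (≤-trans (expSum-lipschitz H 1≤H (boundx n) (boundx N) n)
               (*-mono {∣ x n - x N ∣} {ε} {expSum n L} {B}
                 (0≤expSum L 0≤L n) (<⇒≤ 0<ε)
                 (<⇒≤ (nearx n N (ℕₚ.≤-trans (ℕₚ.m≤m⊔n M M′) N≤n) (ℕₚ.m≤m⊔n M M′)))
                 (≤-trans (p≤∣p∣ (expSum n L)) (boundE n))))
             (subst (λ w → ∣ expSum w (x N) - expSum N (x N) ∣ ≤ ε) (ℕₚ.m∸n+n≡m N≤n)
               (≤-trans (expSum-tail L 0≤L (≤-trans (boundx N) H≤L) N (n ℕ.∸ N))
                 (subst (λ w → expSum w L - expSum N L ≤ ε) (sym (ℕₚ.m∸n+n≡m N≤n))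
                   (≤-trans (p≤∣p∣ (expSum n L - expSum N L))
                     (<⇒≤ (settle n N (ℕₚ.≤-trans (ℕₚ.m≤n⊔m M M′) N≤n) (ℕₚ.m≤n⊔m M M′))))))) ⟩
      ε * B + ε
        ≡⟨ cong (λ w → ε * B + w) (*-identityʳ ε) ⟨
      ε * B + ε * 1ℚ
        ≡⟨ solve 3 (λ e b o → e :* b :+ e :* o := (b :+ o) :* e) refl ε B 1ℚ ⟩
      (B + 1ℚ) * ε ∎
    where
      0≤expSum : ∀ L → 0ℚ ≤ L → ∀ n → 0ℚ ≤ expSum n L
      0≤expSum L 0≤L zero = ≤-refl
      0≤expSum L 0≤L (suc n) = 0≤+ (0≤expSum L 0≤L n) (0≤expTerm L 0≤L n)

open Estimates using (IsCauchy; expSum; invFact)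

-- Real numbers as Cauchy sequences of rationals; the equality is the
-- setoid relation _≈_ of ℝ-rawRing, not propositional equality.

record ℝ : Set where
  constructor mkℝ
  field
    approx : ℕ → ℚ
    cauchy : IsCauchy approx

open ℝ public

Eventually : (ℕ → Set) → Set
Eventually P = ∃[ N ] (∀ n → N ℕ.≤ n → P n)

ℝ-rawRing : RawRing 0ℓ 0ℓ
ℝ-rawRing = record
  { Carrier = ℝ
  ; _≈_ = λ x y → ∀ ε → 0ℚ Rat.< ε → Eventually λ n → Rat.∣ approx x n Rat.- approx y n ∣ Rat.< ε
  ; _+_ = λ x y → mkℝ (λ n → approx x n Rat.+ approx y n)
                      (Estimates.+-cauchy (approx x) (approx y) (cauchy x) (cauchy y))
  ; _*_ = λ x y → mkℝ (λ n → approx x n Rat.* approx y n)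
                      (Estimates.*-cauchy (approx x) (approx y) (cauchy x) (cauchy y))
  ; -_ = λ x → mkℝ (λ n → Rat.- approx x n) (Estimates.neg-cauchy (approx x) (cauchy x))
  ; 0# = mkℝ (λ _ → 0ℚ) (Estimates.const-cauchy 0ℚ)
  ; 1# = mkℝ (λ _ → 1ℚ) (Estimates.const-cauchy 1ℚ)
  }

fromℚ : ℚ → ℝ
fromℚ q = mkℝ (λ _ → q) (Estimates.const-cauchy q)

module RealAnalysis where
  open RawRing ℝ-rawRing
  open FiniteSums ℝ-rawRing

  infix 4 _≤_ _<_
  infixl 6 _-_

  _≤_ : ℝ → ℝ → Set
  x ≤ y = ∀ ε → 0ℚ Rat.< ε → Eventually λ n → approx x n Rat.< approx y n Rat.+ ε

  _<_ : ℝ → ℝ → Set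
  x < y = ∃[ ε ] 0ℚ Rat.< ε × Eventually λ n → approx x n Rat.+ ε Rat.< approx y n

  _-_ : ℝ → ℝ → ℝ
  x - y = x + (- y)

  ∣_∣ : ℝ → ℝ
  ∣ x ∣ = mkℝ (λ n → Rat.∣ approx x n ∣) (Estimates.abs-cauchy (approx x) (cauchy x))

  -- Diagonal representative of ∑ xᵏ/k!: the n-th approximant of exp x is
  -- the n-th partial sum at the n-th approximant of x.  exp-converges
  -- checks that this is the limit of the real partial sums.
  exp : ℝ → ℝ
  exp x = mkℝ (λ n → expSum n (approx x n)) (Estimates.exp-cauchy (approx x) (cauchy x))

  record TaggedPartition (a b : ℝ) : Set where
    field
      size      : ℕ
      point     : ℕ → ℝ
      tag       : ℕ → ℝ
      starts    : point 0 ≈ a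
      ends      : point size ≈ b
      point≤tag : ∀ i → i ℕ.< size → point i ≤ tag i
      tag≤point : ∀ i → i ℕ.< size → tag i ≤ point (suc i)

  open TaggedPartition

  MeshBelow : ∀ {a b} → ℝ → TaggedPartition a b → Set
  MeshBelow δ P = ∀ i → i ℕ.< size P → point P (suc i) - point P i < δ

  riemannSum : ∀ {a b} → (ℝ → ℝ) → TaggedPartition a b → ℝ
  riemannSum φ P = ∑ (size P) λ i → φ (tag P i) * (point P (suc i) - point P i)

  IsRiemannIntegral : (φ : ℝ → ℝ) (a b I : ℝ) → Set
  IsRiemannIntegral φ a b I = ∀ ε → 0# < ε → ∃[ δ ] 0# < δ ×
    ((P : TaggedPartition a b) → MeshBelow δ P → ∣ riemannSum φ P - I ∣ < ε)

  TendsTo∞ : (F : ℝ → ℝ) (L : ℝ) → Set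
  TendsTo∞ F L = ∀ ε → 0# < ε → ∃[ T₀ ] (∀ T → T₀ ≤ T → ∣ F T - L ∣ < ε)

  -- ∫₀^∞ φ = L, both the proper integrals and their limit existing
  IsIntegral₀^∞ : (φ : ℝ → ℝ) (L : ℝ) → Set
  IsIntegral₀^∞ φ L = ∃[ F ] (∀ T → 0# ≤ T → IsRiemannIntegral φ 0# T (F T)) × TendsTo∞ F L

  private
    approx-∑ : ∀ x n N → approx (∑ N λ k → x ^ k * fromℚ (invFact k)) n ≡ expSum N (approx x n)
    approx-∑ x n zero = refl
    approx-∑ x n (suc N) = cong₂ Rat._+_ (approx-∑ x n N) (cong (Rat._* invFact N) (approx-^ N))
      where
        open FiniteSums Rat.+-*-rawRing using () renaming (_^_ to _^ℚ_)
        approx-^ : ∀ k → approx (x ^ k) n ≡ approx x n ^ℚ k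
        approx-^ zero = refl
        approx-^ (suc k) = cong (approx x n Rat.*_) (approx-^ k)

  exp-converges : ∀ x ε → 0ℚ Rat.< ε → Eventually λ N →
    ∣ (∑ N λ k → x ^ k * fromℚ (invFact k)) - exp x ∣ < fromℚ ε
  exp-converges x ε 0<ε =
    let (H , 1≤H , bound) = bounded (approx x) (cauchy x)
        0≤H = ℚₚ.≤-trans 0≤1 1≤H
        (N₀ , settle) = expSum-cauchy H 0≤H η 0<η
    in N₀ , λ N N₀≤N → η , 0<η , N , λ n N≤n →
       subst (λ w → Rat.∣ w Rat.- expSum n (approx x n) ∣ Rat.+ η Rat.< ε) (sym (approx-∑ x n N))
         (bound-diagonal H 0≤H (approx x n) (bound n) N n N≤n
           (settle n N (ℕₚ.≤-trans N₀≤N N≤n) N₀≤N))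
    where
      open Estimates hiding (IsCauchy; expSum; invFact)
      η : ℚ
      η = Rat.½ Rat.* ε
      0<η : 0ℚ Rat.< η
      0<η = ℚₚ.positive⁻¹ η {{ℚₚ.pos*pos⇒pos Rat.½ ε {{Rat.positive 0<ε}}}}
      η+η≡ε : η Rat.+ η ≡ ε
      η+η≡ε = trans (sym (ℚₚ.*-distribʳ-+ ε Rat.½ Rat.½)) (ℚₚ.*-identityˡ ε)
      bound-diagonal : ∀ H → 0ℚ Rat.≤ H → ∀ q → Rat.∣ q ∣ Rat.≤ H → ∀ N n → N ℕ.≤ n →
        Rat.∣ expSum n H Rat.- expSum N H ∣ Rat.< η →
        Rat.∣ expSum N q Rat.- expSum n q ∣ Rat.+ η Rat.< ε
      bound-diagonal H 0≤H q ∣q∣≤H N n N≤n close = begin-strict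
        Rat.∣ expSum N q Rat.- expSum n q ∣ Rat.+ η
          ≡⟨ cong (Rat._+ η) (∣-∣-sym (expSum N q) (expSum n q)) ⟩
        Rat.∣ expSum n q Rat.- expSum N q ∣ Rat.+ η
          <⟨ ℚₚ.+-monoˡ-< η (ℚₚ.≤-<-trans tail close) ⟩
        η Rat.+ η
          ≡⟨ η+η≡ε ⟩
        ε ∎
        where
          open ℚₚ.≤-Reasoning
          tail : Rat.∣ expSum n q Rat.- expSum N q ∣ Rat.≤ Rat.∣ expSum n H Rat.- expSum N H ∣
          tail = subst (λ m → Rat.∣ expSum m q Rat.- expSum N q ∣ Rat.≤ Rat.∣ expSum m H Rat.- expSum N H ∣)
            (ℕₚ.m∸n+n≡m N≤n)
            (ℚₚ.≤-trans (expSum-tail H 0≤H ∣q∣≤H N (n ℕ.∸ N))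
              (p≤∣p∣ (expSum (n ℕ.∸ N ℕ.+ N) H Rat.- expSum N H)))

record ℂ : Set where
  constructor _+i_
  field
    re im : ℝ

open ℂ public

ℂ-rawRing : RawRing 0ℓ 0ℓ
ℂ-rawRing = record
  { Carrier = ℂ
  ; _≈_ = λ u v → (re u ≈ re v) × (im u ≈ im v)
  ; _+_ = λ u v → (re u + re v) +i (im u + im v)
  ; _*_ = λ u v → (re u * re v + - (im u * im v)) +i (re u * im v + im u * re v)
  ; -_ = λ u → (- re u) +i (- im u)
  ; 0# = 0# +i 0#
  ; 1# = 1# +i 0#
  }
  where open RawRing ℝ-rawRing

fromℝ : ℝ → ℂ
fromℝ x = x +i RawRing.0# ℝ-rawRing

-- ∫₀^∞ of a complex-valued integrand is taken componentwise.
IsComplexIntegral₀^∞ : (ℝ → ℂ) → ℂ → Set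
IsComplexIntegral₀^∞ φ L = IsIntegral₀^∞ (re ∘ φ) (re L) × IsIntegral₀^∞ (im ∘ φ) (im L)
  where open RealAnalysis using (IsIntegral₀^∞)

-- Univariate polynomials: lists of coefficients, constant term first,
-- trailing zeros being irrelevant for _≈_.

module Polynomials (R : RawRing 0ℓ 0ℓ) where
  open RawRing R

  Poly : Set
  Poly = List Carrier

  coeff : Poly → ℕ → Carrier
  coeff []      _       = 0#
  coeff (a ∷ p) zero    = a
  coeff (a ∷ p) (suc k) = coeff p k

  const : Carrier → Poly
  const a = a ∷ []

  var : Poly
  var = 0# ∷ 1# ∷ []

  add : Poly → Poly → Poly
  add []      q       = q
  add (a ∷ p) []      = a ∷ p
  add (a ∷ p) (b ∷ q) = (a + b) ∷ add p q

  mul : Poly → Poly → Poly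
  mul []      q = []
  mul (a ∷ p) q = add (map (a *_) q) (0# ∷ mul p q)

  Poly-rawRing : RawRing 0ℓ 0ℓ
  Poly-rawRing = record
    { Carrier = Poly
    ; _≈_ = λ p q → ∀ k → coeff p k ≈ coeff q k
    ; _+_ = add
    ; _*_ = mul
    ; -_ = map (-_)
    ; 0# = []
    ; 1# = const 1#
    }

module ℂ[x]Poly  = Polynomials ℂ-rawRing
module ℂ[xy]Poly = Polynomials ℂ[x]Poly.Poly-rawRing
module ℂ[xyz]Poly = Polynomials ℂ[xy]Poly.Poly-rawRing

ℂ[x,y] : RawRing 0ℓ 0ℓ
ℂ[x,y] = ℂ[xy]Poly.Poly-rawRing

-- ℂ[x][y][z], with z the outermost variable
ℂ[x,y,z] : RawRing 0ℓ 0ℓ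
ℂ[x,y,z] = ℂ[xyz]Poly.Poly-rawRing

Polynomial : Set
Polynomial = RawRing.Carrier ℂ[x,y,z]

constant₂ : ℂ → RawRing.Carrier ℂ[x,y]
constant₂ = ℂ[xy]Poly.const ∘ ℂ[x]Poly.const

constant : ℂ → Polynomial
constant = ℂ[xyz]Poly.const ∘ constant₂

𝐱 𝐲 𝐳 : Polynomial
𝐱 = ℂ[xyz]Poly.const (ℂ[xy]Poly.const ℂ[x]Poly.var)
𝐲 = ℂ[xyz]Poly.const ℂ[xy]Poly.var
𝐳 = ℂ[xyz]Poly.var

horner : {A : Set} → (A → ℂ) → List A → ℂ → ℂ
horner e []      v = RawRing.0# ℂ-rawRing
horner e (a ∷ p) v = e a + v * horner e p v
  where open RawRing ℂ-rawRing

eval : Polynomial → (x y z : ℂ) → ℂ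
eval p x y z = horner (λ q → horner (λ u → horner id u x) q y) p z

-- D_z⁻¹, sending c zᵏ to (c / (k + 1)) zᵏ⁺¹
D⁻¹ : Polynomial → Polynomial
D⁻¹ p = RawRing.0# ℂ[x,y] ∷ divide 0 p
  where
    divide : ℕ → Polynomial → Polynomial
    divide k []      = []
    divide k (c ∷ p) = RawRing._*_ ℂ[x,y] (constant₂ (fromℝ (fromℚ (+ 1 Rat./ suc k)))) c ∷ divide (suc k) p

-- p(x, y, s D_z⁻¹) applied to 1, that is ∑ₖ pₖ(x,y) sᵏ D_z⁻ᵏ{1}
substD⁻¹ : Polynomial → ℂ → Polynomial
substD⁻¹ p s = ∑ (length p) λ k →
    ℂ[xyz]Poly.const (ℂ[xyz]Poly.coeff p k) * constant s ^ k * fold 1# D⁻¹ k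
  where
    open RawRing ℂ[x,y,z]
    open FiniteSums ℂ[x,y,z]

module PowerSeries (R : RawRing 0ℓ 0ℓ) where
  open RawRing R
  open FiniteSums R using (∑)

  Series : Set
  Series = ℕ → Carrier

  constSeries : Carrier → Series
  constSeries a zero    = a
  constSeries a (suc _) = 0#

  t : Series
  t (suc zero) = 1#
  t _          = 0#

  Series-rawRing : RawRing 0ℓ 0ℓ
  Series-rawRing = record
    { Carrier = Series
    ; _≈_ = λ a b → ∀ n → a n ≈ b n
    ; _+_ = λ a b n → a n + b n
    ; _*_ = λ a b n → ∑ (suc n) λ k → a k * b (n ℕ.∸ k)
    ; -_ = λ a n → - a n
    ; 0# = constSeries 0#
    ; 1# = constSeries 1#
    }

  -- Meaningful when b has zero constant term: then bᵏ contributes to tⁿ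
  -- only for k ≤ n.
  infixr 9 _⊚_
  _⊚_ : Series → Series → Series
  (a ⊚ b) n = ∑ (suc n) λ k → a k * (b ^ k) n
    where open FiniteSums Series-rawRing using (_^_)

ℂ⟦t⟧ : RawRing 0ℓ 0ℓ
ℂ⟦t⟧ = PowerSeries.Series-rawRing ℂ-rawRing

ComplexSeries : Set
ComplexSeries = RawRing.Carrier ℂ⟦t⟧

ℂ[x,y,z]⟦t⟧ : RawRing 0ℓ 0ℓ
ℂ[x,y,z]⟦t⟧ = PowerSeries.Series-rawRing ℂ[x,y,z]

PolynomialSeries : Set
PolynomialSeries = RawRing.Carrier ℂ[x,y,z]⟦t⟧

module _ where
  open RawRing ℂ-rawRing

  IsDelta : ComplexSeries → Set
  IsDelta f = (f 0 ≈ 0#) × (f 1 ≉ 0#)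

  IsInvertible : ComplexSeries → Set
  IsInvertible g = g 0 ≉ 0#

  fromRational : ℚ → ℂ
  fromRational = fromℝ ∘ fromℚ

C₀-series : ComplexSeries
C₀-series k = fromRational ((-1ℤ ℤ.^ k Rat./ (k ! ℕ.* k !)) {{ℕₚ._!*_!≢0 k k}})

exp-series : ComplexSeries
exp-series k = fromRational (invFact k)

module _ where
  open RawRing ℂ⟦t⟧
  open PowerSeries ℂ-rawRing using (_⊚_; t)

  IsCompositionalInverse : (f h : ComplexSeries) → Set
  IsCompositionalInverse f h =
    RawRing._≈_ ℂ-rawRing (h 0) (RawRing.0# ℂ-rawRing) × (f ⊚ h ≈ t) × (h ⊚ f ≈ t)

  IsReciprocal : (a b : ComplexSeries) → Set
  IsReciprocal a b = a * b ≈ 1#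

-- The left-hand side of the generating function, in terms of h = f⁻¹(t)
-- and w = 1 / g(f⁻¹(t)).
generatingFunction : (w h : ComplexSeries) (r : ℕ) → PolynomialSeries
generatingFunction w h r =
    lift w
      * (lift C₀-series ⊚ (constSeries 𝐱 * lift h))
      * (lift C₀-series ⊚ (- constSeries 𝐲 * lift h))
      * (lift exp-series ⊚ (constSeries 𝐳 * lift h ^ r))
  where
    open RawRing ℂ[x,y,z]⟦t⟧
    open FiniteSums ℂ[x,y,z]⟦t⟧ using (_^_)
    open PowerSeries ℂ[x,y,z] using (constSeries; _⊚_)
    lift : ComplexSeries → PolynomialSeries
    lift a = constant ∘ a

-- ∑ₙ sₙ tⁿ / (n!)²
doublyExponential : (ℕ → Polynomial) → PolynomialSeries
doublyExponential s n =
    s n * constant (fromRational ((+ 1 Rat./ (n ! ℕ.* n !)) {{ℕₚ._!*_!≢0 n n}}))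
  where open RawRing ℂ[x,y,z]

-- s is the sequence of Legendre-Gould Hopper based Sheffer polynomials
-- of the pair (g, f); h and w are f⁻¹(t) and 1 / g(f⁻¹(t)).
IsLegendreGouldHopperSheffer : (g f : ComplexSeries) (r : ℕ) (s : ℕ → Polynomial) → Set
IsLegendreGouldHopperSheffer g f r s =
  ∃[ h ] ∃[ w ] IsCompositionalInverse f h × IsReciprocal (g ⊚ h) w ×
    (generatingFunction w h r ≈ doublyExponential s)
  where
    open PowerSeries ℂ-rawRing using (_⊚_)
    open RawRing ℂ[x,y,z]⟦t⟧ using (_≈_)

-- τ ↦ e^(-τ) p(x, y, τ D_z⁻¹), evaluated at the point (x, y, z)
laplaceIntegrand : Polynomial → (x y z : ℂ) → ℝ → ℂ
laplaceIntegrand p x y z τ = fromℝ (RealAnalysis.exp (- τ)) ℂ* eval (substD⁻¹ p (fromℝ τ)) x y z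
  where
    open RawRing ℝ-rawRing using (-_)
    open RawRing ℂ-rawRing using () renaming (_*_ to _ℂ*_)

{-# OPTIONS --safe #-}
module Submission where

-- The integral formula holds for every polynomial p = ∑ pₖ(x,y) zᵏ:
-- substituting s D_z⁻¹ turns zᵏ into sᵏ zᵏ / k!, and
-- ∫₀^∞ e^(-s) sᵏ / k! ds = 1.  For the latter, e^(-s) sᵏ / k! has the
-- primitive -e^(-s) ∑_{j≤k} sʲ / j!, whose value at 0 is -1 and which
-- vanishes at infinity because s e^(-s) sʲ / j! ≤ j + 1.  Everything rests
-- on three facts about exp: it is its own derivative, exp 0 = 1, and it
-- dominates each term of its series on [0, ∞).

open import Defs
open import Algebra.Bundles using (CommutativeRing)
open import Algebra.Bundles.Raw using (RawRing)
import Algebra.Properties.Ring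
import Algebra.Solver.Ring
open import Algebra.Solver.Ring.AlmostCommutativeRing using (fromCommutativeRing; _-Raw-AlmostCommutative⟶_)
import Algebra.Solver.Ring.NaturalCoefficients.Default
open import Algebra.Structures using (IsCommutativeRing)
open import Data.Empty using (⊥)
import Data.Integer as ℤ
open import Data.List using (List; []; _∷_; map; length; drop)
open import Data.Maybe using (Maybe; just; nothing)
open import Data.Nat using (ℕ; zero; suc)
import Data.Nat as ℕ
open import Data.Nat.GeneralisedArithmetic using (fold)
import Data.Nat.Properties as ℕₚ
open import Data.Product using (∃-syntax; _×_; _,_; proj₁; proj₂)
open import Data.Rational using (ℚ; 0ℚ; 1ℚ)
import Data.Rational as Rat
import Data.Rational.Properties as ℚₚ
open import Data.Rational.Solver using () renaming (module +-*-Solver to ℚ-Solver)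
open import Data.Sum using (inj₁; inj₂)
open import Function using (id)
open import Level using (0ℓ)
open import Relation.Binary.Bundles using (Preorder)
open import Relation.Binary.PropositionalEquality as ≡ using (_≡_)
import Relation.Binary.Reasoning.Preorder as PreorderReasoning
import Relation.Binary.Reasoning.Setoid as SetoidReasoning
open import Relation.Nullary using (yes; no)

-- Real numbers are Cauchy sequences whose order admits no case distinctions, and the integral
-- quantifies over partitions with arbitrary real points and tags. Hence derivatives carry a uniform
-- quadratic remainder: summed along any partition, these remainders telescope into an error bound
-- for the Riemann sum, with neither a mean value theorem nor a modulus of continuity. The addition
-- law of `exp` is never established. What replaces it is that e^(-s) e^s has derivative 0 and hence
-- keeps its value 1; this yields both e^(-s) ≥ 0 and e^(-s) s^k / k! ≤ 1. In the diagonal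
-- representative of `exp` the same index governs the truncation of the series and the approximation
-- of the argument. Its derivative is therefore estimated on rational partial sums, with constants
-- that do not depend on that index. The complex data enter only through coefficients that are
-- constant in s, so the complex integral splits into two real ones built from the same primitives.

-- Axioms for the real numbers

-- Totality of the order is absent, since Cauchy reals do not have it constructively; the laws of
-- `∣_∣` take its place. The last two fields express the Archimedean property, and `ι` supplies the
-- rational constants in which all tolerances are measured.
record IsOrderedAlgebra (R : CommutativeRing 0ℓ 0ℓ)
  (_≤_ : CommutativeRing.Carrier R → CommutativeRing.Carrier R → Set)
  (∣_∣ : CommutativeRing.Carrier R → CommutativeRing.Carrier R)
  (ι : ℚ → CommutativeRing.Carrier R) : Set where
  open CommutativeRing R
  field
    ≤-reflexive   : ∀ {x y} → x ≈ y → x ≤ y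
    ≤-trans       : ∀ {x y z} → x ≤ y → y ≤ z → x ≤ z
    ≤-antisym     : ∀ {x y} → x ≤ y → y ≤ x → x ≈ y
    +-mono-≤      : ∀ {x y u v} → x ≤ y → u ≤ v → (x + u) ≤ (y + v)
    0≤x*y         : ∀ {x y} → 0# ≤ x → 0# ≤ y → 0# ≤ (x * y)
    0≤x*x         : ∀ x → 0# ≤ (x * x)
    0≤∣x∣         : ∀ x → 0# ≤ ∣ x ∣
    x≤∣x∣         : ∀ x → x ≤ ∣ x ∣
    0≤x⇒∣x∣≈x     : ∀ {x} → 0# ≤ x → ∣ x ∣ ≈ x
    ∣-∣-cong      : ∀ {x y} → x ≈ y → ∣ x ∣ ≈ ∣ y ∣
    ∣-x∣≈∣x∣      : ∀ x → ∣ - x ∣ ≈ ∣ x ∣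
    ∣x+y∣≤∣x∣+∣y∣ : ∀ x y → ∣ x + y ∣ ≤ (∣ x ∣ + ∣ y ∣)
    ∣x*y∣≈∣x∣*∣y∣ : ∀ x y → ∣ x * y ∣ ≈ (∣ x ∣ * ∣ y ∣)
    ι-+    : ∀ p q → ι (p Rat.+ q) ≈ (ι p + ι q)
    ι-*    : ∀ p q → ι (p Rat.* q) ≈ (ι p * ι q)
    ι-neg  : ∀ p → ι (Rat.- p) ≈ (- ι p)
    ι-0    : ι 0ℚ ≈ 0#
    ι-1    : ι 1ℚ ≈ 1#
    ι-mono : ∀ {p q} → p Rat.≤ q → ι p ≤ ι q
    rational-bound : ∀ x → ∃[ K ] 1ℚ Rat.≤ K × (x ≤ ι K)
    ≤-small⇒≤0     : ∀ {x} → (∀ {q} → 0ℚ Rat.< q → x ≤ ι q) → x ≤ 0#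

record OrderedAlgebra : Set₁ where
  infix 4 _≤_
  field
    commutativeRing : CommutativeRing 0ℓ 0ℓ
  open CommutativeRing commutativeRing public
  field
    _≤_  : Carrier → Carrier → Set
    ∣_∣  : Carrier → Carrier
    ι    : ℚ → Carrier
    isOrderedAlgebra : IsOrderedAlgebra commutativeRing _≤_ ∣_∣ ι
  open IsOrderedAlgebra isOrderedAlgebra public

-- `N` is a natural number above K/δ. Cutting an interval of length `K` into `suc N` equal pieces
-- then gives pieces no longer than `δ`.
subdivision : ∀ K δ → 0ℚ Rat.≤ K → 0ℚ Rat.< δ → ∃[ N ] Estimates.recip N Rat.* K Rat.≤ δ
subdivision K δ 0≤K 0<δ = N , (begin
    recip N Rat.* K
      ≡⟨ ≡.cong (recip N Rat.*_) (≡.trans (≡.cong (K Rat.*_) (ℚₚ.*-inverseˡ δ)) (ℚₚ.*-identityʳ K)) ⟨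
    recip N Rat.* (K Rat.* (Rat.1/ δ Rat.* δ))
      ≤⟨ *-mono (0≤* 0≤K 0≤1/δδ) (0≤recip N) ℚₚ.≤-refl (begin
           K Rat.* (Rat.1/ δ Rat.* δ)   ≡⟨ ℚₚ.*-assoc K (Rat.1/ δ) δ ⟨
           (K Rat.* Rat.1/ δ) Rat.* δ   ≤⟨ ℚₚ.*-monoʳ-≤-nonNeg δ {{ℚₚ.pos⇒nonNeg δ}}
                                            (ℚₚ.≤-trans (proj₂ (archimedean (K Rat.* Rat.1/ δ))) (↑-mono (ℕₚ.n≤1+n N))) ⟩
           ↑ (suc N) Rat.* δ            ∎) ⟩
    recip N Rat.* (↑ (suc N) Rat.* δ)
      ≡⟨ ℚ-Solver.solve 3 (λ r u d → r ℚ-Solver.:* (u ℚ-Solver.:* d) ℚ-Solver.:= (u ℚ-Solver.:* r) ℚ-Solver.:* d) ≡.refl (recip N) (↑ (suc N)) δ ⟩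
    (↑ (suc N) Rat.* recip N) Rat.* δ
      ≡⟨ ≡.cong (Rat._* δ) (↑-recip (suc N)) ⟩
    1ℚ Rat.* δ
      ≡⟨ ℚₚ.*-identityˡ δ ⟩
    δ ∎)
  where
    open ℚₚ.≤-Reasoning
    open Estimates using (recip; ↑; archimedean; *-mono; 0≤*; 0≤recip; ↑-mono; ↑-recip)
    instance
      δ-pos : Rat.Positive δ
      δ-pos = Rat.positive 0<δ
      δ-nonZero : Rat.NonZero δ
      δ-nonZero = ℚₚ.pos⇒nonZero δ
    N : ℕ
    N = proj₁ (archimedean (K Rat.* Rat.1/ δ))
    0≤1/δδ : 0ℚ Rat.≤ Rat.1/ δ Rat.* δ
    0≤1/δδ = ℚₚ.≤-trans (ℚₚ.nonNegative⁻¹ 1ℚ) (ℚₚ.≤-reflexive (≡.sym (ℚₚ.*-inverseˡ δ)))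

-- Order arithmetic in an ordered algebra

module Calculus (R : OrderedAlgebra) where
  open OrderedAlgebra R
  open FiniteSums rawRing

  private
    -- Coefficients are rational because their equality is decidable, whereas equality in the
    -- carrier need not be.
    morphism : Rat.+-*-rawRing -Raw-AlmostCommutative⟶ fromCommutativeRing commutativeRing
    morphism = record
      { ⟦_⟧ = ι ; +-homo = ι-+ ; *-homo = ι-* ; -‿homo = ι-neg ; 0-homo = ι-0 ; 1-homo = ι-1 }

    _≟_ : ∀ p q → Maybe (ι p ≈ ι q)
    p ≟ q with p ℚₚ.≟ q
    ... | yes ≡.refl = just refl
    ... | no _       = nothing

  open Algebra.Solver.Ring Rat.+-*-rawRing (fromCommutativeRing commutativeRing) morphism _≟_ public
    using (solve; _:+_; _:*_; _:-_; :-_; _:=_; con)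

  ≤-preorder : Preorder 0ℓ 0ℓ 0ℓ
  ≤-preorder = record
    { isPreorder = record { isEquivalence = isEquivalence ; reflexive = ≤-reflexive ; trans = ≤-trans } }

  module ≤-Reasoning = PreorderReasoning ≤-preorder
  open ≤-Reasoning
  open Algebra.Properties.Ring ring using (-0#≈0#)

  ≤-refl : ∀ {x} → x ≤ x
  ≤-refl = ≤-reflexive refl

  x-0≈x : ∀ x → x - 0# ≈ x
  x-0≈x x = trans (+-congˡ -0#≈0#) (+-identityʳ x)

  +-nonNeg : ∀ {x y} → 0# ≤ x → 0# ≤ y → 0# ≤ x + y
  +-nonNeg {x} {y} 0≤x 0≤y = begin
    0#       ≈⟨ +-identityˡ 0# ⟨
    0# + 0#  ∼⟨ +-mono-≤ 0≤x 0≤y ⟩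
    x + y    ∎

  x≤y⇒0≤y-x : ∀ {x y} → x ≤ y → 0# ≤ y - x
  x≤y⇒0≤y-x {x} {y} x≤y = begin
    0#     ≈⟨ -‿inverseʳ x ⟨
    x - x  ∼⟨ +-mono-≤ x≤y ≤-refl ⟩
    y - x  ∎

  0≤y-x⇒x≤y : ∀ {x y} → 0# ≤ y - x → x ≤ y
  0≤y-x⇒x≤y {x} {y} 0≤y-x = begin
    x            ≈⟨ +-identityˡ x ⟨
    0# + x       ∼⟨ +-mono-≤ 0≤y-x ≤-refl ⟩
    (y - x) + x  ≈⟨ solve 2 (λ x y → (y :- x) :+ x := y) refl x y ⟩
    y            ∎

  ≤+ʳ : ∀ {x y} → 0# ≤ y → x ≤ x + y
  ≤+ʳ {x} {y} 0≤y = begin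
    x       ≈⟨ +-identityʳ x ⟨
    x + 0#  ∼⟨ +-mono-≤ ≤-refl 0≤y ⟩
    x + y   ∎

  ≤+ˡ : ∀ {x y} → 0# ≤ y → x ≤ y + x
  ≤+ˡ {x} {y} 0≤y = begin
    x       ∼⟨ ≤+ʳ 0≤y ⟩
    x + y   ≈⟨ +-comm x y ⟩
    y + x   ∎

  *-monoˡ-≤ : ∀ {x y z} → 0# ≤ z → x ≤ y → z * x ≤ z * y
  *-monoˡ-≤ {x} {y} {z} 0≤z x≤y = 0≤y-x⇒x≤y (begin
    0#             ∼⟨ 0≤x*y 0≤z (x≤y⇒0≤y-x x≤y) ⟩
    z * (y - x)    ≈⟨ solve 3 (λ x y z → z :* (y :- x) := z :* y :- z :* x) refl x y z ⟩
    z * y - z * x  ∎)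

  *-monoʳ-≤ : ∀ {x y z} → 0# ≤ z → x ≤ y → x * z ≤ y * z
  *-monoʳ-≤ {x} {y} {z} 0≤z x≤y = begin
    x * z  ≈⟨ *-comm x z ⟩
    z * x  ∼⟨ *-monoˡ-≤ 0≤z x≤y ⟩
    z * y  ≈⟨ *-comm z y ⟩
    y * z  ∎

  *-mono-≤ : ∀ {x y u v} → 0# ≤ y → 0# ≤ u → x ≤ y → u ≤ v → x * u ≤ y * v
  *-mono-≤ 0≤y 0≤u x≤y u≤v = ≤-trans (*-monoʳ-≤ 0≤u x≤y) (*-monoˡ-≤ 0≤y u≤v)

  0≤1 : 0# ≤ 1#
  0≤1 = begin
    0#       ∼⟨ 0≤x*x 1# ⟩
    1# * 1#  ≈⟨ *-identityʳ 1# ⟩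
    1#       ∎

  0≤ι : ∀ {q} → 0ℚ Rat.≤ q → 0# ≤ ι q
  0≤ι {q} 0≤q = begin
    0#    ≈⟨ ι-0 ⟨
    ι 0ℚ  ∼⟨ ι-mono 0≤q ⟩
    ι q   ∎

  ∣0∣≈0 : ∣ 0# ∣ ≈ 0#
  ∣0∣≈0 = 0≤x⇒∣x∣≈x ≤-refl

  ∣x-y∣≈∣y-x∣ : ∀ x y → ∣ x - y ∣ ≈ ∣ y - x ∣
  ∣x-y∣≈∣y-x∣ x y = begin-equality
    ∣ x - y ∣      ≈⟨ ∣-x∣≈∣x∣ (x - y) ⟨
    ∣ - (x - y) ∣  ≈⟨ ∣-∣-cong (solve 2 (λ x y → :- (x :- y) := y :- x) refl x y) ⟩
    ∣ y - x ∣      ∎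

  ∣x*y∣≤ : ∀ {x y X Y} → ∣ x ∣ ≤ X → ∣ y ∣ ≤ Y → ∣ x * y ∣ ≤ X * Y
  ∣x*y∣≤ {x} {y} {X} {Y} x≤ y≤ = begin
    ∣ x * y ∣      ≈⟨ ∣x*y∣≈∣x∣*∣y∣ x y ⟩
    ∣ x ∣ * ∣ y ∣  ∼⟨ *-mono-≤ (≤-trans (0≤∣x∣ x) x≤) (0≤∣x∣ y) x≤ y≤ ⟩
    X * Y          ∎

  ∣x+y∣≤ : ∀ {x y X Y} → ∣ x ∣ ≤ X → ∣ y ∣ ≤ Y → ∣ x + y ∣ ≤ X + Y
  ∣x+y∣≤ {x} {y} x≤ y≤ = ≤-trans (∣x+y∣≤∣x∣+∣y∣ x y) (+-mono-≤ x≤ y≤)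

  0≤x≤y⇒∣x∣≤y : ∀ {x y} → 0# ≤ x → x ≤ y → ∣ x ∣ ≤ y
  0≤x≤y⇒∣x∣≤y 0≤x x≤y = ≤-trans (≤-reflexive (0≤x⇒∣x∣≈x 0≤x)) x≤y

  -- In place of a limit of difference quotients: G is Lipschitz with
  -- derivative g up to a quadratic remainder, uniformly on bounded sets.
  record DifferentiableOn (B C : Carrier) (G g : Carrier → Carrier) : Set where
    field
      bounded   : ∀ a → ∣ a ∣ ≤ B → ∣ G a ∣ ≤ C
      lipschitz : ∀ a b → ∣ a ∣ ≤ B → ∣ b ∣ ≤ B → ∣ G b - G a ∣ ≤ C * ∣ b - a ∣
      remainder : ∀ a b → ∣ a ∣ ≤ B → ∣ b ∣ ≤ B →
        ∣ (G b - G a) - g a * (b - a) ∣ ≤ C * (∣ b - a ∣ * ∣ b - a ∣)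

  -- A single constant `C`, chosen after the bound `B`, serves for the values, the Lipschitz
  -- estimate and the remainder. The product rule multiplies these estimates with each other, which
  -- is why all three are carried along.
  HasDerivative : (G g : Carrier → Carrier) → Set
  HasDerivative G g = ∀ B → ∃[ C ] 0# ≤ C × DifferentiableOn B C G g

  open DifferentiableOn

  -- Rules of differentiation

  derivative-resp-≈ : ∀ {G G′ g g′} → (∀ a → G a ≈ G′ a) → (∀ a → g a ≈ g′ a) →
    HasDerivative G g → HasDerivative G′ g′
  derivative-resp-≈ {G} {G′} {g} {g′} G≈ g≈ D B = let (C , 0≤C , d) = D B in C , 0≤C , record
    { bounded = λ a a≤ → ≤-trans (≤-reflexive (∣-∣-cong (sym (G≈ a)))) (bounded d a a≤)
    ; lipschitz = λ a b a≤ b≤ → ≤-trans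
        (≤-reflexive (∣-∣-cong (sym (diff a b)))) (lipschitz d a b a≤ b≤)
    ; remainder = λ a b a≤ b≤ → ≤-trans
        (≤-reflexive (∣-∣-cong (sym (+-cong (diff a b) (-‿cong (*-congʳ (g≈ a)))))))
        (remainder d a b a≤ b≤)
    }
    where
      diff : ∀ a b → G b - G a ≈ G′ b - G′ a
      diff a b = +-cong (G≈ b) (-‿cong (G≈ a))

  derivative-const : ∀ c → HasDerivative (λ _ → c) (λ _ → 0#)
  derivative-const c B = ∣ c ∣ , 0≤∣x∣ c , record
    { bounded = λ _ _ → ≤-refl
    ; lipschitz = λ a b _ _ → vanishes (-‿inverseʳ c) (0≤∣x∣ (b - a))
    ; remainder = λ a b _ _ → vanishes
        (trans (+-cong (-‿inverseʳ c) (-‿cong (zeroˡ (b - a)))) (-‿inverseʳ 0#))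
        (0≤x*y (0≤∣x∣ (b - a)) (0≤∣x∣ (b - a)))
    }
    where
      vanishes : ∀ {x y} → x ≈ 0# → 0# ≤ y → ∣ x ∣ ≤ ∣ c ∣ * y
      vanishes {x} {y} x≈0 0≤y = begin
        ∣ x ∣        ≈⟨ ∣-∣-cong x≈0 ⟩
        ∣ 0# ∣       ≈⟨ ∣0∣≈0 ⟩
        0#           ∼⟨ 0≤x*y (0≤∣x∣ c) 0≤y ⟩
        ∣ c ∣ * y    ∎

  derivative-id : HasDerivative (λ a → a) (λ _ → 1#)
  -- `B` has no prescribed sign, so `∣ B ∣` replaces it as the bound of the values; the added `1#`
  -- is the Lipschitz constant.
  derivative-id B = ∣ B ∣ + 1# , +-nonNeg (0≤∣x∣ B) 0≤1 , record
    { bounded = λ a a≤ → ≤-trans a≤ (≤-trans (x≤∣x∣ B) (≤+ʳ 0≤1))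
    ; lipschitz = λ a b _ _ → begin
        ∣ b - a ∣                     ≈⟨ *-identityˡ _ ⟨
        1# * ∣ b - a ∣                ∼⟨ *-monoʳ-≤ (0≤∣x∣ (b - a)) (≤+ˡ (0≤∣x∣ B)) ⟩
        (∣ B ∣ + 1#) * ∣ b - a ∣      ∎
    ; remainder = λ a b _ _ → begin
        ∣ (b - a) - 1# * (b - a) ∣    ≈⟨ ∣-∣-cong (trans (+-congˡ (-‿cong (*-identityˡ _))) (-‿inverseʳ (b - a))) ⟩
        ∣ 0# ∣                        ≈⟨ ∣0∣≈0 ⟩
        0#                            ∼⟨ 0≤x*y (+-nonNeg (0≤∣x∣ B) 0≤1) (0≤x*y (0≤∣x∣ (b - a)) (0≤∣x∣ (b - a))) ⟩
        (∣ B ∣ + 1#) * (∣ b - a ∣ * ∣ b - a ∣) ∎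
    }

  derivative-+ : ∀ {G g H h} → HasDerivative G g → HasDerivative H h →
    HasDerivative (λ a → G a + H a) (λ a → g a + h a)
  derivative-+ {G} {g} {H} {h} DG DH B =
    let (C , 0≤C , dG) = DG B
        (K , 0≤K , dH) = DH B
    in C + K , +-nonNeg 0≤C 0≤K , record
    { bounded = λ a a≤ → ∣x+y∣≤ (bounded dG a a≤) (bounded dH a a≤)
    ; lipschitz = λ a b a≤ b≤ → begin
        ∣ (G b + H b) - (G a + H a) ∣
          ≈⟨ ∣-∣-cong (solve 4 (λ p q r s → (p :+ q) :- (r :+ s) := (p :- r) :+ (q :- s)) refl (G b) (H b) (G a) (H a)) ⟩
        ∣ (G b - G a) + (H b - H a) ∣
          ∼⟨ ∣x+y∣≤ (lipschitz dG a b a≤ b≤) (lipschitz dH a b a≤ b≤) ⟩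
        C * ∣ b - a ∣ + K * ∣ b - a ∣
          ≈⟨ distribʳ ∣ b - a ∣ C K ⟨
        (C + K) * ∣ b - a ∣ ∎
    ; remainder = λ a b a≤ b≤ → begin
        ∣ ((G b + H b) - (G a + H a)) - (g a + h a) * (b - a) ∣
          ≈⟨ ∣-∣-cong (solve 7 (λ p q r s u v d → ((p :+ q) :- (r :+ s)) :- (u :+ v) :* d
               := ((p :- r) :- u :* d) :+ ((q :- s) :- v :* d)) refl
               (G b) (H b) (G a) (H a) (g a) (h a) (b - a)) ⟩
        ∣ ((G b - G a) - g a * (b - a)) + ((H b - H a) - h a * (b - a)) ∣
          ∼⟨ ∣x+y∣≤ (remainder dG a b a≤ b≤) (remainder dH a b a≤ b≤) ⟩
        C * (∣ b - a ∣ * ∣ b - a ∣) + K * (∣ b - a ∣ * ∣ b - a ∣)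
          ≈⟨ distribʳ (∣ b - a ∣ * ∣ b - a ∣) C K ⟨
        (C + K) * (∣ b - a ∣ * ∣ b - a ∣) ∎
    }

  derivative-* : ∀ {G g H h} → HasDerivative G g → HasDerivative H h →
    HasDerivative (λ a → G a * H a) (λ a → g a * H a + G a * h a)
  derivative-* {G} {g} {H} {h} DG DH B =
    let (C , 0≤C , dG) = DG B
        (K , 0≤K , dH) = DH B
        0≤CK = 0≤x*y 0≤C 0≤K
        M = (C * K + C * K) + C * K
        0≤2CK = +-nonNeg 0≤CK 0≤CK
    in M , +-nonNeg 0≤2CK 0≤CK , record
    { bounded = λ a a≤ → ≤-trans (∣x*y∣≤ (bounded dG a a≤) (bounded dH a a≤)) (≤+ˡ 0≤2CK)
    ; lipschitz = λ a b a≤ b≤ → let d = ∣ b - a ∣ in begin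
        ∣ G b * H b - G a * H a ∣
          ≈⟨ ∣-∣-cong (solve 4 (λ p q r s → p :* q :- r :* s := p :* (q :- s) :+ (p :- r) :* s) refl (G b) (H b) (G a) (H a)) ⟩
        ∣ G b * (H b - H a) + (G b - G a) * H a ∣
          ∼⟨ ∣x+y∣≤ (∣x*y∣≤ (bounded dG b b≤) (lipschitz dH a b a≤ b≤))
                    (∣x*y∣≤ (lipschitz dG a b a≤ b≤) (bounded dH a a≤)) ⟩
        C * (K * d) + (C * d) * K
          ≈⟨ solve 3 (λ c k d → c :* (k :* d) :+ (c :* d) :* k := (c :* k :+ c :* k) :* d) refl C K d ⟩
        (C * K + C * K) * d
          ∼⟨ *-monoʳ-≤ (0≤∣x∣ (b - a)) (≤+ʳ 0≤CK) ⟩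
        M * d ∎
    ; remainder = λ a b a≤ b≤ → let d = ∣ b - a ∣ in begin
        ∣ (G b * H b - G a * H a) - (g a * H a + G a * h a) * (b - a) ∣
          -- The product of the two increments, plus `G a` times the remainder of `H`, plus the
          -- remainder of `G` times `H a`. Each of the three is at most C K d², whence the threefold
          -- C K in `M`.
          ≈⟨ ∣-∣-cong (solve 7 (λ p q r s u v d → (p :* q :- r :* s) :- (u :* s :+ r :* v) :* d
               := ((p :- r) :* (q :- s) :+ r :* ((q :- s) :- v :* d)) :+ ((p :- r) :- u :* d) :* s) refl
               (G b) (H b) (G a) (H a) (g a) (h a) (b - a)) ⟩
        ∣ ((G b - G a) * (H b - H a) + G a * ((H b - H a) - h a * (b - a))) + ((G b - G a) - g a * (b - a)) * H a ∣
          ∼⟨ ∣x+y∣≤ (∣x+y∣≤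
               (∣x*y∣≤ (lipschitz dG a b a≤ b≤) (lipschitz dH a b a≤ b≤))
               (∣x*y∣≤ (bounded dG a a≤) (remainder dH a b a≤ b≤)))
               (∣x*y∣≤ (remainder dG a b a≤ b≤) (bounded dH a a≤)) ⟩
        ((C * d) * (K * d) + C * (K * (d * d))) + (C * (d * d)) * K
          ≈⟨ solve 3 (λ c k d → ((c :* d) :* (k :* d) :+ c :* (k :* (d :* d))) :+ (c :* (d :* d)) :* k
               := ((c :* k :+ c :* k) :+ c :* k) :* (d :* d)) refl C K d ⟩
        M * (d * d) ∎
    }

  derivative-scale : ∀ c {G g} → HasDerivative G g → HasDerivative (λ a → c * G a) (λ a → c * g a)
  derivative-scale c {G} {g} D = derivative-resp-≈ (λ _ → refl)
    (λ a → trans (+-congʳ (zeroˡ (G a))) (+-identityˡ (c * g a)))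
    (derivative-* (derivative-const c) D)

  derivative-∘- : ∀ {G g} → HasDerivative G g → HasDerivative (λ a → G (- a)) (λ a → - g (- a))
  derivative-∘- {G} {g} D B = let (C , 0≤C , d) = D B in C , 0≤C , record
    { bounded = λ a a≤ → bounded d (- a) (∣-a∣≤ a a≤)
    ; lipschitz = λ a b a≤ b≤ → begin
        ∣ G (- b) - G (- a) ∣
          ∼⟨ lipschitz d (- a) (- b) (∣-a∣≤ a a≤) (∣-a∣≤ b b≤) ⟩
        C * ∣ - b - - a ∣
          ≈⟨ *-congˡ (∣-b+a∣ a b) ⟩
        C * ∣ b - a ∣ ∎
    ; remainder = λ a b a≤ b≤ → begin
        ∣ (G (- b) - G (- a)) - - g (- a) * (b - a) ∣
          ≈⟨ ∣-∣-cong (solve 5 (λ p r u b a → (p :- r) :- :- u :* (b :- a) := (p :- r) :- u :* (:- b :- :- a))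
               refl (G (- b)) (G (- a)) (g (- a)) b a) ⟩
        ∣ (G (- b) - G (- a)) - g (- a) * (- b - - a) ∣
          ∼⟨ remainder d (- a) (- b) (∣-a∣≤ a a≤) (∣-a∣≤ b b≤) ⟩
        C * (∣ - b - - a ∣ * ∣ - b - - a ∣)
          ≈⟨ *-congˡ (*-cong (∣-b+a∣ a b) (∣-b+a∣ a b)) ⟩
        C * (∣ b - a ∣ * ∣ b - a ∣) ∎
    }
    where
      ∣-a∣≤ : ∀ a → ∣ a ∣ ≤ B → ∣ - a ∣ ≤ B
      ∣-a∣≤ a = ≤-trans (≤-reflexive (∣-x∣≈∣x∣ a))
      ∣-b+a∣ : ∀ a b → ∣ - b - - a ∣ ≈ ∣ b - a ∣
      ∣-b+a∣ a b = trans (∣-∣-cong (solve 2 (λ a b → :- b :- :- a := :- (b :- a)) refl a b)) (∣-x∣≈∣x∣ (b - a))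

  derivative-∑ : ∀ n {G g : ℕ → Carrier → Carrier} → (∀ k → HasDerivative (G k) (g k)) →
    HasDerivative (λ a → ∑ n λ k → G k a) (λ a → ∑ n λ k → g k a)
  derivative-∑ zero    D = derivative-const 0#
  derivative-∑ (suc n) D = derivative-+ (derivative-∑ n D) (D n)

  -- Riemann sums of a derivative

  module _ {B C δ : Carrier} {G g : Carrier → Carrier} (0≤C : 0# ≤ C) (d : DifferentiableOn B C G g) where

    -- Expanding G at the tag t, so that no modulus of continuity of g is needed.
    increment-error : ∀ {a t b} → a ≤ t → t ≤ b → b - a ≤ δ →
      ∣ a ∣ ≤ B → ∣ t ∣ ≤ B → ∣ b ∣ ≤ B →
      ∣ g t * (b - a) - (G b - G a) ∣ ≤ (C * δ) * (b - a)
    increment-error {a} {t} {b} a≤t t≤b b-a≤δ ∣a∣≤ ∣t∣≤ ∣b∣≤ = begin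
      ∣ g t * (b - a) - (G b - G a) ∣
        ≈⟨ ∣-∣-cong (solve 7 (λ g a t b p q r → g :* (b :- a) :- (p :- q)
             := ((q :- r) :- g :* (a :- t)) :+ :- ((p :- r) :- g :* (b :- t))) refl
             (g t) a t b (G b) (G a) (G t)) ⟩
      ∣ ((G a - G t) - g t * (a - t)) + - ((G b - G t) - g t * (b - t)) ∣
        ∼⟨ ∣x+y∣≤ (remainder d t a ∣t∣≤ ∣a∣≤)
                  (≤-trans (≤-reflexive (∣-x∣≈∣x∣ _)) (remainder d t b ∣t∣≤ ∣b∣≤)) ⟩
      C * (∣ a - t ∣ * ∣ a - t ∣) + C * (∣ b - t ∣ * ∣ b - t ∣)
        ∼⟨ +-mono-≤ (*-monoˡ-≤ 0≤C (square a-t≤ (≤-trans (+-mono-≤ t≤b ≤-refl) b-a≤δ)))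
                    (*-monoˡ-≤ 0≤C (square b-t≤ (≤-trans (+-mono-≤ ≤-refl -t≤-a) b-a≤δ))) ⟩
      C * ((t - a) * δ) + C * ((b - t) * δ)
        ≈⟨ solve 5 (λ c δ a t b → c :* ((t :- a) :* δ) :+ c :* ((b :- t) :* δ) := (c :* δ) :* (b :- a)) refl C δ a t b ⟩
      (C * δ) * (b - a) ∎
      where
        a-t≤ : ∣ a - t ∣ ≤ t - a
        a-t≤ = ≤-reflexive (trans (∣x-y∣≈∣y-x∣ a t) (0≤x⇒∣x∣≈x (x≤y⇒0≤y-x a≤t)))
        b-t≤ : ∣ b - t ∣ ≤ b - t
        b-t≤ = ≤-reflexive (0≤x⇒∣x∣≈x (x≤y⇒0≤y-x t≤b))
        -t≤-a : - t ≤ - a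
        -t≤-a = 0≤y-x⇒x≤y (≤-trans (x≤y⇒0≤y-x a≤t)
          (≤-reflexive (solve 2 (λ a t → t :- a := :- a :- :- t) refl a t)))
        square : ∀ {x y} → ∣ x ∣ ≤ y → y ≤ δ → ∣ x ∣ * ∣ x ∣ ≤ y * δ
        square {x} x≤y y≤δ = *-mono-≤ (≤-trans (0≤∣x∣ x) x≤y) (0≤∣x∣ x) x≤y (≤-trans x≤y y≤δ)

  module _ (p t : ℕ → Carrier) (n : ℕ)
           (p≤t : ∀ i → i ℕ.< n → p i ≤ t i) (t≤p : ∀ i → i ℕ.< n → t i ≤ p (suc i)) where

    point-mono : ∀ {i j} → i ℕ.≤′ j → j ℕ.≤ n → p i ≤ p j
    point-mono ℕ.≤′-refl _ = ≤-refl
    point-mono (ℕ.≤′-step {j} i≤j) j<n =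
      ≤-trans (point-mono i≤j (ℕₚ.<⇒≤ j<n)) (≤-trans (p≤t j j<n) (t≤p j j<n))

    -- Each interval contributes an error proportional to its length, so the total depends on the
    -- length of the whole interval and not on the number of pieces. Monotonicity of the points
    -- keeps points and tags inside [0, B], where `d` applies.
    riemann-error : ∀ {B C δ G g} → 0# ≤ p 0 → p n ≤ B → (∀ i → i ℕ.< n → p (suc i) - p i ≤ δ) →
      0# ≤ C → DifferentiableOn B C G g →
      ∣ (∑ n λ i → g (t i) * (p (suc i) - p i)) - (G (p n) - G (p 0)) ∣ ≤ (C * δ) * (p n - p 0)
    riemann-error {B} {C} {δ} {G} {g} 0≤p₀ pₙ≤B mesh 0≤C d = go n ℕₚ.≤-refl
      where
        ∣p∣≤B : ∀ i → i ℕ.≤ n → ∣ p i ∣ ≤ B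
        ∣p∣≤B i i≤n = 0≤x≤y⇒∣x∣≤y
          (≤-trans 0≤p₀ (point-mono (ℕₚ.≤⇒≤′ ℕ.z≤n) i≤n))
          (≤-trans (point-mono (ℕₚ.≤⇒≤′ i≤n) ℕₚ.≤-refl) pₙ≤B)
        ∣t∣≤B : ∀ i → i ℕ.< n → ∣ t i ∣ ≤ B
        ∣t∣≤B i i<n = 0≤x≤y⇒∣x∣≤y
          (≤-trans 0≤p₀ (≤-trans (point-mono (ℕₚ.≤⇒≤′ ℕ.z≤n) (ℕₚ.<⇒≤ i<n)) (p≤t i i<n)))
          (≤-trans (t≤p i i<n) (≤-trans (point-mono (ℕₚ.≤⇒≤′ i<n) ℕₚ.≤-refl) pₙ≤B))
        S : ℕ → Carrier
        S j = ∑ j λ i → g (t i) * (p (suc i) - p i)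
        go : ∀ j → j ℕ.≤ n → ∣ S j - (G (p j) - G (p 0)) ∣ ≤ (C * δ) * (p j - p 0)
        go zero _ = begin
          ∣ 0# - (G (p 0) - G (p 0)) ∣  ≈⟨ ∣-∣-cong (trans (+-congˡ (-‿cong (-‿inverseʳ _))) (-‿inverseʳ 0#)) ⟩
          ∣ 0# ∣                        ≈⟨ ∣0∣≈0 ⟩
          0#                            ≈⟨ zeroʳ (C * δ) ⟨
          (C * δ) * 0#                  ≈⟨ *-congˡ (-‿inverseʳ (p 0)) ⟨
          (C * δ) * (p 0 - p 0)         ∎
        go (suc j) j<n = begin
          ∣ (S j + s) - (G (p (suc j)) - G (p 0)) ∣
            ≈⟨ ∣-∣-cong (solve 5 (λ S s u v w → (S :+ s) :- (u :- w) := (S :- (v :- w)) :+ (s :- (u :- v))) refl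
                 (S j) s (G (p (suc j))) (G (p j)) (G (p 0))) ⟩
          ∣ (S j - (G (p j) - G (p 0))) + (s - (G (p (suc j)) - G (p j))) ∣
            ∼⟨ ∣x+y∣≤ (go j (ℕₚ.<⇒≤ j<n)) (increment-error 0≤C d (p≤t j j<n) (t≤p j j<n) (mesh j j<n)
                 (∣p∣≤B j (ℕₚ.<⇒≤ j<n)) (∣t∣≤B j j<n) (∣p∣≤B (suc j) j<n)) ⟩
          (C * δ) * (p j - p 0) + (C * δ) * (p (suc j) - p j)
            ≈⟨ solve 4 (λ c u v w → c :* (v :- w) :+ c :* (u :- v) := c :* (u :- w)) refl
                 (C * δ) (p (suc j)) (p j) (p 0) ⟩
          (C * δ) * (p (suc j) - p 0) ∎
          where
            s : Carrier
            s = g (t j) * (p (suc j) - p j)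

  ∣x∣≤0⇒x≈0 : ∀ {x} → ∣ x ∣ ≤ 0# → x ≈ 0#
  ∣x∣≤0⇒x≈0 {x} ∣x∣≤0 = ≤-antisym (≤-trans (x≤∣x∣ x) ∣x∣≤0) (0≤y-x⇒x≤y′ (begin
    - x        ∼⟨ x≤∣x∣ (- x) ⟩
    ∣ - x ∣    ≈⟨ ∣-x∣≈∣x∣ x ⟩
    ∣ x ∣      ∼⟨ ∣x∣≤0 ⟩
    0#         ∎))
    where
      0≤y-x⇒x≤y′ : - x ≤ 0# → 0# ≤ x
      0≤y-x⇒x≤y′ -x≤0 = begin
        0#         ∼⟨ x≤y⇒0≤y-x -x≤0 ⟩
        -- `0#` is passed as a variable `o`, because the solver knows rational constants only in the
        -- form `ι q`; `1#` is treated in the same way below.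
        0# - - x   ≈⟨ solve 2 (λ o x → o :- :- x := o :+ x) refl 0# x ⟩
        0# + x     ≈⟨ +-identityˡ x ⟩
        x          ∎

  x-y≈0⇒x≈y : ∀ {x y} → x - y ≈ 0# → x ≈ y
  x-y≈0⇒x≈y {x} {y} x-y≈0 = begin-equality
    x            ≈⟨ solve 2 (λ x y → x := (x :- y) :+ y) refl x y ⟩
    (x - y) + y  ≈⟨ +-congʳ x-y≈0 ⟩
    0# + y       ≈⟨ +-identityˡ y ⟩
    y            ∎

  -- Functions between setoids need not respect `_≈_`. Here the Lipschitz bound forces it: arguments
  -- at distance 0 have values at distance 0.
  differentiable⇒cong : ∀ {G g} → HasDerivative G g → ∀ {x y} → x ≈ y → G x ≈ G y
  differentiable⇒cong {G} D {x} {y} x≈y = let (C , _ , d) = D (∣ y ∣ + ∣ x ∣) in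
    x-y≈0⇒x≈y (∣x∣≤0⇒x≈0 (begin
      ∣ G x - G y ∣    ∼⟨ lipschitz d y x (≤+ʳ (0≤∣x∣ x)) (≤+ˡ (0≤∣x∣ y)) ⟩
      C * ∣ x - y ∣    ≈⟨ *-congˡ (∣-∣-cong (trans (+-congʳ x≈y) (-‿inverseʳ y))) ⟩
      C * ∣ 0# ∣       ≈⟨ *-congˡ ∣0∣≈0 ⟩
      C * 0#           ≈⟨ zeroʳ C ⟩
      0#               ∎))

  -- Partitions are bare sequences and tolerances are rational, so that the statement serves both
  -- the Riemann integral and the constancy of functions with zero derivative.
  riemann-converges : ∀ {G g} → HasDerivative G g → ∀ {T} → 0# ≤ T → ∀ {q} → 0ℚ Rat.< q →
    ∃[ δ ] 0ℚ Rat.< δ × (∀ p t n → p 0 ≈ 0# → p n ≈ T →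
      (∀ i → i ℕ.< n → p i ≤ t i) → (∀ i → i ℕ.< n → t i ≤ p (suc i)) →
      (∀ i → i ℕ.< n → p (suc i) - p i ≤ ι δ) →
      ∣ (∑ n λ i → g (t i) * (p (suc i) - p i)) - (G T - G 0#) ∣ ≤ ι q)
  riemann-converges {G} {g} D {T} 0≤T {q} 0<q =
    let (C , 0≤C , d) = D T
        (K , 1≤K , C≤K) = rational-bound C
        (M , 1≤M , T≤M) = rational-bound T
        -- The error of the Riemann sum is at most C δ T. With rational bounds `K` of `C` and `M` of
        -- `T`, the choice δ = q/(K M) makes it at most `q`.
        (δ , 0<δ , KδM≡q) = split K M 1≤K 1≤M
        0≤ιK = 0≤ι (ℚₚ.≤-trans Estimates.0≤1 1≤K)
        0≤ιδ = 0≤ι (ℚₚ.<⇒≤ 0<δ)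
    in δ , 0<δ , λ p t n p₀≈0 pₙ≈T p≤t t≤p mesh → begin
      ∣ (∑ n λ i → g (t i) * (p (suc i) - p i)) - (G T - G 0#) ∣
        ≈⟨ ∣-∣-cong (+-congˡ (-‿cong (+-cong (cong pₙ≈T) (-‿cong (cong p₀≈0))))) ⟨
      ∣ (∑ n λ i → g (t i) * (p (suc i) - p i)) - (G (p n) - G (p 0)) ∣
        ∼⟨ riemann-error p t n p≤t t≤p (≤-reflexive (sym p₀≈0)) (≤-reflexive pₙ≈T) mesh 0≤C d ⟩
      (C * ι δ) * (p n - p 0)
        ≈⟨ *-congˡ (trans (+-cong pₙ≈T (-‿cong p₀≈0)) (x-0≈x T)) ⟩
      (C * ι δ) * T
        ∼⟨ *-mono-≤ (0≤x*y 0≤ιK 0≤ιδ) 0≤T (*-monoʳ-≤ 0≤ιδ C≤K) T≤M ⟩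
      (ι K * ι δ) * ι M
        ≈⟨ trans (ι-* (K Rat.* δ) M) (*-congʳ (ι-* K δ)) ⟨
      ι ((K Rat.* δ) Rat.* M)
        ≡⟨ ≡.cong ι KδM≡q ⟩
      ι q ∎
    where
      cong : ∀ {x y} → x ≈ y → G x ≈ G y
      cong = differentiable⇒cong D
      split : ∀ K M → 1ℚ Rat.≤ K → 1ℚ Rat.≤ M → ∃[ δ ] 0ℚ Rat.< δ × (K Rat.* δ) Rat.* M ≡ q
      split K M 1≤K 1≤M = q Rat.* Rat.1/ KM ,
          ℚₚ.positive⁻¹ _ {{ℚₚ.pos*pos⇒pos q {{Rat.positive 0<q}} (Rat.1/ KM) {{ℚₚ.1/pos⇒pos KM}}}} ,
          ≡.trans (ℚ-Solver.solve 4 (λ K q r M → (K ℚ-Solver.:* (q ℚ-Solver.:* r)) ℚ-Solver.:* M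
                     ℚ-Solver.:= q ℚ-Solver.:* (r ℚ-Solver.:* (K ℚ-Solver.:* M))) ≡.refl K q (Rat.1/ KM) M)
            (≡.trans (≡.cong (q Rat.*_) (ℚₚ.*-inverseˡ KM)) (ℚₚ.*-identityʳ q))
        where
          KM : ℚ
          KM = K Rat.* M
          pos : ∀ {x} → 1ℚ Rat.≤ x → Rat.Positive x
          pos 1≤x = Rat.positive (ℚₚ.<-≤-trans (ℚₚ.positive⁻¹ 1ℚ) 1≤x)
          instance
            KM-pos : Rat.Positive KM
            KM-pos = ℚₚ.pos*pos⇒pos K {{pos 1≤K}} M {{pos 1≤M}}
            KM-nonZero : Rat.NonZero KM
            KM-nonZero = ℚₚ.pos⇒nonZero KM

  open Estimates using (↑; recip; invFact; ↑-recip; ↑-suc; 0≤recip; 0≤↑; 0≤invFact; invFact-suc)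

  ι-↑-suc : ∀ n → ι (↑ (suc n)) ≈ ι (↑ n) + ι 1ℚ
  ι-↑-suc n = trans (reflexive (≡.cong ι (↑-suc n))) (ι-+ (↑ n) 1ℚ)

  -- All Riemann sums of the zero function vanish, yet they approximate H T - H 0 within every
  -- tolerance; so that difference is 0.
  zero-derivative⇒constant : ∀ {H} → HasDerivative H (λ _ → 0#) → ∀ {T} → 0# ≤ T → H T ≈ H 0#
  zero-derivative⇒constant {H} D {T} 0≤T = x-y≈0⇒x≈y (∣x∣≤0⇒x≈0 (≤-small⇒≤0 small))
    where
      small : ∀ {q} → 0ℚ Rat.< q → ∣ H T - H 0# ∣ ≤ ι q
      small {q} 0<q =
        let (δ , 0<δ , close) = riemann-converges D 0≤T 0<q
            (K , 1≤K , T≤K) = rational-bound T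
            (N , fine) = subdivision K δ (ℚₚ.≤-trans Estimates.0≤1 1≤K) 0<δ
            h = ι (recip N) * T
            -- The uniform partition of [0, T] into `suc N` pieces of length `h`, used below with
            -- its left endpoints as tags.
            p = λ i → ι (↑ i) * h
            step = λ i → trans (+-congʳ (*-congʳ (ι-↑-suc i)))
              (solve 2 (λ i h → (i :+ con 1ℚ) :* h :- i :* h := h) refl (ι (↑ i)) h)
            0≤h = 0≤x*y (0≤ι (0≤recip N)) 0≤T
            p≤p = λ i → ≤-trans (≤+ʳ 0≤h)
              (≤-reflexive (trans (+-congˡ (sym (step i))) (solve 2 (λ x y → x :+ (y :- x) := y) refl (p i) (p (suc i)))))
        in begin
          ∣ H T - H 0# ∣
            ≈⟨ ∣x-y∣≈∣y-x∣ (H T) (H 0#) ⟩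
          ∣ H 0# - H T ∣
            ≈⟨ ∣-∣-cong (trans (+-congʳ (null (λ i → p (suc i) - p i) (suc N)))
                 (trans (+-identityˡ _) (solve 2 (λ a b → :- (a :- b) := b :- a) refl (H T) (H 0#)))) ⟨
          ∣ (∑ (suc N) λ i → 0# * (p (suc i) - p i)) - (H T - H 0#) ∣
            ∼⟨ close p p (suc N)
                 (trans (*-congʳ ι-0) (zeroˡ h))
                 (begin-equality
                   ι (↑ (suc N)) * (ι (recip N) * T)   ≈⟨ *-assoc (ι (↑ (suc N))) (ι (recip N)) T ⟨
                   (ι (↑ (suc N)) * ι (recip N)) * T   ≈⟨ *-congʳ (ι-* (↑ (suc N)) (recip N)) ⟨
                   ι (↑ (suc N) Rat.* recip N) * T     ≡⟨ ≡.cong (λ w → ι w * T) (↑-recip (suc N)) ⟩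
                   ι 1ℚ * T                            ≈⟨ trans (*-congʳ ι-1) (*-identityˡ T) ⟩
                   T                                   ∎)
                 (λ _ _ → ≤-refl)
                 (λ i _ → p≤p i)
                 (λ i _ → begin
                   p (suc i) - p i     ≈⟨ step i ⟩
                   ι (recip N) * T     ∼⟨ *-monoˡ-≤ (0≤ι (0≤recip N)) T≤K ⟩
                   ι (recip N) * ι K   ≈⟨ ι-* (recip N) K ⟨
                   ι (recip N Rat.* K) ∼⟨ ι-mono fine ⟩
                   ι δ                 ∎) ⟩
          ι q ∎
        where
          null : ∀ x n → (∑ n λ i → 0# * x i) ≈ 0#
          null x zero    = refl
          null x (suc n) = trans (+-cong (null x n) (zeroˡ (x n))) (+-identityˡ 0#)

  -- Decay at infinity

  -- This is F = O(1/T) on the half-line. The class is closed under sums and scalar multiples, and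
  -- the constant yields an explicit threshold for the limit.
  Decays : (Carrier → Carrier) → Set
  Decays F = ∃[ C ] (∀ {T} → 0# ≤ T → ∣ T * F T ∣ ≤ C)

  -- The carrier has no division by `T`. Instead T₀ = K/q and u = q/K satisfy u T₀ = 1, so ∣F T∣ = u
  -- T₀ ∣F T∣ ≤ u T ∣F T∣ ≤ u K = q once T ≥ T₀.
  decays⇒small : ∀ {F} → Decays F → ∀ {q} → 0ℚ Rat.< q →
    ∃[ T₀ ] 0ℚ Rat.≤ T₀ × (∀ {T} → ι T₀ ≤ T → ∣ F T ∣ ≤ ι q)
  decays⇒small {F} (C , F≤) {q} 0<q =
    let (K , 1≤K , C≤K) = rational-bound C
        (T₀ , 0≤T₀ , u , 0≤u , uT₀≡1 , uK≡q) = scales K 1≤K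
    in T₀ , 0≤T₀ , λ {T} T₀≤T → let 0≤T = ≤-trans (0≤ι 0≤T₀) T₀≤T in begin
      ∣ F T ∣                    ≈⟨ trans (*-congʳ ι-1) (*-identityˡ _) ⟨
      ι 1ℚ * ∣ F T ∣             ≡⟨ ≡.cong (λ w → ι w * ∣ F T ∣) uT₀≡1 ⟨
      ι (u Rat.* T₀) * ∣ F T ∣   ≈⟨ trans (*-congʳ (ι-* u T₀)) (*-assoc (ι u) (ι T₀) ∣ F T ∣) ⟩
      ι u * (ι T₀ * ∣ F T ∣)     ∼⟨ *-monoˡ-≤ (0≤ι 0≤u) (begin
          ι T₀ * ∣ F T ∣    ∼⟨ *-monoʳ-≤ (0≤∣x∣ (F T)) T₀≤T ⟩
          T * ∣ F T ∣       ≈⟨ *-congʳ (0≤x⇒∣x∣≈x 0≤T) ⟨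
          ∣ T ∣ * ∣ F T ∣   ≈⟨ ∣x*y∣≈∣x∣*∣y∣ T (F T) ⟨
          ∣ T * F T ∣       ∼⟨ F≤ 0≤T ⟩
          C                 ∼⟨ C≤K ⟩
          ι K               ∎) ⟩
      ι u * ι K                  ≈⟨ ι-* u K ⟨
      ι (u Rat.* K)              ≡⟨ ≡.cong ι uK≡q ⟩
      ι q                        ∎
    where
      scales : ∀ K → 1ℚ Rat.≤ K →
        ∃[ T₀ ] 0ℚ Rat.≤ T₀ × ∃[ u ] 0ℚ Rat.≤ u × (u Rat.* T₀ ≡ 1ℚ) × (u Rat.* K ≡ q)
      scales K 1≤K = K Rat.* Rat.1/ q , 0≤T₀ , q Rat.* Rat.1/ K , 0≤u ,
          ≡.trans (ℚ-Solver.solve 4 (λ q r K s → (q ℚ-Solver.:* s) ℚ-Solver.:* (K ℚ-Solver.:* r)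
                     ℚ-Solver.:= (r ℚ-Solver.:* q) ℚ-Solver.:* (s ℚ-Solver.:* K)) ≡.refl q (Rat.1/ q) K (Rat.1/ K))
            (≡.cong₂ Rat._*_ (ℚₚ.*-inverseˡ q) (ℚₚ.*-inverseˡ K)) ,
          ≡.trans (ℚₚ.*-assoc q (Rat.1/ K) K) (≡.trans (≡.cong (q Rat.*_) (ℚₚ.*-inverseˡ K)) (ℚₚ.*-identityʳ q))
        where
          instance
            q-pos : Rat.Positive q
            q-pos = Rat.positive 0<q
            q-nonZero : Rat.NonZero q
            q-nonZero = ℚₚ.pos⇒nonZero q
            K-pos : Rat.Positive K
            K-pos = Rat.positive (ℚₚ.<-≤-trans (ℚₚ.positive⁻¹ 1ℚ) 1≤K)
            K-nonZero : Rat.NonZero K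
            K-nonZero = ℚₚ.pos⇒nonZero K
          0≤T₀ : 0ℚ Rat.≤ K Rat.* Rat.1/ q
          0≤T₀ = ℚₚ.<⇒≤ (ℚₚ.positive⁻¹ _ {{ℚₚ.pos*pos⇒pos K (Rat.1/ q) {{ℚₚ.1/pos⇒pos q}}}})
          0≤u : 0ℚ Rat.≤ q Rat.* Rat.1/ K
          0≤u = ℚₚ.<⇒≤ (ℚₚ.positive⁻¹ _ {{ℚₚ.pos*pos⇒pos q (Rat.1/ K) {{ℚₚ.1/pos⇒pos K}}}})

  decays⇒limit : ∀ {F L} → Decays F → - F 0# ≈ L → ∀ {q} → 0ℚ Rat.< q →
    ∃[ T₀ ] 0ℚ Rat.≤ T₀ × (∀ {T} → ι T₀ ≤ T → ∣ (F T - F 0#) - L ∣ ≤ ι q)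
  decays⇒limit {F} {L} d -F0≈L 0<q = let (T₀ , 0≤T₀ , small) = decays⇒small d 0<q in
    T₀ , 0≤T₀ , λ {T} T₀≤T → ≤-trans (≤-reflexive (∣-∣-cong (begin-equality
      (F T - F 0#) - L   ≈⟨ +-congʳ (+-congˡ -F0≈L) ⟩
      (F T + L) - L      ≈⟨ solve 2 (λ f l → (f :+ l) :- l := f) refl (F T) L ⟩
      F T                ∎))) (small T₀≤T)

  decays-+ : ∀ {F G} → Decays F → Decays G → Decays (λ τ → F τ + G τ)
  decays-+ {F} {G} (C , F≤) (K , G≤) = C + K , λ {T} 0≤T →
    ≤-trans (≤-reflexive (∣-∣-cong (distribˡ T (F T) (G T)))) (∣x+y∣≤ (F≤ 0≤T) (G≤ 0≤T))

  decays-scale : ∀ c {F} → Decays F → Decays (λ τ → c * F τ)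
  decays-scale c {F} (C , F≤) = ∣ c ∣ * C , λ {T} 0≤T → ≤-trans
    (≤-reflexive (∣-∣-cong (solve 3 (λ t c f → t :* (c :* f) := c :* (t :* f)) refl T c (F T))))
    (∣x*y∣≤ ≤-refl (F≤ 0≤T))

  decays-∑ : ∀ n {F : ℕ → Carrier → Carrier} → (∀ k → Decays (F k)) → Decays (λ τ → ∑ n λ k → F k τ)
  decays-∑ zero    _ = 0# , λ {T} _ → ≤-reflexive (trans (∣-∣-cong (zeroʳ T)) ∣0∣≈0)
  decays-∑ (suc n) d = decays-+ (decays-∑ n d) (d n)

  -- Primitives of e^(-τ) τ^k / k!

  module Exponential (exp : Carrier → Carrier) (D-exp : HasDerivative exp exp) (exp-0 : exp 0# ≈ 1#)
    (term≤exp : ∀ k {T} → 0# ≤ T → T ^ k * ι (invFact k) ≤ exp T) where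

    power : ℕ → Carrier → Carrier
    power k τ = τ ^ k * ι (invFact k)

    decaying : Carrier → Carrier
    decaying τ = exp (- τ)

    power-suc : ∀ k τ → power (suc k) τ ≈ ι (recip k) * (τ * power k τ)
    power-suc k τ = begin-equality
      (τ * τ ^ k) * ι (invFact (suc k))           ≡⟨ ≡.cong (λ w → (τ * τ ^ k) * ι w) (invFact-suc k) ⟩
      (τ * τ ^ k) * ι (recip k Rat.* invFact k)   ≈⟨ *-congˡ (ι-* (recip k) (invFact k)) ⟩
      (τ * τ ^ k) * (ι (recip k) * ι (invFact k))
        ≈⟨ solve 4 (λ t p r c → (t :* p) :* (r :* c) := r :* (t :* (p :* c))) refl τ (τ ^ k) (ι (recip k)) (ι (invFact k)) ⟩
      ι (recip k) * (τ * power k τ)               ∎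

    ↑-recip-cancel : ∀ k x → ι (↑ (suc k)) * (ι (recip k) * x) ≈ x
    ↑-recip-cancel k x = begin-equality
      ι (↑ (suc k)) * (ι (recip k) * x)   ≈⟨ *-assoc (ι (↑ (suc k))) (ι (recip k)) x ⟨
      (ι (↑ (suc k)) * ι (recip k)) * x   ≈⟨ *-congʳ (ι-* (↑ (suc k)) (recip k)) ⟨
      ι (↑ (suc k) Rat.* recip k) * x     ≡⟨ ≡.cong (λ w → ι w * x) (↑-recip (suc k)) ⟩
      ι 1ℚ * x                            ≈⟨ trans (*-congʳ ι-1) (*-identityˡ x) ⟩
      x                                   ∎

    *-power : ∀ k τ → τ * power k τ ≈ ι (↑ (suc k)) * power (suc k) τ
    *-power k τ = sym (trans (*-congˡ (power-suc k τ)) (↑-recip-cancel k (τ * power k τ)))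

    power-zero-derivative : HasDerivative (power 0) (λ _ → 0#)
    power-zero-derivative = derivative-const (1# * ι (invFact 0))

    -- Induction with the product rule for τ · (τ^k / k!) divided by k + 1. The first step stands
    -- apart because the derivative of `power 0` is 0 and not another `power`.
    power-suc-derivative : ∀ k → HasDerivative (power (suc k)) (power k)
    power-suc-derivative zero = derivative-resp-≈ (λ τ → sym (power-suc 0 τ)) correct
      (derivative-scale (ι (recip 0)) (derivative-* derivative-id power-zero-derivative))
      where
        correct : ∀ τ → ι (recip 0) * (1# * power 0 τ + τ * 0#) ≈ power 0 τ
        correct τ = begin-equality
          ι 1ℚ * (1# * power 0 τ + τ * 0#)   ≈⟨ trans (*-congʳ ι-1) (*-identityˡ _) ⟩
          1# * power 0 τ + τ * 0#            ≈⟨ +-cong (*-identityˡ _) (zeroʳ τ) ⟩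
          power 0 τ + 0#                     ≈⟨ +-identityʳ _ ⟩
          power 0 τ                          ∎
    power-suc-derivative (suc k) = derivative-resp-≈ (λ τ → sym (power-suc (suc k) τ)) correct
      (derivative-scale (ι (recip (suc k))) (derivative-* derivative-id (power-suc-derivative k)))
      where
        correct : ∀ τ → ι (recip (suc k)) * (1# * power (suc k) τ + τ * power k τ) ≈ power (suc k) τ
        correct τ = let P = power (suc k) τ in begin-equality
          ι (recip (suc k)) * (1# * P + τ * power k τ)
            ≈⟨ *-congˡ (+-cong (*-identityˡ P) (*-power k τ)) ⟩
          ι (recip (suc k)) * (P + ι (↑ (suc k)) * P)
            ≈⟨ solve 3 (λ r p c → r :* (p :+ c :* p) := (c :+ con 1ℚ) :* (r :* p)) refl (ι (recip (suc k))) P (ι (↑ (suc k))) ⟩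
          (ι (↑ (suc k)) + ι 1ℚ) * (ι (recip (suc k)) * P)
            ≈⟨ *-congʳ (ι-↑-suc (suc k)) ⟨
          ι (↑ (suc (suc k))) * (ι (recip (suc k)) * P)
            ≈⟨ ↑-recip-cancel (suc k) P ⟩
          P ∎

    D-decaying : HasDerivative decaying (λ τ → - decaying τ)
    D-decaying = derivative-∘- D-exp

    decaying-0 : decaying 0# ≈ 1#
    decaying-0 = trans (differentiable⇒cong D-exp -0#≈0#) exp-0

    -- The two terms of the product rule cancel, so the product is constant on [0, ∞) and equal to
    -- its value at 0. This is the only instance of the functional equation that is required.
    decaying*exp : ∀ {T} → 0# ≤ T → decaying T * exp T ≈ 1#
    decaying*exp 0≤T = trans
      (zero-derivative⇒constant (derivative-resp-≈ (λ _ → refl)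
        (λ τ → trans (solve 2 (λ a b → :- a :* b :+ a :* b := con 0ℚ) refl (decaying τ) (exp τ)) ι-0) (derivative-* D-decaying D-exp)) 0≤T)
      (trans (*-cong decaying-0 exp-0) (*-identityˡ 1#))

    0≤exp : ∀ {T} → 0# ≤ T → 0# ≤ exp T
    0≤exp 0≤T = ≤-trans (0≤x*y 0≤1 (0≤ι (0≤invFact 0))) (term≤exp 0 0≤T)

    -- A negative value is excluded because e^(-T) = (e^(-T))² e^T.
    0≤decaying : ∀ {T} → 0# ≤ T → 0# ≤ decaying T
    0≤decaying {T} 0≤T = let E = decaying T in begin
      0#                ∼⟨ 0≤x*y (0≤x*x E) (0≤exp 0≤T) ⟩
      (E * E) * exp T   ≈⟨ *-assoc E E (exp T) ⟩
      E * (E * exp T)   ≈⟨ *-congˡ (decaying*exp 0≤T) ⟩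
      E * 1#            ≈⟨ *-identityʳ E ⟩
      E                 ∎

    integrand : ℕ → Carrier → Carrier
    integrand k τ = decaying τ * power k τ

    integrand≤1 : ∀ k {T} → 0# ≤ T → integrand k T ≤ 1#
    integrand≤1 k {T} 0≤T = begin
      decaying T * power k T  ∼⟨ *-monoˡ-≤ (0≤decaying 0≤T) (term≤exp k 0≤T) ⟩
      decaying T * exp T      ≈⟨ decaying*exp 0≤T ⟩
      1#                      ∎

    0≤power : ∀ k {T} → 0# ≤ T → 0# ≤ power k T
    0≤power k {T} 0≤T = 0≤x*y (0≤^ k) (0≤ι (0≤invFact k))
      where
        0≤^ : ∀ k → 0# ≤ T ^ k
        0≤^ zero    = 0≤1
        0≤^ (suc k) = 0≤x*y 0≤T (0≤^ k)

    integrand-decays : ∀ k → Decays (integrand k)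
    integrand-decays k = ι (↑ (suc k)) , λ {T} 0≤T → let E = decaying T in 0≤x≤y⇒∣x∣≤y
      (0≤x*y 0≤T (0≤x*y (0≤decaying 0≤T) (0≤power k 0≤T))) (begin
        T * (E * power k T)                       ≈⟨ solve 3 (λ t e p → t :* (e :* p) := e :* (t :* p)) refl T E (power k T) ⟩
        E * (T * power k T)                       ≈⟨ *-congˡ (*-power k T) ⟩
        E * (ι (↑ (suc k)) * power (suc k) T)     ≈⟨ solve 3 (λ c e p → e :* (c :* p) := c :* (e :* p)) refl (ι (↑ (suc k))) E (power (suc k) T) ⟩
        ι (↑ (suc k)) * integrand (suc k) T       ∼⟨ *-monoˡ-≤ (0≤ι (0≤↑ (suc k))) (integrand≤1 (suc k) 0≤T) ⟩
        ι (↑ (suc k)) * 1#                        ≈⟨ *-identityʳ _ ⟩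
        ι (↑ (suc k))                             ∎)

    -- The sign is a factor `- 1#` so that the rules for scalar multiples yield its derivative and
    -- its decay.
    antiderivative : ℕ → Carrier → Carrier
    antiderivative zero    τ = - 1# * integrand 0 τ
    antiderivative (suc k) τ = antiderivative k τ + - 1# * integrand (suc k) τ

    -- The summand added at `suc k` has derivative `integrand (suc k)` minus `integrand k`, so the
    -- sum telescopes to its last integrand.
    antiderivative-derivative : ∀ k → HasDerivative (antiderivative k) (integrand k)
    antiderivative-derivative zero = derivative-resp-≈ (λ _ → refl) correct
      (derivative-scale (- 1#) (derivative-* D-decaying power-zero-derivative))
      where
        correct : ∀ τ → - 1# * (- decaying τ * power 0 τ + decaying τ * 0#) ≈ integrand 0 τ
        correct τ = let E = decaying τ ; P = power 0 τ in begin-equality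
          - 1# * (- E * P + E * 0#)   ≈⟨ *-congˡ (trans (+-congˡ (zeroʳ E)) (+-identityʳ _)) ⟩
          - 1# * (- E * P)            ≈⟨ solve 3 (λ o e p → :- o :* (:- e :* p) := o :* (e :* p)) refl 1# E P ⟩
          1# * (E * P)                ≈⟨ *-identityˡ _ ⟩
          E * P                       ∎
    antiderivative-derivative (suc k) = derivative-resp-≈ (λ _ → refl) correct
      (derivative-+ (antiderivative-derivative k)
        (derivative-scale (- 1#) (derivative-* D-decaying (power-suc-derivative k))))
      where
        correct : ∀ τ → integrand k τ + - 1# * (- decaying τ * power (suc k) τ + decaying τ * power k τ) ≈ integrand (suc k) τ
        correct τ = let E = decaying τ ; P = power k τ ; Q = power (suc k) τ in begin-equality
          E * P + - 1# * (- E * Q + E * P)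
            ≈⟨ solve 4 (λ o e p q → e :* p :+ :- o :* (:- e :* q :+ e :* p) := e :* p :+ o :* (e :* q :- e :* p)) refl 1# E P Q ⟩
          E * P + 1# * (E * Q - E * P)
            ≈⟨ +-congˡ (*-identityˡ _) ⟩
          E * P + (E * Q - E * P)
            ≈⟨ solve 2 (λ x y → x :+ (y :- x) := y) refl (E * P) (E * Q) ⟩
          E * Q ∎

    antiderivative-decays : ∀ k → Decays (antiderivative k)
    antiderivative-decays zero    = decays-scale (- 1#) (integrand-decays 0)
    antiderivative-decays (suc k) = decays-+ (antiderivative-decays k) (decays-scale (- 1#) (integrand-decays (suc k)))

    antiderivative-0 : ∀ k → - antiderivative k 0# ≈ 1#
    antiderivative-0 zero = begin-equality
      - (- 1# * (decaying 0# * (1# * ι (invFact 0))))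
        ≈⟨ solve 4 (λ o e p u → :- (:- o :* (e :* (p :* u))) := o :* (e :* (p :* u))) refl 1# (decaying 0#) 1# (ι (invFact 0)) ⟩
      1# * (decaying 0# * (1# * ι 1ℚ))
        ≈⟨ trans (*-identityˡ _) (*-cong decaying-0 (trans (*-identityˡ _) ι-1)) ⟩
      1# * 1#
        ≈⟨ *-identityˡ 1# ⟩
      1# ∎
    antiderivative-0 (suc k) = begin-equality
      - (antiderivative k 0# + - 1# * (decaying 0# * ((0# * 0# ^ k) * ι (invFact (suc k)))))
        ≈⟨ -‿cong (+-congˡ (*-congˡ (*-congˡ (trans (*-congʳ (zeroˡ _)) (zeroˡ _))))) ⟩
      - (antiderivative k 0# + - 1# * (decaying 0# * 0#))
        ≈⟨ -‿cong (trans (+-congˡ (trans (*-congˡ (zeroʳ _)) (zeroʳ _))) (+-identityʳ _)) ⟩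
      - antiderivative k 0#
        ≈⟨ antiderivative-0 k ⟩
      1# ∎

    module _ (n : ℕ) (c : ℕ → Carrier) where

      combination : Carrier → Carrier
      combination τ = ∑ n λ k → c k * antiderivative k τ

      combination-derivative : HasDerivative combination (λ τ → ∑ n λ k → c k * integrand k τ)
      combination-derivative = derivative-∑ n λ k → derivative-scale (c k) (antiderivative-derivative k)

      combination-decays : Decays combination
      combination-decays = decays-∑ n λ k → decays-scale (c k) (antiderivative-decays k)

    combination-0 : ∀ n c → - combination n c 0# ≈ ∑ n c
    combination-0 zero    c = -0#≈0#
    combination-0 (suc n) c = begin-equality
      - (combination n c 0# + c n * antiderivative n 0#)
        ≈⟨ solve 3 (λ s c p → :- (s :+ c :* p) := :- s :+ c :* :- p) refl (combination n c 0#) (c n) (antiderivative n 0#) ⟩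
      - combination n c 0# + c n * - antiderivative n 0#
        ≈⟨ +-cong (combination-0 n c) (trans (*-congˡ (antiderivative-0 n)) (*-identityʳ (c n))) ⟩
      ∑ n c + c n ∎

-- Real identities behind complex multiplication

-- These are the real and imaginary parts of the ring laws of the complex numbers. They are proved
-- for letters in an abstract algebra, so that normalisation never meets Cauchy sequences.
module ComplexMultiplication (R : OrderedAlgebra) where
  open OrderedAlgebra R
  open Calculus R using (solve; _:+_; _:*_; _:-_; :-_; _:=_; x-0≈x)

  module _ (a b c d e f : Carrier) where

    assoc-re : (a * c - b * d) * e - (a * d + b * c) * f ≈ a * (c * e - d * f) - b * (c * f + d * e)
    assoc-re = solve 6 (λ a b c d e f → (a :* c :- b :* d) :* e :- (a :* d :+ b :* c) :* f
      := a :* (c :* e :- d :* f) :- b :* (c :* f :+ d :* e)) refl a b c d e f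

    assoc-im : (a * c - b * d) * f + (a * d + b * c) * e ≈ a * (c * f + d * e) + b * (c * e - d * f)
    assoc-im = solve 6 (λ a b c d e f → (a :* c :- b :* d) :* f :+ (a :* d :+ b :* c) :* e
      := a :* (c :* f :+ d :* e) :+ b :* (c :* e :- d :* f)) refl a b c d e f

    distribˡ-re : a * (c + e) - b * (d + f) ≈ (a * c - b * d) + (a * e - b * f)
    distribˡ-re = solve 6 (λ a b c d e f → a :* (c :+ e) :- b :* (d :+ f)
      := (a :* c :- b :* d) :+ (a :* e :- b :* f)) refl a b c d e f

    distribˡ-im : a * (d + f) + b * (c + e) ≈ (a * d + b * c) + (a * f + b * e)
    distribˡ-im = solve 6 (λ a b c d e f → a :* (d :+ f) :+ b :* (c :+ e)
      := (a :* d :+ b :* c) :+ (a :* f :+ b :* e)) refl a b c d e f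

    distribʳ-re : (c + e) * a - (d + f) * b ≈ (c * a - d * b) + (e * a - f * b)
    distribʳ-re = solve 6 (λ a b c d e f → (c :+ e) :* a :- (d :+ f) :* b
      := (c :* a :- d :* b) :+ (e :* a :- f :* b)) refl a b c d e f

    distribʳ-im : (c + e) * b + (d + f) * a ≈ (c * b + d * a) + (e * b + f * a)
    distribʳ-im = solve 6 (λ a b c d e f → (c :+ e) :* b :+ (d :+ f) :* a
      := (c :* b :+ d :* a) :+ (e :* b :+ f :* a)) refl a b c d e f

  module _ (a b c d : Carrier) where

    comm-re : a * c - b * d ≈ c * a - d * b
    comm-re = solve 4 (λ a b c d → a :* c :- b :* d := c :* a :- d :* b) refl a b c d

    comm-im : a * d + b * c ≈ c * b + d * a
    comm-im = solve 4 (λ a b c d → a :* d :+ b :* c := c :* b :+ d :* a) refl a b c d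

  module _ (a a′ b b′ c c′ d d′ : Carrier) (a≈ : a ≈ a′) (b≈ : b ≈ b′) (c≈ : c ≈ c′) (d≈ : d ≈ d′) where

    cong-re : a * b - c * d ≈ a′ * b′ - c′ * d′
    cong-re = +-cong (*-cong a≈ b≈) (-‿cong (*-cong c≈ d≈))

    cong-im : a * d + c * b ≈ a′ * d′ + c′ * b′
    cong-im = +-cong (*-cong a≈ d≈) (*-cong c≈ b≈)

  x*y-z*0≈x*y : ∀ x y z → x * y - z * 0# ≈ x * y
  x*y-z*0≈x*y x y z = trans (+-congˡ (-‿cong (zeroʳ z))) (x-0≈x (x * y))

  x*0+y*z≈y*z : ∀ x y z → x * 0# + y * z ≈ y * z
  x*0+y*z≈y*z x y z = trans (+-congʳ (zeroʳ x)) (+-identityˡ (y * z))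

  1*x-0*y≈x : ∀ x y → 1# * x - 0# * y ≈ x
  1*x-0*y≈x x y = trans (+-cong (*-identityˡ x) (-‿cong (zeroˡ y))) (x-0≈x x)

  1*x+0*y≈x : ∀ x y → 1# * x + 0# * y ≈ x
  1*x+0*y≈x x y = trans (+-cong (*-identityˡ x) (zeroˡ y)) (+-identityʳ x)

  x*1-y*0≈x : ∀ x y → x * 1# - y * 0# ≈ x
  x*1-y*0≈x x y = trans (+-cong (*-identityʳ x) (-‿cong (zeroʳ y))) (x-0≈x x)

  x*0+y*1≈y : ∀ x y → x * 0# + y * 1# ≈ y
  x*0+y*1≈y x y = trans (+-cong (zeroʳ x) (*-identityʳ y)) (+-identityˡ y)

  x*0+0*y≈0 : ∀ x y → x * 0# + 0# * y ≈ 0#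
  x*0+0*y≈0 x y = trans (+-cong (zeroʳ x) (zeroˡ y)) (+-identityˡ 0#)

-- The operations of Defs, made opaque: real expressions are then compared
-- through their operations instead of their rational approximants, whose
-- normal forms are huge.  The equations +≡, *≡, … lead back to Defs.
module Real where
  opaque
    infix 4 _≈_ _≤_
    infixl 6 _+_
    infixl 7 _*_
    infix 8 -_

    _≈_ _≤_ : ℝ → ℝ → Set
    _≈_ = RawRing._≈_ ℝ-rawRing
    _≤_ = RealAnalysis._≤_

    _+_ _*_ : ℝ → ℝ → ℝ
    _+_ = RawRing._+_ ℝ-rawRing
    _*_ = RawRing._*_ ℝ-rawRing

    -_ ∣_∣ : ℝ → ℝ
    -_  = RawRing.-_ ℝ-rawRing
    ∣_∣ = RealAnalysis.∣_∣

    0# 1# : ℝ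
    0# = RawRing.0# ℝ-rawRing
    1# = RawRing.1# ℝ-rawRing

    ι : ℚ → ℝ
    ι = fromℚ

    exp : ℝ → ℝ
    exp = RealAnalysis.exp

-- Order and congruence for Cauchy sequences

module RealOrder where
  open Real
  open Estimates
  open ℚₚ.≤-Reasoning
  open ℚ-Solver using (solve; _:+_; _:*_; _:-_; :-_; _:=_; con)

  infixr 2 _⊓_
  _⊓_ : ∀ {P Q} → Eventually P → Eventually Q → Eventually (λ n → P n × Q n)
  (M , p) ⊓ (N , q) = M ℕ.⊔ N , λ n ≤n →
    p n (ℕₚ.≤-trans (ℕₚ.m≤m⊔n M N) ≤n) , q n (ℕₚ.≤-trans (ℕₚ.m≤n⊔m M N) ≤n)

  mapᵉ : ∀ {P Q : ℕ → Set} → (∀ n → P n → Q n) → Eventually P → Eventually Q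
  mapᵉ f (N , p) = N , λ n N≤n → f n (p n N≤n)

  -- The witness is ε/(K + 1): the added 1 covers K = 0 and makes the inequality strict.
  shrink : ∀ K → 0ℚ Rat.≤ K → ∀ {ε} → 0ℚ Rat.< ε → ∃[ ε′ ] 0ℚ Rat.< ε′ × K Rat.* ε′ Rat.< ε
  shrink K 0≤K {ε} 0<ε = ε′ , 0<ε′ , (begin-strict
      K Rat.* ε′                    ≡⟨ ℚₚ.+-identityʳ _ ⟨
      K Rat.* ε′ Rat.+ 0ℚ           <⟨ ℚₚ.+-monoʳ-< (K Rat.* ε′) 0<ε′ ⟩
      K Rat.* ε′ Rat.+ ε′           ≡⟨ solve 3 (λ k e i → k :* (e :* i) :+ e :* i := e :* (i :* (k :+ con 1ℚ))) ≡.refl K ε (Rat.1/ D) ⟩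
      ε Rat.* (Rat.1/ D Rat.* D)    ≡⟨ ≡.cong (ε Rat.*_) (ℚₚ.*-inverseˡ D) ⟩
      ε Rat.* 1ℚ                    ≡⟨ ℚₚ.*-identityʳ ε ⟩
      ε                             ∎)
    where
      D : ℚ
      D = K Rat.+ 1ℚ
      instance
        D-pos : Rat.Positive D
        D-pos = ℚₚ.nonNeg+pos⇒pos K {{Rat.nonNegative 0≤K}} 1ℚ
        D-nonZero : Rat.NonZero D
        D-nonZero = ℚₚ.pos⇒nonZero D
      ε′ : ℚ
      ε′ = ε Rat.* Rat.1/ D
      0<ε′ : 0ℚ Rat.< ε′
      0<ε′ = ℚₚ.positive⁻¹ ε′ {{ℚₚ.pos*pos⇒pos ε {{Rat.positive 0<ε}} (Rat.1/ D) {{ℚₚ.1/pos⇒pos D}}}}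

  2ℚ : ℚ
  2ℚ = 1ℚ Rat.+ 1ℚ

  0≤2 : 0ℚ Rat.≤ 2ℚ
  0≤2 = 0≤+ 0≤1 0≤1

  2*ε : ∀ ε → 2ℚ Rat.* ε ≡ ε Rat.+ ε
  2*ε = solve 1 (λ e → (con 1ℚ :+ con 1ℚ) :* e := e :+ e) ≡.refl

  ∣p∣≤ : ∀ {p q} → p Rat.≤ q → Rat.- p Rat.≤ q → Rat.∣ p ∣ Rat.≤ q
  ∣p∣≤ {p} {q} p≤q -p≤q with ℚₚ.∣p∣≡p∨∣p∣≡-p p
  ... | inj₁ ∣p∣≡p  = ≡.subst (Rat._≤ q) (≡.sym ∣p∣≡p) p≤q
  ... | inj₂ ∣p∣≡-p = ≡.subst (Rat._≤ q) (≡.sym ∣p∣≡-p) -p≤q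

  p-q≤ : ∀ {p q r} → p Rat.≤ q Rat.+ r → p Rat.- q Rat.≤ r
  p-q≤ {p} {q} {r} p≤q+r = begin
    p Rat.- q               ≤⟨ ℚₚ.+-monoˡ-≤ (Rat.- q) p≤q+r ⟩
    (q Rat.+ r) Rat.- q     ≡⟨ solve 2 (λ q r → (q :+ r) :- q := r) ≡.refl q r ⟩
    r                       ∎

  0≤p*p : ∀ p → 0ℚ Rat.≤ p Rat.* p
  0≤p*p p with ℚₚ.≤-total 0ℚ p
  ... | inj₁ 0≤p = 0≤* 0≤p 0≤p
  ... | inj₂ p≤0 = ≡.subst (0ℚ Rat.≤_) (solve 1 (λ p → :- p :* :- p := p :* p) ≡.refl p) (0≤* 0≤-p 0≤-p)
    where
      0≤-p : 0ℚ Rat.≤ Rat.- p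
      0≤-p = ℚₚ.neg-antimono-≤ p≤0

  opaque
    unfolding _≈_

    -- Estimates may end with any fixed multiple of `ε` and a weak inequality; the rescaling by
    -- `shrink` happens once, here and in `≤-intro`.
    ≈-intro : ∀ x y K → 0ℚ Rat.≤ K →
      (∀ ε → 0ℚ Rat.< ε → Eventually λ n → Rat.∣ approx x n Rat.- approx y n ∣ Rat.≤ K Rat.* ε) → x ≈ y
    ≈-intro x y K 0≤K close ε 0<ε = let (ε′ , 0<ε′ , small) = shrink K 0≤K 0<ε in
      mapᵉ (λ n c → ℚₚ.≤-<-trans c small) (close ε′ 0<ε′)

    ≤-intro : ∀ x y K → 0ℚ Rat.≤ K →
      (∀ ε → 0ℚ Rat.< ε → Eventually λ n → approx x n Rat.≤ approx y n Rat.+ K Rat.* ε) → x ≤ y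
    ≤-intro x y K 0≤K close ε 0<ε = let (ε′ , 0<ε′ , small) = shrink K 0≤K 0<ε in
      mapᵉ (λ n c → ℚₚ.≤-<-trans c (ℚₚ.+-monoʳ-< (approx y n) small)) (close ε′ 0<ε′)

    pointwise-≈ : ∀ x y → (∀ n → approx x n ≡ approx y n) → x ≈ y
    pointwise-≈ x y x≡y ε 0<ε = 0 , λ n _ →
      ≡.subst (λ w → Rat.∣ approx x n Rat.- w ∣ Rat.< ε) (x≡y n) (∣p-p∣<ε (approx x n) 0<ε)

    eventually-≤ : ∀ x y → Eventually (λ n → approx x n Rat.≤ approx y n) → x ≤ y
    eventually-≤ x y x≤y ε 0<ε = mapᵉ (λ n xₙ≤yₙ → begin-strict
      approx x n            ≤⟨ xₙ≤yₙ ⟩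
      approx y n            ≡⟨ ℚₚ.+-identityʳ _ ⟨
      approx y n Rat.+ 0ℚ   <⟨ ℚₚ.+-monoʳ-< (approx y n) 0<ε ⟩
      approx y n Rat.+ ε    ∎) x≤y

    pointwise-≤ : ∀ x y → (∀ n → approx x n Rat.≤ approx y n) → x ≤ y
    pointwise-≤ x y x≤y = eventually-≤ x y (0 , λ n _ → x≤y n)

    ≈-refl : ∀ x → x ≈ x
    ≈-refl x = pointwise-≈ x x λ _ → ≡.refl

    ≈-sym : ∀ x y → x ≈ y → y ≈ x
    ≈-sym x y x≈y ε 0<ε = mapᵉ (λ n → ≡.subst (Rat._< ε) (∣-∣-sym (approx x n) (approx y n))) (x≈y ε 0<ε)

    ≈-trans : ∀ x y z → x ≈ y → y ≈ z → x ≈ z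
    ≈-trans x y z x≈y y≈z = ≈-intro x z 2ℚ 0≤2 λ ε 0<ε → mapᵉ (λ n (p , q) → begin
      Rat.∣ approx x n Rat.- approx z n ∣   ≤⟨ triangle (approx x n) (approx y n) (approx z n) ⟩
      Rat.∣ approx x n Rat.- approx y n ∣ Rat.+ Rat.∣ approx y n Rat.- approx z n ∣
                                            ≤⟨ ℚₚ.+-mono-≤ (ℚₚ.<⇒≤ p) (ℚₚ.<⇒≤ q) ⟩
      ε Rat.+ ε                             ≡⟨ 2*ε ε ⟨
      2ℚ Rat.* ε                            ∎) (x≈y ε 0<ε ⊓ y≈z ε 0<ε)

    +-cong : ∀ x y u v → x ≈ y → u ≈ v → x + u ≈ y + v
    +-cong x y u v x≈y u≈v = ≈-intro (x + u) (y + v) 2ℚ 0≤2 λ ε 0<ε → mapᵉ (λ n (p , q) →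
      let a = approx x n ; b = approx y n ; c = approx u n ; d = approx v n in begin
      Rat.∣ (a Rat.+ c) Rat.- (b Rat.+ d) ∣
        ≡⟨ ≡.cong Rat.∣_∣ (solve 4 (λ a b c d → (a :+ c) :- (b :+ d) := (a :- b) :+ (c :- d)) ≡.refl a b c d) ⟩
      Rat.∣ (a Rat.- b) Rat.+ (c Rat.- d) ∣
        ≤⟨ ℚₚ.∣p+q∣≤∣p∣+∣q∣ (a Rat.- b) (c Rat.- d) ⟩
      Rat.∣ a Rat.- b ∣ Rat.+ Rat.∣ c Rat.- d ∣
        ≤⟨ ℚₚ.+-mono-≤ (ℚₚ.<⇒≤ p) (ℚₚ.<⇒≤ q) ⟩
      ε Rat.+ ε
        ≡⟨ 2*ε ε ⟨
      2ℚ Rat.* ε ∎) (x≈y ε 0<ε ⊓ u≈v ε 0<ε)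

    *-cong : ∀ x y u v → x ≈ y → u ≈ v → x * u ≈ y * v
    *-cong x y u v x≈y u≈v =
      let (A , 1≤A , x≤) = bounded (approx x) (cauchy x)
          (B , 1≤B , v≤) = bounded (approx v) (cauchy v)
          0≤A = ℚₚ.≤-trans 0≤1 1≤A
          0≤B = ℚₚ.≤-trans 0≤1 1≤B
      in ≈-intro (x * u) (y * v) (A Rat.+ B) (0≤+ 0≤A 0≤B) λ ε 0<ε → mapᵉ (λ n (p , q) →
      let a = approx x n ; b = approx y n ; c = approx u n ; d = approx v n in begin
      Rat.∣ a Rat.* c Rat.- b Rat.* d ∣
        ≡⟨ ≡.cong Rat.∣_∣ (solve 4 (λ a b c d → a :* c :- b :* d := a :* (c :- d) :+ (a :- b) :* d) ≡.refl a b c d) ⟩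
      Rat.∣ a Rat.* (c Rat.- d) Rat.+ (a Rat.- b) Rat.* d ∣
        ≤⟨ ℚₚ.∣p+q∣≤∣p∣+∣q∣ (a Rat.* (c Rat.- d)) ((a Rat.- b) Rat.* d) ⟩
      Rat.∣ a Rat.* (c Rat.- d) ∣ Rat.+ Rat.∣ (a Rat.- b) Rat.* d ∣
        ≡⟨ ≡.cong₂ Rat._+_ (ℚₚ.∣p*q∣≡∣p∣*∣q∣ a (c Rat.- d)) (ℚₚ.∣p*q∣≡∣p∣*∣q∣ (a Rat.- b) d) ⟩
      Rat.∣ a ∣ Rat.* Rat.∣ c Rat.- d ∣ Rat.+ Rat.∣ a Rat.- b ∣ Rat.* Rat.∣ d ∣
        ≤⟨ ℚₚ.+-mono-≤ (*-mono (ℚₚ.0≤∣p∣ (c Rat.- d)) 0≤A (x≤ n) (ℚₚ.<⇒≤ q))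
                       (*-mono (ℚₚ.0≤∣p∣ d) (ℚₚ.<⇒≤ 0<ε) (ℚₚ.<⇒≤ p) (v≤ n)) ⟩
      A Rat.* ε Rat.+ ε Rat.* B
        ≡⟨ solve 3 (λ a b e → a :* e :+ e :* b := (a :+ b) :* e) ≡.refl A B ε ⟩
      (A Rat.+ B) Rat.* ε ∎) (x≈y ε 0<ε ⊓ u≈v ε 0<ε)

    neg-cong : ∀ x y → x ≈ y → - x ≈ - y
    neg-cong x y x≈y ε 0<ε = mapᵉ (λ n → let a = approx x n ; b = approx y n in
      ≡.subst (Rat._< ε) (≡.trans (≡.sym (ℚₚ.∣-p∣≡∣p∣ (a Rat.- b)))
        (≡.cong Rat.∣_∣ (solve 2 (λ a b → :- (a :- b) := :- a :- :- b) ≡.refl a b)))) (x≈y ε 0<ε)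

    ∣-∣-cong : ∀ x y → x ≈ y → ∣ x ∣ ≈ ∣ y ∣
    ∣-∣-cong x y x≈y ε 0<ε = mapᵉ (λ n → ℚₚ.≤-<-trans (∣∣p∣-∣q∣∣≤∣p-q∣ (approx x n) (approx y n))) (x≈y ε 0<ε)

    ≤-reflexive : ∀ x y → x ≈ y → x ≤ y
    ≤-reflexive x y x≈y ε 0<ε = mapᵉ (λ n p → let a = approx x n ; b = approx y n in begin-strict
      a                               ≡⟨ solve 2 (λ a b → a := b :+ (a :- b)) ≡.refl a b ⟩
      b Rat.+ (a Rat.- b)             ≤⟨ ℚₚ.+-monoʳ-≤ b (p≤∣p∣ (a Rat.- b)) ⟩
      b Rat.+ Rat.∣ a Rat.- b ∣       <⟨ ℚₚ.+-monoʳ-< b p ⟩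
      b Rat.+ ε                       ∎) (x≈y ε 0<ε)

    ≤-trans : ∀ x y z → x ≤ y → y ≤ z → x ≤ z
    ≤-trans x y z x≤y y≤z = ≤-intro x z 2ℚ 0≤2 λ ε 0<ε → mapᵉ (λ n (p , q) → begin
      approx x n                      ≤⟨ ℚₚ.<⇒≤ p ⟩
      approx y n Rat.+ ε              ≤⟨ ℚₚ.+-monoˡ-≤ ε (ℚₚ.<⇒≤ q) ⟩
      (approx z n Rat.+ ε) Rat.+ ε    ≡⟨ ≡.trans (ℚₚ.+-assoc (approx z n) ε ε) (≡.cong (approx z n Rat.+_) (≡.sym (2*ε ε))) ⟩
      approx z n Rat.+ 2ℚ Rat.* ε     ∎) (x≤y ε 0<ε ⊓ y≤z ε 0<ε)

    +-mono-≤ : ∀ x y u v → x ≤ y → u ≤ v → x + u ≤ y + v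
    +-mono-≤ x y u v x≤y u≤v = ≤-intro (x + u) (y + v) 2ℚ 0≤2 λ ε 0<ε → mapᵉ (λ n (p , q) → begin
      approx x n Rat.+ approx u n
        ≤⟨ ℚₚ.+-mono-≤ (ℚₚ.<⇒≤ p) (ℚₚ.<⇒≤ q) ⟩
      (approx y n Rat.+ ε) Rat.+ (approx v n Rat.+ ε)
        ≡⟨ solve 3 (λ b d e → (b :+ e) :+ (d :+ e) := (b :+ d) :+ (con 1ℚ :+ con 1ℚ) :* e) ≡.refl (approx y n) (approx v n) ε ⟩
      (approx y n Rat.+ approx v n) Rat.+ 2ℚ Rat.* ε ∎) (x≤y ε 0<ε ⊓ u≤v ε 0<ε)

    ≤-antisym : ∀ x y → x ≤ y → y ≤ x → x ≈ y
    ≤-antisym x y x≤y y≤x = ≈-intro x y 1ℚ 0≤1 λ ε 0<ε → mapᵉ (λ n (p , q) →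
      ≡.subst (Rat.∣ approx x n Rat.- approx y n ∣ Rat.≤_) (≡.sym (ℚₚ.*-identityˡ ε))
        (∣p∣≤ (p-q≤ (ℚₚ.<⇒≤ p))
          (≡.subst (Rat._≤ ε) (solve 2 (λ a b → b :- a := :- (a :- b)) ≡.refl (approx x n) (approx y n))
            (p-q≤ (ℚₚ.<⇒≤ q))))) (x≤y ε 0<ε ⊓ y≤x ε 0<ε)

    0≤x⇒∣x∣≈x : ∀ x → 0# ≤ x → ∣ x ∣ ≈ x
    0≤x⇒∣x∣≈x x 0≤x = ≤-antisym ∣ x ∣ x upper (pointwise-≤ x ∣ x ∣ λ n → p≤∣p∣ (approx x n))
      where
        upper : ∣ x ∣ ≤ x
        upper = ≤-intro ∣ x ∣ x 2ℚ 0≤2 λ ε 0<ε → mapᵉ (λ n p → let a = approx x n in ∣p∣≤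
          (begin
            a                        ≡⟨ ℚₚ.+-identityʳ a ⟨
            a Rat.+ 0ℚ               ≤⟨ ℚₚ.+-monoʳ-≤ a (0≤* 0≤2 (ℚₚ.<⇒≤ 0<ε)) ⟩
            a Rat.+ 2ℚ Rat.* ε       ∎)
          (begin
            Rat.- a                                  ≡⟨ ℚₚ.+-identityˡ _ ⟨
            -- The hypothesis says only 0 < a + ε, as `a` itself may be negative; used twice, it
            -- gives -a ≤ a + 2ε.
            0ℚ Rat.- a                               ≤⟨ ℚₚ.+-monoˡ-≤ (Rat.- a) (0≤+ (ℚₚ.<⇒≤ p) (ℚₚ.<⇒≤ p)) ⟩
            ((a Rat.+ ε) Rat.+ (a Rat.+ ε)) Rat.- a  ≡⟨ solve 2 (λ a e → ((a :+ e) :+ (a :+ e)) :- a := a :+ (con 1ℚ :+ con 1ℚ) :* e) ≡.refl a ε ⟩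
            a Rat.+ 2ℚ Rat.* ε                       ∎)) (0≤x ε 0<ε)

    -- Approximants of nonnegative reals may be negative, so the product is first compared with ∣x∣
    -- ∣y∣, whose approximants are all nonnegative.
    0≤x*y : ∀ x y → 0# ≤ x → 0# ≤ y → 0# ≤ x * y
    0≤x*y x y 0≤x 0≤y = ≤-trans 0# (∣ x ∣ * ∣ y ∣) (x * y)
      (pointwise-≤ 0# (∣ x ∣ * ∣ y ∣) λ n → 0≤* (ℚₚ.0≤∣p∣ (approx x n)) (ℚₚ.0≤∣p∣ (approx y n)))
      (≤-reflexive (∣ x ∣ * ∣ y ∣) (x * y)
        (*-cong (∣ x ∣) x (∣ y ∣) y (0≤x⇒∣x∣≈x x 0≤x) (0≤x⇒∣x∣≈x y 0≤y)))

    rational-bound : ∀ x → ∃[ K ] 1ℚ Rat.≤ K × x ≤ ι K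
    rational-bound x = let (K , 1≤K , x≤K) = bounded (approx x) (cauchy x) in
      K , 1≤K , pointwise-≤ x (ι K) λ n → ℚₚ.≤-trans (p≤∣p∣ (approx x n)) (x≤K n)

    ≤-small⇒≤0 : ∀ x → (∀ {q} → 0ℚ Rat.< q → x ≤ ι q) → x ≤ 0#
    ≤-small⇒≤0 x small = ≤-intro x 0# 2ℚ 0≤2 λ ε 0<ε → mapᵉ (λ n p → begin
      approx x n             ≤⟨ ℚₚ.<⇒≤ p ⟩
      ε Rat.+ ε              ≡⟨ 2*ε ε ⟨
      2ℚ Rat.* ε             ≡⟨ ℚₚ.+-identityˡ _ ⟨
      0ℚ Rat.+ 2ℚ Rat.* ε    ∎) (small 0<ε ε 0<ε)

-- The Cauchy reals as an ordered algebra

module RealAlgebra where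
  open Real
  open Estimates
  open RealOrder

  opaque
    unfolding _≈_

    isCommutativeRing : IsCommutativeRing _≈_ _+_ _*_ -_ 0# 1#
    isCommutativeRing = record
      { isRing = record
        { +-isAbelianGroup = record
          { isGroup = record
            { isMonoid = record
              { isSemigroup = record
                { isMagma = record
                  { isEquivalence = record
                    { refl  = λ {x} → ≈-refl x
                    ; sym   = λ {x} {y} → ≈-sym x y
                    ; trans = λ {x} {y} {z} → ≈-trans x y z
                    }
                  ; ∙-cong = λ {x} {y} {u} {v} → +-cong x y u v
                  }
                ; assoc = λ x y z → pointwise-≈ ((x + y) + z) (x + (y + z)) λ n →
                    ℚₚ.+-assoc (approx x n) (approx y n) (approx z n)
                }
              ; identity = (λ x → pointwise-≈ (0# + x) x λ n → ℚₚ.+-identityˡ (approx x n))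
                         , (λ x → pointwise-≈ (x + 0#) x λ n → ℚₚ.+-identityʳ (approx x n))
              }
            ; inverse = (λ x → pointwise-≈ (- x + x) 0# λ n → ℚₚ.+-inverseˡ (approx x n))
                      , (λ x → pointwise-≈ (x + - x) 0# λ n → ℚₚ.+-inverseʳ (approx x n))
            ; ⁻¹-cong = λ {x} {y} → neg-cong x y
            }
          ; comm = λ x y → pointwise-≈ (x + y) (y + x) λ n → ℚₚ.+-comm (approx x n) (approx y n)
          }
        ; *-cong = λ {x} {y} {u} {v} → *-cong x y u v
        ; *-assoc = λ x y z → pointwise-≈ ((x * y) * z) (x * (y * z)) λ n →
            ℚₚ.*-assoc (approx x n) (approx y n) (approx z n)
        ; *-identity = (λ x → pointwise-≈ (1# * x) x λ n → ℚₚ.*-identityˡ (approx x n))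
                     , (λ x → pointwise-≈ (x * 1#) x λ n → ℚₚ.*-identityʳ (approx x n))
        ; distrib = (λ x y z → pointwise-≈ (x * (y + z)) (x * y + x * z) λ n →
                      ℚₚ.*-distribˡ-+ (approx x n) (approx y n) (approx z n))
                  , (λ x y z → pointwise-≈ ((y + z) * x) (y * x + z * x) λ n →
                      ℚₚ.*-distribʳ-+ (approx x n) (approx y n) (approx z n))
        }
      ; *-comm = λ x y → pointwise-≈ (x * y) (y * x) λ n → ℚₚ.*-comm (approx x n) (approx y n)
      }

  ℝ-commutativeRing : CommutativeRing 0ℓ 0ℓ
  ℝ-commutativeRing = record { isCommutativeRing = isCommutativeRing }

  opaque
    unfolding _≈_

    isOrderedAlgebra : IsOrderedAlgebra ℝ-commutativeRing _≤_ ∣_∣ ι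
    isOrderedAlgebra = record
      { ≤-reflexive = λ {x} {y} → ≤-reflexive x y
      ; ≤-trans = λ {x} {y} {z} → ≤-trans x y z
      ; ≤-antisym = λ {x} {y} → ≤-antisym x y
      ; +-mono-≤ = λ {x} {y} {u} {v} → +-mono-≤ x y u v
      ; 0≤x*y = λ {x} {y} → 0≤x*y x y
      ; 0≤x*x = λ x → pointwise-≤ 0# (x * x) λ n → 0≤p*p (approx x n)
      ; 0≤∣x∣ = λ x → pointwise-≤ 0# ∣ x ∣ λ n → ℚₚ.0≤∣p∣ (approx x n)
      ; x≤∣x∣ = λ x → pointwise-≤ x ∣ x ∣ λ n → p≤∣p∣ (approx x n)
      ; 0≤x⇒∣x∣≈x = λ {x} → 0≤x⇒∣x∣≈x x
      ; ∣-∣-cong = λ {x} {y} → ∣-∣-cong x y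
      ; ∣-x∣≈∣x∣ = λ x → pointwise-≈ ∣ - x ∣ ∣ x ∣ λ n → ℚₚ.∣-p∣≡∣p∣ (approx x n)
      ; ∣x+y∣≤∣x∣+∣y∣ = λ x y → pointwise-≤ ∣ x + y ∣ (∣ x ∣ + ∣ y ∣) λ n →
          ℚₚ.∣p+q∣≤∣p∣+∣q∣ (approx x n) (approx y n)
      ; ∣x*y∣≈∣x∣*∣y∣ = λ x y → pointwise-≈ ∣ x * y ∣ (∣ x ∣ * ∣ y ∣) λ n →
          ℚₚ.∣p*q∣≡∣p∣*∣q∣ (approx x n) (approx y n)
      ; ι-+ = λ p q → ≈-refl (ι (p Rat.+ q))
      ; ι-* = λ p q → ≈-refl (ι (p Rat.* q))
      ; ι-neg = λ p → ≈-refl (ι (Rat.- p))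
      ; ι-0 = ≈-refl 0#
      ; ι-1 = ≈-refl 1#
      ; ι-mono = λ {p} {q} p≤q → pointwise-≤ (ι p) (ι q) λ _ → p≤q
      ; rational-bound = rational-bound
      ; ≤-small⇒≤0 = λ {x} → ≤-small⇒≤0 x
      }

  ℝ-orderedAlgebra : OrderedAlgebra
  ℝ-orderedAlgebra = record { isOrderedAlgebra = isOrderedAlgebra }

  opaque
    unfolding _≈_

    +≡ : ∀ x y → x + y ≡ RawRing._+_ ℝ-rawRing x y
    +≡ _ _ = ≡.refl

    *≡ : ∀ x y → x * y ≡ RawRing._*_ ℝ-rawRing x y
    *≡ _ _ = ≡.refl

    -≡ : ∀ x → - x ≡ RawRing.-_ ℝ-rawRing x
    -≡ _ = ≡.refl

    ∣∣≡ : ∀ x → ∣ x ∣ ≡ RealAnalysis.∣ x ∣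
    ∣∣≡ _ = ≡.refl

    0≡ : 0# ≡ RawRing.0# ℝ-rawRing
    0≡ = ≡.refl

    1≡ : 1# ≡ RawRing.1# ℝ-rawRing
    1≡ = ≡.refl

    ι≡ : ∀ q → ι q ≡ fromℚ q
    ι≡ _ = ≡.refl

    exp≡ : ∀ x → exp x ≡ RealAnalysis.exp x
    exp≡ _ = ≡.refl

    raw⇒≈ : ∀ x y → RawRing._≈_ ℝ-rawRing x y → x ≈ y
    raw⇒≈ _ _ x≈y = x≈y

    raw⇒≤ : ∀ x y → x RealAnalysis.≤ y → x ≤ y
    raw⇒≤ _ _ x≤y = x≤y

-- Second-order estimates for rational exponential sums

module ExponentialRemainder (H : ℚ) (1≤H : 1ℚ Rat.≤ H) {p q : ℚ}
  (∣p∣≤H : Rat.∣ p ∣ Rat.≤ H) (∣q∣≤H : Rat.∣ q ∣ Rat.≤ H) where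
  open Rat
  open Estimates
  open FiniteSums Rat.+-*-rawRing
  open ℚₚ.≤-Reasoning
  open ℚ-Solver using (solve; _:+_; _:*_; _:-_; :-_; _:=_; con)

  private
    0≤H : 0ℚ ≤ H
    0≤H = ℚₚ.≤-trans 0≤1 1≤H

    L d : ℚ
    L = H + H
    d = ∣ q - p ∣

    0≤L : 0ℚ ≤ L
    0≤L = 0≤+ 0≤H 0≤H

    0≤d² : 0ℚ ≤ d * d
    0≤d² = 0≤* (ℚₚ.0≤∣p∣ (q - p)) (ℚₚ.0≤∣p∣ (q - p))

  -- This is k p^(k-1), defined by the product rule for p · p^k. The recursion avoids a predecessor
  -- and matches the induction on the remainder.
  powerDerivative : ℕ → ℚ
  powerDerivative zero    = 0ℚ
  powerDerivative (suc k) = p ^ k + p * powerDerivative k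

  powerDerivative-suc : ∀ k → powerDerivative (suc k) ≡ ↑ (suc k) * p ^ k
  powerDerivative-suc zero = solve 1 (λ p → con 1ℚ :+ p :* con 0ℚ := con 1ℚ :* con 1ℚ) ≡.refl p
  powerDerivative-suc (suc k) = begin-equality
    p * p ^ k + p * powerDerivative (suc k)   ≡⟨ ≡.cong (λ w → p * p ^ k + p * w) (powerDerivative-suc k) ⟩
    p * p ^ k + p * (↑ (suc k) * p ^ k)       ≡⟨ solve 3 (λ p u x → p :* x :+ p :* (u :* x) := (u :+ con 1ℚ) :* (p :* x)) ≡.refl p (↑ (suc k)) (p ^ k) ⟩
    (↑ (suc k) + 1ℚ) * (p * p ^ k)            ≡⟨ ≡.cong (_* (p * p ^ k)) (↑-suc (suc k)) ⟨
    ↑ (suc (suc k)) * (p * p ^ k)             ∎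

  -- The product rule leaves `p` times the previous remainder plus (q - p)(q^k - p^k); the second
  -- term is already quadratic by the Lipschitz bound for powers.
  power-remainder : ∀ k → ∣ (q ^ k - p ^ k) - powerDerivative k * (q - p) ∣ ≤ (d * d) * L ^ k
  power-remainder zero = ≡.subst (_≤ (d * d) * 1ℚ)
    (≡.cong ∣_∣ (solve 2 (λ p q → con 0ℚ := (con 1ℚ :- con 1ℚ) :- con 0ℚ :* (q :- p)) ≡.refl p q))
    (0≤* 0≤d² 0≤1)
  power-remainder (suc k) = begin
    ∣ (q * Q - p * P) - (P + p * D) * (q - p) ∣
      ≡⟨ ≡.cong ∣_∣ (solve 5 (λ p q P Q D → (q :* Q :- p :* P) :- (P :+ p :* D) :* (q :- p)
           := p :* ((Q :- P) :- D :* (q :- p)) :+ (q :- p) :* (Q :- P)) ≡.refl p q P Q D) ⟩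
    ∣ p * r + (q - p) * (Q - P) ∣
      ≤⟨ ℚₚ.∣p+q∣≤∣p∣+∣q∣ (p * r) ((q - p) * (Q - P)) ⟩
    ∣ p * r ∣ + ∣ (q - p) * (Q - P) ∣
      ≡⟨ ≡.cong₂ _+_ (ℚₚ.∣p*q∣≡∣p∣*∣q∣ p r) (ℚₚ.∣p*q∣≡∣p∣*∣q∣ (q - p) (Q - P)) ⟩
    ∣ p ∣ * ∣ r ∣ + d * ∣ Q - P ∣
      ≤⟨ ℚₚ.+-mono-≤ (*-mono (ℚₚ.0≤∣p∣ r) 0≤H ∣p∣≤H (power-remainder k))
           (*-mono (ℚₚ.0≤∣p∣ (Q - P)) (ℚₚ.0≤∣p∣ (q - p)) ℚₚ.≤-refl (∣^-^∣≤ H 1≤H ∣q∣≤H ∣p∣≤H k)) ⟩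
    H * ((d * d) * L ^ k) + d * (d * L ^ k)
      ≡⟨ solve 3 (λ h d l → h :* ((d :* d) :* l) :+ d :* (d :* l) := (h :+ con 1ℚ) :* ((d :* d) :* l)) ≡.refl H d (L ^ k) ⟩
    (H + 1ℚ) * ((d * d) * L ^ k)
      -- Here `1ℚ ≤ H` absorbs the added 1, which is why the base of the bound is L = H + H.
      ≤⟨ *-mono (0≤* 0≤d² (0≤^ L 0≤L k)) 0≤L (ℚₚ.+-monoʳ-≤ H 1≤H) ℚₚ.≤-refl ⟩
    L * ((d * d) * L ^ k)
      ≡⟨ solve 3 (λ l d x → l :* ((d :* d) :* x) := (d :* d) :* (l :* x)) ≡.refl L d (L ^ k) ⟩
    (d * d) * (L * L ^ k) ∎
    where
      P Q D r : ℚ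
      P = p ^ k
      Q = q ^ k
      D = powerDerivative k
      r = (Q - P) - D * (q - p)

  expTerm-derivative : ∀ n → expTerm p n ≡ powerDerivative (suc n) * invFact (suc n)
  expTerm-derivative n = begin-equality
    p ^ n * invFact n
      ≡⟨ ≡.cong (p ^ n *_) (≡.trans (≡.sym (ℚₚ.*-identityˡ (invFact n))) (≡.cong (_* invFact n) (≡.sym (↑-recip (suc n))))) ⟩
    p ^ n * ((↑ (suc n) * recip n) * invFact n)
      ≡⟨ solve 4 (λ x u r c → x :* ((u :* r) :* c) := (u :* x) :* (r :* c)) ≡.refl (p ^ n) (↑ (suc n)) (recip n) (invFact n) ⟩
    (↑ (suc n) * p ^ n) * (recip n * invFact n)
      ≡⟨ ≡.cong₂ _*_ (powerDerivative-suc n) (invFact-suc n) ⟨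
    powerDerivative (suc n) * invFact (suc n) ∎

  -- Adding up the remainders of the powers with weights 1/k! leaves d² times an exponential sum at
  -- `L`, and these sums are bounded uniformly in `n`. The derivative has one term fewer, as the
  -- constant term drops out.
  expSum-remainder : ∀ n → ∣ (expSum (suc n) q - expSum (suc n) p) - expSum n p * (q - p) ∣ ≤ (d * d) * expSum (suc n) L
  expSum-remainder zero = ≡.subst (_≤ (d * d) * expSum 1 L)
    (≡.cong ∣_∣ (solve 3 (λ p q x → con 0ℚ := (x :- x) :- con 0ℚ :* (q :- p)) ≡.refl p q (expSum 1 p)))
    (0≤* 0≤d² (0≤+ ℚₚ.≤-refl (0≤expTerm L 0≤L 0)))
  expSum-remainder (suc n) = begin
    ∣ ((S q + Q * c) - (S p + P * c)) - (expSum n p + expTerm p n) * (q - p) ∣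
      ≡⟨ ≡.cong (λ w → ∣ ((S q + Q * c) - (S p + P * c)) - (expSum n p + w) * (q - p) ∣) (expTerm-derivative n) ⟩
    ∣ ((S q + Q * c) - (S p + P * c)) - (expSum n p + D * c) * (q - p) ∣
      ≡⟨ ≡.cong ∣_∣ (solve 8 (λ a b Q P c e D h → ((a :+ Q :* c) :- (b :+ P :* c)) :- (e :+ D :* c) :* h
           := ((a :- b) :- e :* h) :+ ((Q :- P) :- D :* h) :* c) ≡.refl
           (S q) (S p) Q P c (expSum n p) D (q - p)) ⟩
    ∣ ((S q - S p) - expSum n p * (q - p)) + r * c ∣
      ≤⟨ ℚₚ.∣p+q∣≤∣p∣+∣q∣ ((S q - S p) - expSum n p * (q - p)) (r * c) ⟩
    ∣ (S q - S p) - expSum n p * (q - p) ∣ + ∣ r * c ∣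
      ≤⟨ ℚₚ.+-mono-≤ (expSum-remainder n) (begin
           ∣ r * c ∣                     ≡⟨ ℚₚ.∣p*q∣≡∣p∣*∣q∣ r c ⟩
           ∣ r ∣ * ∣ c ∣                 ≡⟨ ≡.cong (∣ r ∣ *_) (ℚₚ.0≤p⇒∣p∣≡p (0≤invFact (suc n))) ⟩
           ∣ r ∣ * c                     ≤⟨ *-mono (0≤invFact (suc n)) (0≤* 0≤d² (0≤^ L 0≤L (suc n))) (power-remainder (suc n)) ℚₚ.≤-refl ⟩
           ((d * d) * L ^ suc n) * c     ∎) ⟩
    (d * d) * S L + ((d * d) * L ^ suc n) * c
      ≡⟨ solve 4 (λ d s l c → d :* s :+ (d :* l) :* c := d :* (s :+ l :* c)) ≡.refl (d * d) (S L) (L ^ suc n) c ⟩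
    (d * d) * (S L + L ^ suc n * c) ∎
    where
      S : ℚ → ℚ
      S = expSum (suc n)
      P Q D c r : ℚ
      P = p ^ suc n
      Q = q ^ suc n
      D = powerDerivative (suc n)
      c = invFact (suc n)
      r = (Q - P) - D * (q - p)

  -- Differentiating a partial sum drops its last term; it is put back here
  -- at the price of the last increment, which tends to 0.
  expSum-remainder′ : ∀ n → ∣ (expSum (suc n) q - expSum (suc n) p) - expSum (suc n) p * (q - p) ∣
    ≤ (d * d) * expSum (suc n) L + L * (expSum (suc n) H - expSum n H)
  expSum-remainder′ n = begin
    ∣ (S q - S p) - (e + t) * (q - p) ∣
      ≡⟨ ≡.cong ∣_∣ (solve 5 (λ a b e t h → (a :- b) :- (e :+ t) :* h := ((a :- b) :- e :* h) :+ :- (h :* t)) ≡.refl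
           (S q) (S p) e t (q - p)) ⟩
    ∣ ((S q - S p) - e * (q - p)) + - ((q - p) * t) ∣
      ≤⟨ ℚₚ.∣p+q∣≤∣p∣+∣q∣ ((S q - S p) - e * (q - p)) (- ((q - p) * t)) ⟩
    ∣ (S q - S p) - e * (q - p) ∣ + ∣ - ((q - p) * t) ∣
      ≡⟨ ≡.cong (∣ (S q - S p) - e * (q - p) ∣ +_) (≡.trans (ℚₚ.∣-p∣≡∣p∣ ((q - p) * t)) (ℚₚ.∣p*q∣≡∣p∣*∣q∣ (q - p) t)) ⟩
    ∣ (S q - S p) - e * (q - p) ∣ + d * ∣ t ∣
      ≤⟨ ℚₚ.+-mono-≤ (expSum-remainder n) (*-mono (ℚₚ.0≤∣p∣ t) 0≤L d≤L t≤) ⟩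
    (d * d) * S L + L * (S H - expSum n H) ∎
    where
      S : ℚ → ℚ
      S = expSum (suc n)
      e t : ℚ
      e = expSum n p
      t = expTerm p n
      d≤L : d ≤ L
      d≤L = begin
        ∣ q - p ∣          ≤⟨ ℚₚ.∣p-q∣≤∣p∣+∣q∣ q p ⟩
        ∣ q ∣ + ∣ p ∣      ≤⟨ ℚₚ.+-mono-≤ ∣q∣≤H ∣p∣≤H ⟩
        H + H              ∎
      t≤ : ∣ t ∣ ≤ S H - expSum n H
      -- A tail of length 1 is the single term `t`.
      t≤ = ≡.subst (λ w → ∣ w ∣ ≤ S H - expSum n H) (solve 2 (λ e t → (e :+ t) :- e := t) ≡.refl e t)
        (expSum-tail H 0≤H ∣p∣≤H n 1)

-- From rational sums to the real exponential

module ExponentialBounds where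
  open RealOrder
  open Real
  open Estimates
  open ℚₚ.≤-Reasoning

  ∣expSum∣≤ : ∀ L → 0ℚ Rat.≤ L → ∀ {q} → Rat.∣ q ∣ Rat.≤ L → ∀ n → Rat.∣ expSum n q ∣ Rat.≤ expSum n L
  ∣expSum∣≤ L 0≤L {q} q≤L n = ≡.subst₂ (λ u v → Rat.∣ u ∣ Rat.≤ v) (simplify q) (simplify L)
      (expSum-tail L 0≤L q≤L 0 n)
    where
      simplify : ∀ q → expSum (n ℕ.+ 0) q Rat.- 0ℚ ≡ expSum n q
      simplify q = ≡.trans (ℚₚ.+-identityʳ _) (≡.cong (λ m → expSum m q) (ℕₚ.+-identityʳ n))

  -- The condition at an index concerns its predecessor, so index 0 is declared impossible; the
  -- threshold `suc N` excludes it.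
  expSum-increments : ∀ H → 0ℚ Rat.≤ H → ∀ ε → 0ℚ Rat.< ε →
    Eventually λ { zero → ⊥ ; (suc n) → expSum (suc n) H Rat.- expSum n H Rat.≤ ε }
  expSum-increments H 0≤H ε 0<ε = let (N , settle) = expSum-cauchy H 0≤H ε 0<ε in
    suc N , λ { (suc n) (ℕ.s≤s N≤n) → ℚₚ.≤-trans (p≤∣p∣ (expSum (suc n) H Rat.- expSum n H))
      (ℚₚ.<⇒≤ (settle (suc n) n (ℕₚ.m≤n⇒m≤1+n N≤n) N≤n)) }

  module At (H : ℚ) (1≤H : 1ℚ Rat.≤ H) (K : ℚ) (0≤K : 0ℚ Rat.≤ K)
    (expSum≤K : ∀ n → expSum n (H Rat.+ H) Rat.≤ K) where
    private
      0≤H : 0ℚ Rat.≤ H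
      0≤H = ℚₚ.≤-trans 0≤1 1≤H

      0≤L : 0ℚ Rat.≤ H Rat.+ H
      0≤L = 0≤+ 0≤H 0≤H

      Near : ℝ → Set
      Near a = Eventually λ n → Rat.∣ approx a n ∣ Rat.≤ H

    opaque
      unfolding _≈_

      exp-bounded : ∀ a → Near a → ∣ exp a ∣ ≤ ι K
      exp-bounded a near = eventually-≤ ∣ exp a ∣ (ι K) (mapᵉ (λ n ∣a∣≤H →
        ℚₚ.≤-trans (∣expSum∣≤ (H Rat.+ H) 0≤L (ℚₚ.≤-trans ∣a∣≤H (≤+ʳ 0≤H)) n) (expSum≤K n)) near)

      exp-lipschitz : ∀ c d → Near c → Near d → ∣ exp d + - exp c ∣ ≤ ι K * ∣ d + - c ∣
      exp-lipschitz c d c≤ d≤ = eventually-≤ ∣ exp d + - exp c ∣ (ι K * ∣ d + - c ∣) (mapᵉ (λ n (∣c∣≤H , ∣d∣≤H) →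
        let p = approx c n ; q = approx d n in begin
        Rat.∣ expSum n q Rat.- expSum n p ∣
          ≤⟨ expSum-lipschitz H 1≤H ∣d∣≤H ∣c∣≤H n ⟩
        Rat.∣ q Rat.- p ∣ Rat.* expSum n (H Rat.+ H)
          ≡⟨ ℚₚ.*-comm Rat.∣ q Rat.- p ∣ (expSum n (H Rat.+ H)) ⟩
        expSum n (H Rat.+ H) Rat.* Rat.∣ q Rat.- p ∣
          ≤⟨ *-mono (ℚₚ.0≤∣p∣ (q Rat.- p)) 0≤K (expSum≤K n) ℚₚ.≤-refl ⟩
        K Rat.* Rat.∣ q Rat.- p ∣ ∎) (c≤ ⊓ d≤))

      -- At each index the rational estimate has an extra term, a multiple of the last increment of
      -- the series at `H`. It tends to 0, so it fits into the slack that the real order permits.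
      exp-remainder : ∀ c d → Near c → Near d →
        ∣ (exp d + - exp c) + - (exp c * (d + - c)) ∣ ≤ ι K * (∣ d + - c ∣ * ∣ d + - c ∣)
      exp-remainder c d c≤ d≤ =
        ≤-intro ∣ (exp d + - exp c) + - (exp c * (d + - c)) ∣ (ι K * (∣ d + - c ∣ * ∣ d + - c ∣)) (H Rat.+ H) 0≤L λ ε 0<ε →
        mapᵉ (λ { zero ((_ , _) , ()) ; (suc n) ((∣c∣≤H , ∣d∣≤H) , small) →
          let p = approx c (suc n) ; q = approx d (suc n) ; h = Rat.∣ q Rat.- p ∣ in begin
          Rat.∣ (expSum (suc n) q Rat.- expSum (suc n) p) Rat.- expSum (suc n) p Rat.* (q Rat.- p) ∣
            ≤⟨ ExponentialRemainder.expSum-remainder′ H 1≤H ∣c∣≤H ∣d∣≤H n ⟩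
          (h Rat.* h) Rat.* expSum (suc n) (H Rat.+ H) Rat.+ (H Rat.+ H) Rat.* (expSum (suc n) H Rat.- expSum n H)
            ≤⟨ ℚₚ.+-mono-≤
                 (≡.subst (Rat._≤ K Rat.* (h Rat.* h)) (ℚₚ.*-comm (expSum (suc n) (H Rat.+ H)) (h Rat.* h))
                   (*-mono (0≤* (ℚₚ.0≤∣p∣ (q Rat.- p)) (ℚₚ.0≤∣p∣ (q Rat.- p))) 0≤K (expSum≤K (suc n)) ℚₚ.≤-refl))
                 (ℚₚ.*-monoˡ-≤-nonNeg (H Rat.+ H) {{Rat.nonNegative 0≤L}} small) ⟩
          K Rat.* (h Rat.* h) Rat.+ (H Rat.+ H) Rat.* ε ∎ })
          ((c≤ ⊓ d≤) ⊓ expSum-increments H 0≤H ε 0<ε)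

module RealExponential where
  open RealOrder using (mapᵉ; eventually-≤)
  open RealAlgebra
  open Real using (exp)
  open OrderedAlgebra ℝ-orderedAlgebra
  open Calculus ℝ-orderedAlgebra using (HasDerivative; differentiable⇒cong)
  open FiniteSums rawRing
  open Estimates
  open FiniteSums Rat.+-*-rawRing using () renaming (_^_ to _^ℚ_)
  open ℚₚ.≤-Reasoning

  opaque
    unfolding Real._≈_

    -- A real inequality bounds approximants only up to an arbitrary positive rational. Taking that
    -- rational to be 1 accounts for the bound b + 1.
    eventually-∣∣≤ : ∀ b B a → B ≤ ι b → ∣ a ∣ ≤ B → Eventually λ n → Rat.∣ approx a n ∣ Rat.≤ b Rat.+ 1ℚ
    eventually-∣∣≤ b B a B≤b ∣a∣≤B = mapᵉ (λ _ → ℚₚ.<⇒≤) (RealOrder.≤-trans ∣ a ∣ B (ι b) ∣a∣≤B B≤b 1ℚ (ℚₚ.positive⁻¹ 1ℚ))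

    exp-0 : exp 0# ≈ 1#
    -- The sum at index 0 is empty, so the approximants equal 1 only from index 1 on.
    exp-0 ε 0<ε = 1 , λ { (suc n) _ → ≡.subst (λ w → Rat.∣ w Rat.- 1ℚ ∣ Rat.< ε) (≡.sym (expSum-0 n)) (∣p-p∣<ε 1ℚ 0<ε) }
      where
        expSum-0 : ∀ n → expSum (suc n) 0ℚ ≡ 1ℚ
        expSum-0 zero    = ≡.refl
        expSum-0 (suc n) = ≡.trans (≡.cong₂ Rat._+_ (expSum-0 n)
          (≡.trans (≡.cong (Rat._* invFact (suc n)) (ℚₚ.*-zeroˡ (0ℚ ^ℚ n))) (ℚₚ.*-zeroˡ (invFact (suc n))))) (ℚₚ.+-identityʳ 1ℚ)

    -- For ∣T∣ every approximant is nonnegative, so a term is at most any partial sum containing it,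
    -- that is, from index k + 1 on. For T ≥ 0 the bound is carried over along ∣T∣ ≈ T.
    ∣∣^≤exp : ∀ k T → ∣ T ∣ ^ k * ι (invFact k) ≤ exp ∣ T ∣
    ∣∣^≤exp k T = eventually-≤ (∣ T ∣ ^ k * ι (invFact k)) (exp ∣ T ∣) (suc k , λ n k<n →
        ≡.subst (λ w → w Rat.* invFact k Rat.≤ expSum n Rat.∣ approx T n ∣) (≡.sym (approx-^ ∣ T ∣ n k))
          (expTerm≤expSum (ℚₚ.0≤∣p∣ (approx T n)) (ℕₚ.≤⇒≤′ k<n)))
      where
        approx-^ : ∀ x n k → approx (x ^ k) n ≡ approx x n ^ℚ k
        approx-^ x n zero    = ≡.refl
        approx-^ x n (suc k) = ≡.cong (approx x n Rat.*_) (approx-^ x n k)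
        expTerm≤expSum : ∀ {q k n} → 0ℚ Rat.≤ q → suc k ℕ.≤′ n → expTerm q k Rat.≤ expSum n q
        expTerm≤expSum {q} {k} 0≤q ℕ.≤′-refl = ≤+ˡ (ℚₚ.≤-trans (expSum-mono q 0≤q 0 k)
          (ℚₚ.≤-reflexive (≡.cong (λ m → expSum m q) (ℕₚ.+-identityʳ k))))
        expTerm≤expSum {q} 0≤q (ℕ.≤′-step {n} k<n) = ℚₚ.≤-trans (expTerm≤expSum 0≤q k<n) (≤+ʳ (0≤expTerm q 0≤q n))

  exp-derivative : HasDerivative exp exp
  exp-derivative B =
    let (b , 1≤b , B≤b) = rational-bound B
        H = b Rat.+ 1ℚ
        1≤H = ≤+ˡ {1ℚ} {b} (ℚₚ.≤-trans 0≤1 1≤b)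
        0≤H = ℚₚ.≤-trans 0≤1 1≤H
        (K , 1≤K , S≤K) = bounded (λ n → expSum n (H Rat.+ H)) (expSum-cauchy (H Rat.+ H) (0≤+ 0≤H 0≤H))
        0≤K = ℚₚ.≤-trans 0≤1 1≤K
        near = λ a → eventually-∣∣≤ b B a B≤b
        module Bounds = ExponentialBounds.At H 1≤H K 0≤K (λ n → ℚₚ.≤-trans (p≤∣p∣ (expSum n (H Rat.+ H))) (S≤K n))
    in ι K , ≤-trans (≤-reflexive (sym ι-0)) (ι-mono 0≤K) , record
    { bounded = λ a a≤ → Bounds.exp-bounded a (near a a≤)
    ; lipschitz = λ a b a≤ b≤ → Bounds.exp-lipschitz a b (near a a≤) (near b b≤)
    ; remainder = λ a b a≤ b≤ → Bounds.exp-remainder a b (near a a≤) (near b b≤)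
    }

  term≤exp : ∀ k {T} → 0# ≤ T → T ^ k * ι (invFact k) ≤ exp T
  term≤exp k {T} 0≤T = ≤-trans (≤-reflexive (*-congʳ (sym (^-cong k))))
    (≤-trans (∣∣^≤exp k T) (≤-reflexive (differentiable⇒cong exp-derivative (0≤x⇒∣x∣≈x 0≤T))))
    where
      ^-cong : ∀ j → ∣ T ∣ ^ j ≈ T ^ j
      ^-cong zero    = refl
      ^-cong (suc j) = *-cong (0≤x⇒∣x∣≈x 0≤T) (^-cong j)

-- Evaluation of polynomials and of the substituted operator

module Evaluation (S : CommutativeRing 0ℓ 0ℓ) where
  open CommutativeRing S
  open FiniteSums rawRing
  open SetoidReasoning setoid
  open Algebra.Solver.Ring.NaturalCoefficients.Default commutativeSemiring
    using (solve; _:+_; _:*_; _:=_)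

  ∑-cong : ∀ n {a b : ℕ → Carrier} → (∀ k → a k ≈ b k) → ∑ n a ≈ ∑ n b
  ∑-cong zero    a≈b = refl
  ∑-cong (suc n) a≈b = +-cong (∑-cong n a≈b) (a≈b n)

  *-distribˡ-∑ : ∀ n c (a : ℕ → Carrier) → c * ∑ n a ≈ ∑ n (λ k → c * a k)
  *-distribˡ-∑ zero    c a = zeroʳ c
  *-distribˡ-∑ (suc n) c a = trans (distribˡ c (∑ n a) (a n)) (+-congʳ (*-distribˡ-∑ n c a))

  ∑-suc : ∀ n (a : ℕ → Carrier) → ∑ (suc n) a ≈ a 0 + ∑ n (λ k → a (suc k))
  ∑-suc zero    a = +-comm 0# (a 0)
  ∑-suc (suc n) a = trans (+-congʳ (∑-suc n a)) (+-assoc (a 0) _ (a (suc n)))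

  -- The source is a bare signature: the nested polynomial rings come without proved laws, so every
  -- identity is established after mapping into the commutative ring `S`.
  record PreservesOperations (R : RawRing 0ℓ 0ℓ) (φ : RawRing.Carrier R → Carrier) : Set where
    private module R = RawRing R
    field
      +-homo : ∀ x y → φ (x R.+ y) ≈ φ x + φ y
      *-homo : ∀ x y → φ (x R.* y) ≈ φ x * φ y
      0-homo : φ R.0# ≈ 0#
      1-homo : φ R.1# ≈ 1#

    private module RΣ = FiniteSums R

    ∑-homo : ∀ n a → φ (RΣ.∑ n a) ≈ ∑ n (λ k → φ (a k))
    ∑-homo zero    a = 0-homo
    ∑-homo (suc n) a = trans (+-homo (RΣ.∑ n a) (a n)) (+-congʳ (∑-homo n a))

    ^-homo : ∀ x k → φ (x RΣ.^ k) ≈ φ x ^ k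
    ^-homo x zero    = 1-homo
    ^-homo x (suc k) = trans (*-homo x (x RΣ.^ k)) (*-congˡ (^-homo x k))

  evaluate : {A : Set} → (A → Carrier) → Carrier → List A → Carrier
  evaluate e v []      = 0#
  evaluate e v (a ∷ p) = e a + v * evaluate e v p

  evaluate-const : ∀ {A : Set} (e : A → Carrier) v a → evaluate e v (a ∷ []) ≈ e a
  evaluate-const e v a = trans (+-congˡ (zeroʳ v)) (+-identityʳ (e a))

  -- The monomial c vᵏ in dense form, up to the values of its coefficients.
  data IsMonomial {A : Set} (e : A → Carrier) (c : Carrier) : ℕ → List A → Set where
    leading : ∀ {a} → e a ≈ c → IsMonomial e c 0 (a ∷ [])
    shifted : ∀ {a k p} → e a ≈ 0# → IsMonomial e c k p → IsMonomial e c (suc k) (a ∷ p)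

  evaluate-monomial : ∀ {A : Set} {e : A → Carrier} {c} v {k p} →
    IsMonomial e c k p → evaluate e v p ≈ c * v ^ k
  evaluate-monomial {e = e} {c} v {zero} {a ∷ []} (leading a≈c) =
    trans (evaluate-const e v a) (trans a≈c (sym (*-identityʳ c)))
  evaluate-monomial {e = e} {c} v {suc k} {a ∷ p} (shifted a≈0 m) = begin
    e a + v * evaluate e v p   ≈⟨ +-cong a≈0 (*-congˡ (evaluate-monomial v m)) ⟩
    0# + v * (c * v ^ k)       ≈⟨ +-identityˡ _ ⟩
    v * (c * v ^ k)            ≈⟨ solve 3 (λ v c x → v :* (c :* x) := c :* (v :* x)) refl v c (v ^ k) ⟩
    c * (v * v ^ k)            ∎

  module _ {R : RawRing 0ℓ 0ℓ} {e : RawRing.Carrier R → Carrier} (hom : PreservesOperations R e) (v : Carrier) where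
    private module R = RawRing R
    open Polynomials R
    open PreservesOperations hom

    private
      ev : Poly → Carrier
      ev = evaluate e v

    evaluate-add : ∀ p q → ev (add p q) ≈ ev p + ev q
    evaluate-add []      q       = sym (+-identityˡ (ev q))
    evaluate-add (a ∷ p) []      = sym (+-identityʳ _)
    evaluate-add (a ∷ p) (b ∷ q) = begin
      e (a R.+ b) + v * ev (add p q)
        ≈⟨ +-cong (+-homo a b) (*-congˡ (evaluate-add p q)) ⟩
      (e a + e b) + v * (ev p + ev q)
        ≈⟨ solve 5 (λ a b v p q → (a :+ b) :+ v :* (p :+ q) := (a :+ v :* p) :+ (b :+ v :* q)) refl (e a) (e b) v (ev p) (ev q) ⟩
      (e a + v * ev p) + (e b + v * ev q) ∎

    evaluate-map-* : ∀ a q → ev (map (a R.*_) q) ≈ e a * ev q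
    evaluate-map-* a []      = sym (zeroʳ (e a))
    evaluate-map-* a (b ∷ q) = begin
      e (a R.* b) + v * ev (map (a R.*_) q)
        ≈⟨ +-cong (*-homo a b) (*-congˡ (evaluate-map-* a q)) ⟩
      e a * e b + v * (e a * ev q)
        ≈⟨ solve 4 (λ a b v q → a :* b :+ v :* (a :* q) := a :* (b :+ v :* q)) refl (e a) (e b) v (ev q) ⟩
      e a * (e b + v * ev q) ∎

    evaluate-mul : ∀ p q → ev (mul p q) ≈ ev p * ev q
    evaluate-mul []      q = sym (zeroˡ (ev q))
    evaluate-mul (a ∷ p) q = begin
      ev (add (map (a R.*_) q) (R.0# ∷ mul p q))
        ≈⟨ evaluate-add (map (a R.*_) q) (R.0# ∷ mul p q) ⟩
      ev (map (a R.*_) q) + (e R.0# + v * ev (mul p q))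
        ≈⟨ +-cong (evaluate-map-* a q) (trans (+-cong 0-homo (*-congˡ (evaluate-mul p q))) (+-identityˡ _)) ⟩
      e a * ev q + v * (ev p * ev q)
        ≈⟨ solve 4 (λ a v p q → a :* q :+ v :* (p :* q) := (a :+ v :* p) :* q) refl (e a) v (ev p) (ev q) ⟩
      (e a + v * ev p) * ev q ∎

    -- The conclusion has the form of the hypothesis on `e`, so evaluation in several variables
    -- follows by iteration.
    evaluate-homo : PreservesOperations Poly-rawRing ev
    evaluate-homo = record
      { +-homo = evaluate-add
      ; *-homo = evaluate-mul
      ; 0-homo = refl
      ; 1-homo = trans (evaluate-const e v R.1#) 1-homo
      }

    evaluate-∑ : ∀ p → ev p ≈ ∑ (length p) (λ k → e (coeff p k) * v ^ k)
    evaluate-∑ []      = refl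
    evaluate-∑ (a ∷ p) = begin
      e a + v * ev p
        ≈⟨ +-cong (sym (*-identityʳ (e a))) (*-congˡ (evaluate-∑ p)) ⟩
      e a * 1# + v * ∑ (length p) (λ k → e (coeff p k) * v ^ k)
        ≈⟨ +-congˡ (trans (*-distribˡ-∑ (length p) v _) (∑-cong (length p) λ k →
             solve 3 (λ v c x → v :* (c :* x) := c :* (v :* x)) refl v (e (coeff p k)) (v ^ k))) ⟩
      e a * 1# + ∑ (length p) (λ k → e (coeff p k) * (v * v ^ k))
        ≈⟨ ∑-suc (length p) (λ k → e (coeff (a ∷ p) k) * v ^ k) ⟨
      ∑ (suc (length p)) (λ k → e (coeff (a ∷ p) k) * v ^ k) ∎

    -- `σ` stands for the constant s and `Z k` for D_z⁻ᵏ{1}. The factors are regrouped so that v^k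
    -- joins the coefficient, which is constant in s, while s^k stays with the weight `c k`.
    evaluate-substitution : ∀ p (σ : Poly) (Z : ℕ → Poly) {s} {c : ℕ → Carrier} →
      ev σ ≈ s → (∀ k → IsMonomial e (c k) k (Z k)) →
      ev (FiniteSums.∑ Poly-rawRing (length p) λ k →
        mul (mul (const (coeff p k)) (FiniteSums._^_ Poly-rawRing σ k)) (Z k))
      ≈ ∑ (length p) (λ k → (e (coeff p k) * v ^ k) * (s ^ k * c k))
    evaluate-substitution p σ Z {s} {c} σ≈s mono = trans
      (PreservesOperations.∑-homo evaluate-homo (length p) _) (∑-cong (length p) λ k → begin
        ev (mul (mul (const (coeff p k)) (σ Poly.^ k)) (Z k))
          ≈⟨ trans (evaluate-mul (mul (const (coeff p k)) (σ Poly.^ k)) (Z k))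
               (*-cong (evaluate-mul (const (coeff p k)) (σ Poly.^ k)) (evaluate-monomial v (mono k))) ⟩
        (ev (const (coeff p k)) * ev (σ Poly.^ k)) * (c k * v ^ k)
          ≈⟨ *-congʳ (*-cong (evaluate-const e v (coeff p k))
               (trans (PreservesOperations.^-homo evaluate-homo σ k) (^-cong k))) ⟩
        (e (coeff p k) * s ^ k) * (c k * v ^ k)
          ≈⟨ solve 4 (λ a s c v → (a :* s) :* (c :* v) := (a :* v) :* (s :* c)) refl (e (coeff p k)) (s ^ k) (c k) (v ^ k) ⟩
        (e (coeff p k) * v ^ k) * (s ^ k * c k) ∎)
      where
        module Poly = FiniteSums Poly-rawRing
        ^-cong : ∀ k → ev σ ^ k ≈ s ^ k
        ^-cong zero    = refl
        ^-cong (suc k) = *-cong σ≈s (^-cong k)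

  monomial-resp-≈ : ∀ {A : Set} {e : A → Carrier} {c d k p} → c ≈ d → IsMonomial e c k p → IsMonomial e d k p
  monomial-resp-≈ c≈d (leading a≈c)   = leading (trans a≈c c≈d)
  monomial-resp-≈ c≈d (shifted a≈0 m) = shifted a≈0 (monomial-resp-≈ c≈d m)

  -- The outer factor moves into the sum and everything except `c k` is gathered under one `φ`. For
  -- the embedding of the reals this exhibits each summand as a complex constant times a real
  -- function.
  scaled-power-sum : ∀ {R : RawRing 0ℓ 0ℓ} {φ : RawRing.Carrier R → Carrier} → PreservesOperations R φ →
    ∀ n w t (c : ℕ → Carrier) (q : ℕ → RawRing.Carrier R) →
    φ w * ∑ n (λ k → c k * (φ t ^ k * φ (q k)))
    ≈ ∑ n (λ k → c k * φ (RawRing._*_ R w (RawRing._*_ R (FiniteSums._^_ R t k) (q k))))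
  scaled-power-sum {R} {φ} hom n w t c q = trans (*-distribˡ-∑ n (φ w) _) (∑-cong n λ k → begin
    φ w * (c k * (φ t ^ k * φ (q k)))
      ≈⟨ solve 4 (λ w c x q → w :* (c :* (x :* q)) := c :* (w :* (x :* q))) refl (φ w) (c k) (φ t ^ k) (φ (q k)) ⟩
    c k * (φ w * (φ t ^ k * φ (q k)))
      ≈⟨ *-congˡ (*-congˡ (trans (*-homo (t RΣ.^ k) (q k)) (*-congʳ (^-homo t k)))) ⟨
    c k * (φ w * φ ((t RΣ.^ k) R.* q k))
      ≈⟨ *-congˡ (*-homo w ((t RΣ.^ k) R.* q k)) ⟨
    c k * φ (w R.* ((t RΣ.^ k) R.* q k)) ∎)
    where
      module R = RawRing R
      module RΣ = FiniteSums R
      open PreservesOperations hom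

-- Proper and improper integrals of real functions

module RealIntegral where
  open RealOrder using (mapᵉ; _⊓_; shrink; eventually-≤; 2ℚ; 0≤2)
  open RealAlgebra
  open RealExponential
  open Real using (exp)
  open RealAnalysis using (IsIntegral₀^∞; IsRiemannIntegral; riemannSum; TaggedPartition)
  open OrderedAlgebra ℝ-orderedAlgebra
  open Calculus ℝ-orderedAlgebra using (HasDerivative; derivative-resp-≈; riemann-converges; Decays; decays⇒limit)
  open Calculus.Exponential ℝ-orderedAlgebra exp exp-derivative exp-0 term≤exp public
  open FiniteSums rawRing

  opaque
    unfolding Real._≈_

    <⇒≤ : ∀ x y → x RealAnalysis.< y → x ≤ y
    <⇒≤ x y (η , 0<η , x+η<y) = eventually-≤ x y (mapᵉ (λ n p →
      ℚₚ.≤-trans (Estimates.≤+ʳ (ℚₚ.<⇒≤ 0<η)) (ℚₚ.<⇒≤ p)) x+η<y)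

    below-positive : ∀ ε → RawRing.0# ℝ-rawRing RealAnalysis.< ε →
      ∃[ q ] 0ℚ Rat.< q × (∀ x → x ≤ ι q → x RealAnalysis.< ε)
    below-positive ε (η , 0<η , η<ε) =
      -- The gap `η` is spent in three shares of `q`: the bound `ι q`, the slack in `_≤_`, and the
      -- gap that witnesses the strict conclusion.
      let (q , 0<q , 3q<η) = shrink (2ℚ Rat.+ 1ℚ) (Estimates.0≤+ 0≤2 Estimates.0≤1) 0<η in
      q , 0<q , λ x x≤q → q , 0<q , mapᵉ (λ n (p , r) → begin-strict
        approx x n Rat.+ q              ≤⟨ ℚₚ.+-monoˡ-≤ q (ℚₚ.<⇒≤ p) ⟩
        (q Rat.+ q) Rat.+ q             ≡⟨ solve 1 (λ q → (q :+ q) :+ q := ((con 1ℚ :+ con 1ℚ) :+ con 1ℚ) :* q) ≡.refl q ⟩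
        (2ℚ Rat.+ 1ℚ) Rat.* q           <⟨ 3q<η ⟩
        η                               ≡⟨ ℚₚ.+-identityˡ η ⟨
        0ℚ Rat.+ η                      <⟨ r ⟩
        approx ε n                      ∎) (x≤q q 0<q ⊓ η<ε)
      where
        open ℚₚ.≤-Reasoning
        open ℚ-Solver using (solve; _:+_; _:*_; _:=_; con)

  fromℚ-pos : ∀ {q} → 0ℚ Rat.< q → RawRing.0# ℝ-rawRing RealAnalysis.< fromℚ q
  fromℚ-pos {q} 0<q = let (η , 0<η , 1*η<q) = shrink 1ℚ Estimates.0≤1 0<q in η , 0<η , 0 , λ _ _ →
    ≡.subst (Rat._< q) (≡.trans (ℚₚ.*-identityˡ η) (≡.sym (ℚₚ.+-identityˡ η))) 1*η<q

  minus≡ : ∀ x y → x - y ≡ x RealAnalysis.- y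
  minus≡ x y = ≡.trans (+≡ x (- y)) (≡.cong (RawRing._+_ ℝ-rawRing x) { - y} {RawRing.-_ ℝ-rawRing y} (-≡ y))

  distance≡ : ∀ {S S′} F → S ≡ S′ → ∣ S - F ∣ ≡ RealAnalysis.∣ S′ RealAnalysis.- F ∣
  distance≡ {S} F ≡.refl = ≡.trans (∣∣≡ (S - F)) (≡.cong RealAnalysis.∣_∣ {S - F} {S RealAnalysis.- F} (minus≡ S F))

  ∑≡ : ∀ n (a b : ℕ → ℝ) → (∀ i → a i ≡ b i) → ∑ n a ≡ FiniteSums.∑ ℝ-rawRing n b
  ∑≡ zero    a b a≡b = 0≡
  ∑≡ (suc n) a b a≡b = ≡.trans (+≡ (∑ n a) (a n))
    (≡.cong₂ (RawRing._+_ ℝ-rawRing) {∑ n a} {FiniteSums.∑ ℝ-rawRing n b} {a n} {b n} (∑≡ n a b a≡b) (a≡b n))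

  riemannSum≡ : ∀ g {a b} (P : TaggedPartition a b) → let open TaggedPartition P in
    (∑ size λ i → g (tag i) * (point (suc i) - point i)) ≡ riemannSum g P
  riemannSum≡ g P = ∑≡ size _ _ λ i →
      ≡.trans (*≡ (g (tag i)) (point (suc i) - point i))
        (≡.cong (RawRing._*_ ℝ-rawRing (g (tag i))) {point (suc i) - point i} {point (suc i) RealAnalysis.- point i}
          (minus≡ (point (suc i)) (point i)))
    where open TaggedPartition P

  -- Convergence of the Riemann sums is already known with rational tolerances. A rational `q` is
  -- found below the real `ε`, and the strict mesh condition is weakened to a bound by `δ`.
  fundamental-theorem : ∀ {G g} → HasDerivative G g → ∀ T → RawRing.0# ℝ-rawRing RealAnalysis.≤ T →
    IsRiemannIntegral g (RawRing.0# ℝ-rawRing) T (G T - G 0#)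
  fundamental-theorem {G} {g} D T 0≤T ε 0<ε =
    let (q , 0<q , below) = below-positive ε 0<ε
        (δ , 0<δ , close) = riemann-converges D (≡.subst (_≤ T) (≡.sym 0≡) (raw⇒≤ (RawRing.0# ℝ-rawRing) T 0≤T)) 0<q
    in fromℚ δ , fromℚ-pos 0<δ , λ P mesh → let open TaggedPartition P in
      below (RealAnalysis.∣ riemannSum g P RealAnalysis.- (G T - G 0#) ∣)
        (≡.subst (_≤ ι q) (distance≡ (G T - G 0#) (riemannSum≡ g P))
          (close point tag size
            (≡.subst (point 0 ≈_) (≡.sym 0≡) (raw⇒≈ (point 0) (RawRing.0# ℝ-rawRing) starts))
            (raw⇒≈ (point size) T ends)
            (λ i i<n → raw⇒≤ (point i) (tag i) (point≤tag i i<n))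
            (λ i i<n → raw⇒≤ (tag i) (point (suc i)) (tag≤point i i<n))
            (λ i i<n → ≡.subst₂ _≤_ (≡.sym (minus≡ (point (suc i)) (point i))) (≡.sym (ι≡ δ))
              (<⇒≤ (point (suc i) RealAnalysis.- point i) (fromℚ δ) (mesh i i<n)))))

  integral₀^∞ : ∀ {G g L} → HasDerivative G g → Decays G → - G 0# ≈ L → IsIntegral₀^∞ g L
  integral₀^∞ {G} {g} {L} D decays -G0≈L = (λ T → G T - G 0#) , fundamental-theorem {G} {g} D , λ ε 0<ε →
    let (q , 0<q , below) = below-positive ε 0<ε
        (T₀ , 0≤T₀ , small) = decays⇒limit {G} {L} decays -G0≈L 0<q
    in fromℚ T₀ , λ T T₀≤T → below (RealAnalysis.∣ (G T - G 0#) RealAnalysis.- L ∣)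
      (≡.subst (_≤ ι q) (distance≡ {G T - G 0#} {G T - G 0#} L ≡.refl)
        (small (≡.subst (_≤ T) (≡.sym (ι≡ T₀)) (raw⇒≤ (fromℚ T₀) T T₀≤T))))

  -- `φ` and `L` are given only up to `_≈_`, because the real and imaginary parts of the complex
  -- integrand agree with such sums only in that sense.
  laplace-sum : ∀ n (a : ℕ → ℝ) {φ : ℝ → ℝ} {L : ℝ} →
    (∀ τ → (∑ n λ k → a k * integrand k τ) ≈ φ τ) → ∑ n a ≈ L → IsIntegral₀^∞ φ L
  laplace-sum n a sum≈φ ∑a≈L = integral₀^∞
    (derivative-resp-≈ (λ _ → refl) sum≈φ (combination-derivative n a)) (combination-decays n a)
    (trans (combination-0 n a) ∑a≈L)

-- The complex numbers as a commutative ring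

module Complex where
  open Real using () renaming (_≈_ to _≈ᴿ_; _+_ to _+ᴿ_; _*_ to _*ᴿ_; -_ to -ᴿ_; 0# to 0ᴿ; 1# to 1ᴿ)

  opaque
    infix 4 _≈_
    infixl 6 _+_
    infixl 7 _*_
    infix 8 -_

    _≈_ : ℂ → ℂ → Set
    u ≈ v = (re u ≈ᴿ re v) × (im u ≈ᴿ im v)

    _+_ _*_ : ℂ → ℂ → ℂ
    u + v = (re u +ᴿ re v) +i (im u +ᴿ im v)
    u * v = (re u *ᴿ re v +ᴿ (-ᴿ (im u *ᴿ im v))) +i (re u *ᴿ im v +ᴿ im u *ᴿ re v)

    -_ : ℂ → ℂ
    - u = (-ᴿ re u) +i (-ᴿ im u)

    0# 1# : ℂ
    0# = 0ᴿ +i 0ᴿ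
    1# = 1ᴿ +i 0ᴿ

module ComplexRing where
  open RealAlgebra using (ℝ-orderedAlgebra; ℝ-commutativeRing)
  private
    module ℝᶠ where
      open CommutativeRing ℝ-commutativeRing public
      open FiniteSums rawRing public
    module Bridge = RealAlgebra
  open ComplexMultiplication ℝ-orderedAlgebra

  opaque
    unfolding Complex._≈_

    isCommutativeRing : IsCommutativeRing Complex._≈_ Complex._+_ Complex._*_ Complex.-_ Complex.0# Complex.1#
    isCommutativeRing = record
      { isRing = record
        { +-isAbelianGroup = record
          { isGroup = record
            { isMonoid = record
              { isSemigroup = record
                { isMagma = record
                  { isEquivalence = record
                    { refl  = λ {u} → ℝᶠ.refl , ℝᶠ.refl
                    ; sym   = λ {u} {v} (p , q) → ℝᶠ.sym p , ℝᶠ.sym q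
                    ; trans = λ {u} {v} {w} (p , q) (p′ , q′) →
                        ℝᶠ.trans p p′ , ℝᶠ.trans q q′
                    }
                  ; ∙-cong = λ {u} {v} {w} {x} (p , q) (p′ , q′) →
                      ℝᶠ.+-cong p p′ , ℝᶠ.+-cong q q′
                  }
                ; assoc = λ u v w → ℝᶠ.+-assoc (re u) (re v) (re w) , ℝᶠ.+-assoc (im u) (im v) (im w)
                }
              ; identity = (λ u → ℝᶠ.+-identityˡ (re u) , ℝᶠ.+-identityˡ (im u))
                         , (λ u → ℝᶠ.+-identityʳ (re u) , ℝᶠ.+-identityʳ (im u))
              }
            ; inverse = (λ u → ℝᶠ.-‿inverseˡ (re u) , ℝᶠ.-‿inverseˡ (im u))
                      , (λ u → ℝᶠ.-‿inverseʳ (re u) , ℝᶠ.-‿inverseʳ (im u))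
            ; ⁻¹-cong = λ {u} {v} (p , q) → ℝᶠ.-‿cong p , ℝᶠ.-‿cong q
            }
          ; comm = λ u v → ℝᶠ.+-comm (re u) (re v) , ℝᶠ.+-comm (im u) (im v)
          }
        ; *-cong = λ {u} {v} {w} {x} (p , q) (p′ , q′) →
            cong-re (re u) (re v) (re w) (re x) (im u) (im v) (im w) (im x) p p′ q q′ ,
            cong-im (re u) (re v) (re w) (re x) (im u) (im v) (im w) (im x) p p′ q q′
        ; *-assoc = λ u v w →
            assoc-re (re u) (im u) (re v) (im v) (re w) (im w) , assoc-im (re u) (im u) (re v) (im v) (re w) (im w)
        ; *-identity = (λ u → 1*x-0*y≈x (re u) (im u) , 1*x+0*y≈x (im u) (re u))
                     , (λ u → x*1-y*0≈x (re u) (im u) , x*0+y*1≈y (re u) (im u))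
        ; distrib =
            (λ u v w → distribˡ-re (re u) (im u) (re v) (im v) (re w) (im w) , distribˡ-im (re u) (im u) (re v) (im v) (re w) (im w))
          , (λ u v w → distribʳ-re (re u) (im u) (re v) (im v) (re w) (im w) , distribʳ-im (re u) (im u) (re v) (im v) (re w) (im w))
        }
      ; *-comm = λ u v → comm-re (re u) (im u) (re v) (im v) , comm-im (re u) (im u) (re v) (im v)
      }

  ℂ-commutativeRing : CommutativeRing 0ℓ 0ℓ
  ℂ-commutativeRing = record { isCommutativeRing = isCommutativeRing }

  opaque
    unfolding Complex._≈_

    +≡ : ∀ u v → u Complex.+ v ≡ RawRing._+_ ℂ-rawRing u v
    +≡ u v = ≡.cong₂ _+i_ (Bridge.+≡ (re u) (re v)) (Bridge.+≡ (im u) (im v))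

    *≡ : ∀ u v → u Complex.* v ≡ RawRing._*_ ℂ-rawRing u v
    *≡ u v = ≡.cong₂ _+i_ (raw-re (re u) (re v) (im u) (im v)) (raw-im (re u) (im v) (im u) (re v))
      where
        raw-re : ∀ a b c d → a ℝᶠ.* b ℝᶠ.+ ℝᶠ.- (c ℝᶠ.* d)
          ≡ RawRing._+_ ℝ-rawRing (RawRing._*_ ℝ-rawRing a b) (RawRing.-_ ℝ-rawRing (RawRing._*_ ℝ-rawRing c d))
        raw-re a b c d = ≡.trans (Bridge.+≡ (a ℝᶠ.* b) (ℝᶠ.- (c ℝᶠ.* d))) (≡.cong₂ (RawRing._+_ ℝ-rawRing)
          {a ℝᶠ.* b} {RawRing._*_ ℝ-rawRing a b} {ℝᶠ.- (c ℝᶠ.* d)} {RawRing.-_ ℝ-rawRing (RawRing._*_ ℝ-rawRing c d)}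
          (Bridge.*≡ a b)
          (≡.trans (Bridge.-≡ (c ℝᶠ.* d)) (≡.cong (RawRing.-_ ℝ-rawRing) {c ℝᶠ.* d} {RawRing._*_ ℝ-rawRing c d} (Bridge.*≡ c d))))
        raw-im : ∀ a b c d → a ℝᶠ.* b ℝᶠ.+ c ℝᶠ.* d
          ≡ RawRing._+_ ℝ-rawRing (RawRing._*_ ℝ-rawRing a b) (RawRing._*_ ℝ-rawRing c d)
        raw-im a b c d = ≡.trans (Bridge.+≡ (a ℝᶠ.* b) (c ℝᶠ.* d)) (≡.cong₂ (RawRing._+_ ℝ-rawRing)
          {a ℝᶠ.* b} {RawRing._*_ ℝ-rawRing a b} {c ℝᶠ.* d} {RawRing._*_ ℝ-rawRing c d} (Bridge.*≡ a b) (Bridge.*≡ c d))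

    0≡ : Complex.0# ≡ RawRing.0# ℂ-rawRing
    0≡ = ≡.cong₂ _+i_ Bridge.0≡ Bridge.0≡

    1≡ : Complex.1# ≡ RawRing.1# ℂ-rawRing
    1≡ = ≡.cong₂ _+i_ Bridge.1≡ Bridge.0≡

    re-≈ : ∀ {u v} → u Complex.≈ v → re u ℝᶠ.≈ re v
    re-≈ = proj₁

    im-≈ : ∀ {u v} → u Complex.≈ v → im u ℝᶠ.≈ im v
    im-≈ = proj₂

  open Evaluation ℂ-commutativeRing
  open CommutativeRing ℂ-commutativeRing using (rawRing; _*_)
  open FiniteSums rawRing

  private
    raw0≈0 : RawRing.0# ℝ-rawRing ℝᶠ.≈ ℝᶠ.0#
    raw0≈0 = ℝᶠ.reflexive (≡.sym Bridge.0≡)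

  opaque
    unfolding Complex._≈_

    fromℝ-homo : PreservesOperations ℝᶠ.rawRing fromℝ
    fromℝ-homo = record
      { +-homo = λ x y → ℝᶠ.refl , ℝᶠ.trans (ℝᶠ.sym (ℝᶠ.+-identityˡ _)) (ℝᶠ.+-congʳ (ℝᶠ.sym raw0≈0))
      ; *-homo = λ x y →
            ℝᶠ.sym (ℝᶠ.trans (ℝᶠ.+-congˡ (ℝᶠ.-‿cong (ℝᶠ.*-congˡ raw0≈0))) (x*y-z*0≈x*y x y _))
          , ℝᶠ.trans raw0≈0 (ℝᶠ.sym (ℝᶠ.trans (ℝᶠ.+-cong (ℝᶠ.*-congˡ raw0≈0) (ℝᶠ.*-congʳ raw0≈0)) (x*0+0*y≈0 x y)))
      ; 0-homo = ℝᶠ.refl , raw0≈0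
      ; 1-homo = ℝᶠ.refl , raw0≈0
      }

    re-∑ : ∀ n a → re (∑ n a) ≡ ℝᶠ.∑ n (λ k → re (a k))
    re-∑ zero    a = ≡.refl
    re-∑ (suc n) a = ≡.cong (ℝᶠ._+ re (a n)) (re-∑ n a)

    im-∑ : ∀ n a → im (∑ n a) ≡ ℝᶠ.∑ n (λ k → im (a k))
    im-∑ zero    a = ≡.refl
    im-∑ (suc n) a = ≡.cong (ℝᶠ._+ im (a n)) (im-∑ n a)

    re-*-fromℝ : ∀ c w → re (c * fromℝ w) ℝᶠ.≈ re c ℝᶠ.* w
    re-*-fromℝ c w = ℝᶠ.trans (ℝᶠ.+-congˡ (ℝᶠ.-‿cong (ℝᶠ.*-congˡ raw0≈0))) (x*y-z*0≈x*y (re c) w (im c))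

    im-*-fromℝ : ∀ c w → im (c * fromℝ w) ℝᶠ.≈ im c ℝᶠ.* w
    im-*-fromℝ c w = ℝᶠ.trans (ℝᶠ.+-congʳ (ℝᶠ.*-congˡ raw0≈0)) (x*0+y*z≈y*z (re c) (im c) w)

    fromℝ-cong : ∀ {x y} → x ℝᶠ.≈ y → fromℝ x Complex.≈ fromℝ y
    fromℝ-cong x≈y = x≈y , ℝᶠ.refl

-- The inverse derivative

module InverseDerivative where
  divide : ℕ → Polynomial → Polynomial
  divide k []      = []
  divide k (c ∷ p) = RawRing._*_ ℂ[x,y] (constant₂ (fromℝ (fromℚ (ℤ.+ 1 Rat./ suc k)))) c ∷ divide (suc k) p

  reciprocal : ℕ → RawRing.Carrier ℂ[x,y]
  reciprocal k = constant₂ (fromℝ (fromℚ (ℤ.+ 1 Rat./ suc k)))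

  -- The left-hand side is the recursion local to D⁻¹, which has no name
  -- here. D⁻¹ calls it at index 0; abstracting that 0 in D⁻¹-divide solves
  -- the underscore at every index.
  divide-unique : ∀ k p → _ ≡ divide k p
  D⁻¹-divide : ∀ p → drop 1 (D⁻¹ p) ≡ divide 0 p
  D⁻¹-divide p with ℕ.zero
  ... | k = divide-unique k p
  divide-unique k []      = ≡.refl
  divide-unique k (c ∷ p) = ≡.cong (_ ∷_) (divide-unique (suc k) p)

-- The integral formula for a polynomial

module LaplaceTransform (p : Polynomial) (x y z : ℂ) where
  private
    module ℝᶠ where
      open OrderedAlgebra RealAlgebra.ℝ-orderedAlgebra public
      open FiniteSums rawRing public
  open InverseDerivative
  open ComplexRing
  open Evaluation ℂ-commutativeRing
  open CommutativeRing ℂ-commutativeRing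
  open FiniteSums rawRing
  open OrderedAlgebra RealAlgebra.ℝ-orderedAlgebra using (ι)
  open RealAlgebra using (ι≡)
  open RealIntegral using (integrand; laplace-sum)
  open Estimates using (invFact; recip; invFact-suc)

  evaluate≡horner : ∀ {A : Set} (e e′ : A → ℂ) v → (∀ a → e a ≡ e′ a) → ∀ q → evaluate e v q ≡ horner e′ q v
  evaluate≡horner e e′ v e≡e′ []      = 0≡
  evaluate≡horner e e′ v e≡e′ (a ∷ q) = ≡.trans (+≡ (e a) (v * evaluate e v q))
    (≡.cong₂ (RawRing._+_ ℂ-rawRing) {e a} {e′ a} {v * evaluate e v q} {RawRing._*_ ℂ-rawRing v (horner e′ q v)} (e≡e′ a)
      (≡.trans (*≡ v (evaluate e v q))
        (≡.cong (RawRing._*_ ℂ-rawRing v) {evaluate e v q} {horner e′ q v} (evaluate≡horner e e′ v e≡e′ q))))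

  id-homo : PreservesOperations ℂ-rawRing id
  id-homo = record
    { +-homo = λ u v → reflexive (≡.sym (+≡ u v))
    ; *-homo = λ u v → reflexive (≡.sym (*≡ u v))
    ; 0-homo = reflexive (≡.sym 0≡)
    ; 1-homo = reflexive (≡.sym 1≡)
    }

  eval₁ : RawRing.Carrier ℂ[x]Poly.Poly-rawRing → ℂ
  eval₁ = evaluate id x

  eval₂ : RawRing.Carrier ℂ[x,y] → ℂ
  eval₂ = evaluate eval₁ y

  eval₃ : Polynomial → ℂ
  eval₃ = evaluate eval₂ z

  eval₃≡eval : ∀ q → eval₃ q ≡ eval q x y z
  eval₃≡eval = evaluate≡horner eval₂ (λ q → horner (λ u → horner id u x) q y) z
    (evaluate≡horner eval₁ (λ u → horner id u x) y (evaluate≡horner id id x (λ _ → ≡.refl)))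

  eval₂-homo : PreservesOperations ℂ[x,y] eval₂
  eval₂-homo = evaluate-homo (evaluate-homo id-homo x) y

  eval₂-constant : ∀ c → eval₂ (constant₂ c) ≈ c
  eval₂-constant c = trans (evaluate-const eval₁ y (c ∷ [])) (evaluate-const id x c)

  eval₃-constant : ∀ c → eval₃ (constant c) ≈ c
  eval₃-constant c = trans (evaluate-const eval₂ z (constant₂ c)) (eval₂-constant c)

  D⁻¹-power : ℕ → Polynomial
  D⁻¹-power = fold (RawRing.1# ℂ[x,y,z]) D⁻¹

  -- The offset `j` is the exponent carried by the head of the list. It grows along the recursion,
  -- so the induction needs it arbitrary, although the inverse derivative starts at 0.
  divide-monomial : ∀ {c k p} j → IsMonomial eval₂ c k p → IsMonomial eval₂ (eval₂ (reciprocal (k ℕ.+ j)) * c) k (divide j p)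
  divide-monomial {p = a ∷ []} j (leading a≈c) =
    leading (trans (PreservesOperations.*-homo eval₂-homo (reciprocal j) a) (*-congˡ a≈c))
  divide-monomial {c} {suc k} {a ∷ p} j (shifted a≈0 m) = shifted
    (trans (PreservesOperations.*-homo eval₂-homo (reciprocal j) a) (trans (*-congˡ a≈0) (zeroʳ _)))
    (≡.subst (λ i → IsMonomial eval₂ (eval₂ (reciprocal i) * c) k (divide (suc j) p)) (ℕₚ.+-suc k j) (divide-monomial (suc j) m))

  weight : ℕ → ℂ
  weight k = fromℝ (ι (invFact k))

  weight-suc : ∀ k → eval₂ (reciprocal (k ℕ.+ 0)) * weight k ≈ weight (suc k)
  weight-suc k = begin
    eval₂ (reciprocal (k ℕ.+ 0)) * weight k   ≡⟨ ≡.cong (λ j → eval₂ (reciprocal j) * weight k) (ℕₚ.+-identityʳ k) ⟩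
    eval₂ (reciprocal k) * weight k           ≈⟨ *-congʳ (eval₂-constant (fromRational (recip k))) ⟩
    fromRational (recip k) * weight k         ≡⟨ ≡.cong (λ q → fromℝ q * weight k) (ι≡ (recip k)) ⟨
    fromℝ (ι (recip k)) * weight k            ≈⟨ *-homo (ι (recip k)) (ι (invFact k)) ⟨
    fromℝ (ι (recip k) ℝᶠ.* ι (invFact k))     ≈⟨ fromℝ-cong (ℝᶠ.ι-* (recip k) (invFact k)) ⟨
    fromℝ (ι (recip k Rat.* invFact k))       ≡⟨ ≡.cong (λ q → fromℝ (ι q)) (invFact-suc k) ⟨
    weight (suc k)                            ∎
    where
      open PreservesOperations fromℝ-homo
      open SetoidReasoning setoid

  D⁻¹-power-monomial : ∀ k → IsMonomial eval₂ (weight k) k (D⁻¹-power k)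
  D⁻¹-power-monomial zero    = leading (trans (PreservesOperations.1-homo eval₂-homo)
    (trans (sym (PreservesOperations.1-homo fromℝ-homo)) (fromℝ-cong (ℝᶠ.sym ℝᶠ.ι-1))))
  D⁻¹-power-monomial (suc k) = shifted (PreservesOperations.0-homo eval₂-homo)
    (≡.subst (IsMonomial eval₂ (weight (suc k)) k) (≡.sym (D⁻¹-divide (D⁻¹-power k)))
      (monomial-resp-≈ (weight-suc k)
        (divide-monomial 0 (D⁻¹-power-monomial k))))

  n : ℕ
  n = length p

  c : ℕ → ℂ
  c k = eval₂ (ℂ[xyz]Poly.coeff p k) * z ^ k

  eval-sum : eval p x y z ≈ ∑ n c
  eval-sum = trans (reflexive (≡.sym (eval₃≡eval p))) (evaluate-∑ eval₂-homo z p)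

  eval-substD⁻¹ : ∀ s → eval (substD⁻¹ p s) x y z ≈ ∑ n (λ k → c k * (s ^ k * weight k))
  eval-substD⁻¹ s = trans (reflexive (≡.sym (eval₃≡eval (substD⁻¹ p s))))
    (evaluate-substitution eval₂-homo z p (constant s) D⁻¹-power (eval₃-constant s) D⁻¹-power-monomial)

  laplaceIntegrand-sum : ∀ τ → laplaceIntegrand p x y z τ ≈ ∑ n (λ k → c k * fromℝ (integrand k τ))
  laplaceIntegrand-sum τ = begin
    laplaceIntegrand p x y z τ
      ≡⟨ integrand≡ (eval (substD⁻¹ p (fromℝ τ)) x y z) ⟨
    fromℝ (Real.exp (ℝᶠ.- τ)) * eval (substD⁻¹ p (fromℝ τ)) x y z
      ≈⟨ *-congˡ (eval-substD⁻¹ (fromℝ τ)) ⟩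
    fromℝ (Real.exp (ℝᶠ.- τ)) * ∑ n (λ k → c k * (fromℝ τ ^ k * weight k))
      ≈⟨ scaled-power-sum fromℝ-homo n (Real.exp (ℝᶠ.- τ)) τ c (λ k → ι (invFact k)) ⟩
    ∑ n (λ k → c k * fromℝ (integrand k τ)) ∎
    where
      open SetoidReasoning setoid
      exp≡ : Real.exp (ℝᶠ.- τ) ≡ RealAnalysis.exp (RawRing.-_ ℝ-rawRing τ)
      exp≡ = ≡.trans (RealAlgebra.exp≡ (ℝᶠ.- τ))
        (≡.cong RealAnalysis.exp {ℝᶠ.- τ} {RawRing.-_ ℝ-rawRing τ} (RealAlgebra.-≡ τ))
      integrand≡ : ∀ v → fromℝ (Real.exp (ℝᶠ.- τ)) * v
        ≡ RawRing._*_ ℂ-rawRing (fromℝ (RealAnalysis.exp (RawRing.-_ ℝ-rawRing τ))) v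
      integrand≡ v = ≡.trans (*≡ (fromℝ (Real.exp (ℝᶠ.- τ))) v)
        (≡.cong (λ e → RawRing._*_ ℂ-rawRing (fromℝ e) v)
          {Real.exp (ℝᶠ.- τ)} {RealAnalysis.exp (RawRing.-_ ℝ-rawRing τ)} exp≡)

  -- Each summand is `c k`, constant in s, times a real function of integral 1. The real and
  -- imaginary parts of the `c k` are thus the coefficients of two real integrals, whose values are
  -- the parts of p(x, y, z).
  laplace-integral : IsComplexIntegral₀^∞ (laplaceIntegrand p x y z) (eval p x y z)
  laplace-integral =
      laplace-sum n (λ k → re (c k)) (λ τ → ℝᶠ.trans (ℝᶠ.sym (re-∑-scaled τ)) (ℝᶠ.sym (re-≈ (laplaceIntegrand-sum τ))))
        (ℝᶠ.trans (ℝᶠ.reflexive (≡.sym (re-∑ n c))) (ℝᶠ.sym (re-≈ eval-sum)))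
    , laplace-sum n (λ k → im (c k)) (λ τ → ℝᶠ.trans (ℝᶠ.sym (im-∑-scaled τ)) (ℝᶠ.sym (im-≈ (laplaceIntegrand-sum τ))))
        (ℝᶠ.trans (ℝᶠ.reflexive (≡.sym (im-∑ n c))) (ℝᶠ.sym (im-≈ eval-sum)))
    where
      open Evaluation RealAlgebra.ℝ-commutativeRing using () renaming (∑-cong to ∑-congᴿ)
      re-∑-scaled : ∀ τ → re (∑ n λ k → c k * fromℝ (integrand k τ)) ℝᶠ.≈ ℝᶠ.∑ n (λ k → re (c k) ℝᶠ.* integrand k τ)
      re-∑-scaled τ = ℝᶠ.trans (ℝᶠ.reflexive (re-∑ n (λ k → c k * fromℝ (integrand k τ))))
        (∑-congᴿ n λ k → re-*-fromℝ (c k) (integrand k τ))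
      im-∑-scaled : ∀ τ → im (∑ n λ k → c k * fromℝ (integrand k τ)) ℝᶠ.≈ ℝᶠ.∑ n (λ k → im (c k) ℝᶠ.* integrand k τ)
      im-∑-scaled τ = ℝᶠ.trans (ℝᶠ.reflexive (im-∑ n (λ k → c k * fromℝ (integrand k τ))))
        (∑-congᴿ n λ k → im-*-fromℝ (c k) (integrand k τ))

open import Data.Nat using (_≤_)

theorem4p5 : (f g : ComplexSeries) → IsDelta f → IsInvertible g →
    (r : ℕ) → 1 ≤ r →
    (s : ℕ → Polynomial) → IsLegendreGouldHopperSheffer g f r s →
    (n : ℕ) (x y z : ℂ) →
    IsComplexIntegral₀^∞ (laplaceIntegrand (s n) x y z) (eval (s n) x y z)
theorem4p5 _ _ _ _ _ _ s _ n x y z = LaplaceTransform.laplace-integral (s n) x y z
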